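{- Let $G$ be a connected graph with minimum degree at least $2$ and let $Q\in\mathbb{R}^{k\times k}$ be an orthogonal matrix with no integral rows. Suppose that $G$ has a non-isomorphic cospectral mate $H$ obtained from $G$ by a $Q$-switching. Then $G$ has a connected subgraph with at most $2k+1$ vertices and strictly more edges than vertices.
   Context: Let $G$ be a graph on $n$ vertices and $Q$ a $k\times k$ real orthogonal matrix no row of which is integral (equivalently, no row of $Q$ is of the form $\pm$ a standard basis vector). A graph $H$ is obtained from $G$ by a $Q$-switching with switching set $X$ ($|X|=k$) if, identifying the vertex sets of $G$ and $H$ via some bijection and ordering the vertices with those of $X$ first, the adjacency matrices satisfy $A_H=D^{T}A_GD$ with $D=Q\oplus E$, where $E$ is an $(n-k)\times(n-k)$ diagonal matrix with diagonal entries in $\{1,-1\}$. A cospectral mate is a non-isomorphic graph with the same adjacency spectrum. -}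

module Defs where

open import Level using (0ℓ)
open import Data.Bool using (Bool; true; false; if_then_else_; _∧_)
open import Data.Nat as ℕ using (ℕ; zero; suc; _≤_; _<_; _<ᵇ_)
open import Data.Fin as Fin using (Fin; toℕ; splitAt; _≟_)
open import Data.Fin.Permutation using (Permutation′; _⟨$⟩ʳ_)
open import Data.Sum using (_⊎_; inj₁; inj₂)
open import Data.Product using (Σ; ∃; ∃-syntax; _×_; _,_)
open import Relation.Nullary using (¬_; yes; no)
open import Relation.Binary.PropositionalEquality using (_≡_)
open import Relation.Binary.Structures using (IsStrictTotalOrder)
open import Algebra.Bundles using (CommutativeRing)

record Graph (n : ℕ) : Set where
  field
    adj    : Fin n → Fin n → Bool
    sym    : ∀ u v → adj u v ≡ adj v u
    irrefl : ∀ u → adj u u ≡ false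
open Graph public

countFin : (n : ℕ) → (Fin n → Bool) → ℕ
countFin zero    p = 0
countFin (suc n) p = (if p Fin.zero then 1 else 0) ℕ.+ countFin n (λ i → p (Fin.suc i))

degree : ∀ {n} → Graph n → Fin n → ℕ
degree G v = countFin _ (λ u → adj G v u)

MinDegreeAtLeast : ∀ {n} → ℕ → Graph n → Set
MinDegreeAtLeast d G = ∀ v → d ≤ degree G v

data Walk {n : ℕ} (E : Fin n → Fin n → Bool) : Fin n → Fin n → Set where
  here : ∀ {u} → Walk E u u
  step : ∀ {u v w} → E u v ≡ true → Walk E v w → Walk E u w

Connected : ∀ {n} → Graph n → Set
Connected {n} G = (0 < n) × (∀ u v → Walk (adj G) u v)

Isomorphic : ∀ {n} → Graph n → Graph n → Set
Isomorphic {n} G H = Σ (Permutation′ n) λ σ → ∀ u v → adj H (σ ⟨$⟩ʳ u) (σ ⟨$⟩ʳ v) ≡ adj G u v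

record Subgraph {n : ℕ} (G : Graph n) : Set where
  field
    vert      : Fin n → Bool
    edge      : Fin n → Fin n → Bool
    edge-sym  : ∀ u v → edge u v ≡ edge v u
    edge-adj  : ∀ u v → edge u v ≡ true → adj G u v ≡ true
    edge-vert : ∀ u v → edge u v ≡ true → vert u ≡ true
open Subgraph public

numVertices : ∀ {n} {G : Graph n} → Subgraph G → ℕ
numVertices {n} S = countFin n (vert S)

-- each edge {u,v} counted once, via the pair with toℕ u < toℕ v
numEdges : ∀ {n} {G : Graph n} → Subgraph G → ℕ
numEdges {n} S = sumEdges
  where
  sumFin : (m : ℕ) → (Fin m → ℕ) → ℕ
  sumFin zero    f = 0
  sumFin (suc m) f = f Fin.zero ℕ.+ sumFin m (λ i → f (Fin.suc i))
  sumEdges = sumFin n (λ u → countFin n (λ v → edge S u v ∧ (toℕ u <ᵇ toℕ v)))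

SubgraphConnected : ∀ {n} {G : Graph n} → Subgraph G → Set
SubgraphConnected {n} S =
  ∀ u v → vert S u ≡ true → vert S v ≡ true → Walk (edge S) u v

-- The real numbers, axiomatised as a Dedekind-complete ordered field
-- (unique up to isomorphism, so quantifying over all models is the
-- same as stating the result over ℝ).

record RealField : Set₁ where
  field
    commutativeRing : CommutativeRing 0ℓ 0ℓ
  open CommutativeRing commutativeRing public
  field
    _<ᴿ_          : Carrier → Carrier → Set
    isStrictTotal : IsStrictTotalOrder _≈_ _<ᴿ_
    0≉1           : ¬ (0# ≈ 1#)
    inverse       : ∀ x → ¬ (x ≈ 0#) → ∃ λ y → x * y ≈ 1#
    +-mono-<      : ∀ {x y} z → x <ᴿ y → (x + z) <ᴿ (y + z)
    *-pos         : ∀ {x y} → 0# <ᴿ x → 0# <ᴿ y → 0# <ᴿ (x * y)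
    complete      : (P : Carrier → Set) → ∃ P →
                    (∃ λ b → ∀ x → P x → ¬ (b <ᴿ x)) →
                    ∃ λ s → (∀ x → P x → ¬ (s <ᴿ x)) ×
                            (∀ b → (∀ x → P x → ¬ (b <ᴿ x)) → ¬ (b <ᴿ s))

module _ (ℝ : RealField) where
  open RealField ℝ

  Matrix : ℕ → ℕ → Set
  Matrix r c = Fin r → Fin c → Carrier

  sumℝ : (m : ℕ) → (Fin m → Carrier) → Carrier
  sumℝ zero    f = 0#
  sumℝ (suc m) f = f Fin.zero + sumℝ m (λ i → f (Fin.suc i))

  identity : ∀ {k} → Matrix k k
  identity i j with i ≟ j
  ... | yes _ = 1#
  ... | no  _ = 0#

  Orthogonal : ∀ {k} → Matrix k k → Set
  Orthogonal {k} Q = ∀ i j → sumℝ k (λ l → Q l i * Q l j) ≈ identity i j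

  natℝ : ℕ → Carrier
  natℝ zero    = 0#
  natℝ (suc m) = 1# + natℝ m

  IsInteger : Carrier → Set
  IsInteger x = ∃ λ m → (x ≈ natℝ m) ⊎ (x ≈ - natℝ m)

  IntegralRow : ∀ {k} → Matrix k k → Fin k → Set
  IntegralRow Q i = ∀ j → IsInteger (Q i j)

  NoIntegralRows : ∀ {k} → Matrix k k → Set
  NoIntegralRows Q = ∀ i → ¬ IntegralRow Q i

  adjMatrix : ∀ {n} → Graph n → Matrix n n
  adjMatrix G u v = if adj G u v then 1# else 0#

  directSum : ∀ {k m} → Matrix k k → (Fin m → Bool) → Matrix (k ℕ.+ m) (k ℕ.+ m)
  directSum {k} Q E i j with splitAt k i | splitAt k j
  ... | inj₁ a | inj₁ b = Q a b
  ... | inj₂ a | inj₂ b with a ≟ b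
  ...   | yes _ = if E a then 1# else - 1#
  ...   | no  _ = 0#
  directSum Q E i j | inj₁ _ | inj₂ _ = 0#
  directSum Q E i j | inj₂ _ | inj₁ _ = 0#

  conj : ∀ {n} → Matrix n n → Matrix n n → Matrix n n
  conj {n} D A i j = sumℝ n (λ a → sumℝ n (λ b → D a i * (A a b * D b j)))

  -- H is obtained from G by a Q-switching (switching set of size k):
  -- orderings π of V(G) and ψ of V(H) (the identification V(H) ≅ V(G)
  -- composed with an ordering of V(G) putting the switching set first)
  -- and a ±1 diagonal E with A_H = Dᵀ A_G D, D = Q ⊕ E.
  QSwitching : ∀ {k m} → Matrix k k → Graph (k ℕ.+ m) → Graph (k ℕ.+ m) → Set
  QSwitching {k} {m} Q G H =
    Σ (Permutation′ (k ℕ.+ m)) λ π →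
    Σ (Permutation′ (k ℕ.+ m)) λ ψ →
    Σ (Fin m → Bool) λ E →
      ∀ i j → adjMatrix H (ψ ⟨$⟩ʳ i) (ψ ⟨$⟩ʳ j)
              ≈ conj (directSum Q E) (λ a b → adjMatrix G (π ⟨$⟩ʳ a) (π ⟨$⟩ʳ b)) i j

{-# OPTIONS --safe #-}
-- Let X be the switching set and a the graph formed by the edges of G that meet X.  A vertex outside X with exactly one
-- neighbour in X would exhibit an integral row of Q, so every vertex has a-degree 0 or at least 2.  If more than 2k+1
-- vertices have positive a-degree, then X together with k+1 of them outside X spans more edges than vertices; if at most
-- 2k+1 do, then a itself does, unless it is a disjoint union of cycles.  One of its components then has more
-- edges than vertices.
--
-- In the remaining case G and H are isomorphic.  The matrix D intertwines a with the analogous graph h of H.  The vector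
-- D1 annihilates the Laplacian form of a, so h has the same degrees as a and is a union of cycles too.  Since D is ±1 on
-- vertices outside X, the operators σᵗ + σ⁻ᵗ (σ a rotation of the cycles), which are polynomials in the adjacency
-- matrices, show that such vertices lie at the same distances along the cycles of a and of h.  Rotating each cycle of a
-- onto a cycle of h so that these vertices are fixed extends to an isomorphism that is the identity outside X.  If X is
-- everything, both graphs are single cycles.  Choosing bases and orientations is
-- classical, which is harmless: that G and H are isomorphic is only needed up to ¬¬.
module Submission where

open import Defs renaming (sym to adj-sym; irrefl to adj-irrefl)
open import Data.Bool using (Bool; true; false; if_then_else_; _∧_; _∨_; not)
open import Data.Bool.Properties
  using (∧-comm; ∧-identityʳ; ∧-zeroʳ; ∧-conicalˡ; ∧-conicalʳ; ∨-comm; ∨-zeroʳ; ∨-conicalˡ; ∨-conicalʳ; ¬-not)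
  renaming (_≟_ to _≟ᵇ_)
open import Data.Empty using (⊥; ⊥-elim)
open import Data.Fin using (Fin; zero; suc; toℕ; splitAt; punchOut; _↑ˡ_; _↑ʳ_; _≟_)
open import Data.Fin.Permutation
  using (Permutation′; _⟨$⟩ʳ_; _⟨$⟩ˡ_; permutation; flip; _∘ₚ_; inverseˡ; inverseʳ)
open import Data.Fin.Properties
  using (any?; toℕ-injective; injective⇒≤; punchOut-injective; splitAt-↑ˡ; splitAt-↑ʳ; splitAt⁻¹-↑ˡ; splitAt⁻¹-↑ʳ;
         ↑ˡ-injective; ↑ʳ-injective) renaming (suc-injective to Fin-suc-injective)
open import Data.Integer as ℤ using (ℤ; +_; -[1+_]; 0ℤ; 1ℤ; -1ℤ)
import Data.Integer.Properties as ℤ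
open import Data.Integer.Tactic.RingSolver using () renaming (solve-∀ to solve-ℤ)
open import Data.Maybe as Maybe using (Maybe; just; nothing)
open import Data.Maybe.Properties using (just-injective)
open import Data.Nat using (ℕ; zero; suc; _+_; _*_; _≤_; _<_; z≤n; s≤s; _<ᵇ_; _≤?_; _<?_)
open import Data.Nat.Properties
  using (+-*-semiring; +-comm; +-suc; +-identityʳ; *-distribˡ-+; suc-injective; +-cancelˡ-≡; *-cancelˡ-≡;
         ≤-refl; ≤-reflexive; ≤-trans; ≤-antisym; ≤-pred; <⇒≤; <-irrefl; ≰⇒>; ≮⇒≥; n≮0; n≤0⇒n≡0; m≤m+n;
         +-mono-≤; +-monoʳ-≤; +-cancelˡ-≤; +-cancelʳ-≤; +-cancelˡ-<; *-cancelˡ-<; module ≤-Reasoning)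
open import Data.Nat.Tactic.RingSolver using (solve-∀)
open import Data.Product using (Σ; ∃; _×_; _,_; proj₁; proj₂; map₂)
open import Data.Sum using (_⊎_; inj₁; inj₂; [_,_]′)
open import Function using (_∘_; id)
open import Relation.Binary.PropositionalEquality
  using (_≡_; _≢_; refl; sym; trans; cong; cong₂; subst; subst₂; module ≡-Reasoning)
open import Relation.Binary.Definitions using (tri<; tri≈; tri>)
open import Relation.Binary.Structures using (IsStrictTotalOrder)
open import Relation.Nullary using (¬_; Dec; yes; no; contradiction; ⌊_⌋; does)
open import Relation.Nullary.Decidable using (_×-dec_; dec-true; dec-false; decidable-stable; ¬¬-excluded-middle)
import Algebra.Properties.Ring
import Algebra.Properties.Semiring.Sum
import Algebra.Solver.Ring.NaturalCoefficients.Default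
import Relation.Binary.Reasoning.Setoid

open Algebra.Properties.Semiring.Sum +-*-semiring
  using ()
  renaming (sum to ∑; sum-cong-≗ to ∑-cong; ∑-distrib-+ to ∑-+; ∑-comm to ∑-swap; sum-permute to ∑-permute;
            *-distribˡ-sum to ∑-*ˡ)

-- The edges that miss X form an arbitrary graph common to G and H, so an isomorphism is only under
-- control if it fixes every vertex outside X. This is why distances along the cycles, and not
-- merely cycle lengths, have to be recovered from D. A lone neighbour x in X of an outside vertex
-- makes a column of A_H, restricted to X, equal up to sign to row x of Q, so this row has entries 0
-- and ±1. The size 2k + 1 is k + (k + 1): the k + 1 outside vertices send at least two edges each
-- into X, which makes at least 2k + 2. The operator σᵗ + σ⁻ᵗ locates a vertex only up to the sign
-- of t, so the direction of each cycle has to be reconstructed from one common vertex that is not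
-- its own mirror image. Connectedness of G ensures that every cycle contains a vertex outside X,
-- unless X is everything.

-- Counting Boolean subsets of a finite set

true≢false : ∀ {b} → b ≡ true → b ≡ false → ⊥
true≢false refl ()

#_ : Bool → ℕ
# b = if b then 1 else 0

countFin-∑ : ∀ n (p : Fin n → Bool) → countFin n p ≡ ∑ (λ i → # p i)
countFin-∑ zero    p = refl
countFin-∑ (suc n) p = cong (_+_ (# p zero)) (countFin-∑ n (p ∘ suc))

count-cong : ∀ {n} {p q : Fin n → Bool} → (∀ i → p i ≡ q i) → countFin n p ≡ countFin n q
count-cong {zero}  p≗q = refl
count-cong {suc n} p≗q = cong₂ (λ b c → # b + c) (p≗q zero) (count-cong (p≗q ∘ suc))

_⊆_ : ∀ {n} → (Fin n → Bool) → (Fin n → Bool) → Set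
p ⊆ q = ∀ i → p i ≡ true → q i ≡ true

#-mono : ∀ {a b} → (a ≡ true → b ≡ true) → # a ≤ # b
#-mono {false} a⇒b = z≤n
#-mono {true}  a⇒b rewrite a⇒b refl = ≤-refl

count-mono : ∀ {n} {p q : Fin n → Bool} → p ⊆ q → countFin n p ≤ countFin n q
count-mono {zero}  p⊆q = z≤n
count-mono {suc n} p⊆q = +-mono-≤ (#-mono (p⊆q zero)) (count-mono (p⊆q ∘ suc))

_without_ : ∀ {n} → (Fin n → Bool) → Fin n → (Fin n → Bool)
(p without x) i = p i ∧ not ⌊ i ≟ x ⌋

count-without : ∀ {n} (p : Fin n → Bool) x → p x ≡ true → countFin n p ≡ suc (countFin n (p without x))
count-without p zero px rewrite px =
  cong suc (count-cong λ i → sym (∧-trueʳ (p (suc i))))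
  where
  ∧-trueʳ : ∀ b → b ∧ true ≡ b
  ∧-trueʳ false = refl
  ∧-trueʳ true  = refl
count-without p (suc x) px = begin
  # p zero + countFin _ (p ∘ suc)                        ≡⟨ cong (_+_ (# p zero)) (count-without (p ∘ suc) x px) ⟩
  # p zero + suc (countFin _ ((p ∘ suc) without x))      ≡⟨ +-suc _ _ ⟩
  suc (# p zero + countFin _ ((p ∘ suc) without x))      ≡⟨ cong suc (cong₂ (λ b c → # b + c) (lemma (p zero)) (count-cong λ i → cong (p (suc i) ∧_) (cong not (≟-suc i)))) ⟩
  suc (countFin _ (p without suc x))                     ∎
  where
  open ≡-Reasoning
  lemma : ∀ b → b ≡ b ∧ true
  lemma false = refl
  lemma true  = refl
  ≟-suc : ∀ i → ⌊ i ≟ x ⌋ ≡ ⌊ suc i ≟ suc x ⌋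
  ≟-suc i with i ≟ x
  ... | yes _ = refl
  ... | no  _ = refl

without-true : ∀ {n} (p : Fin n → Bool) {x i} → p i ≡ true → i ≢ x → (p without x) i ≡ true
without-true p {x} {i} pi i≢x with i ≟ x
... | yes i≡x = contradiction i≡x i≢x
... | no  _   = trans (∧-comm (p i) true) pi

without-≢ : ∀ {n} (p : Fin n → Bool) {x i} → (p without x) i ≡ true → p i ≡ true × i ≢ x
without-≢ p {x} {i} h with i ≟ x
... | yes _   = contradiction (∧-conicalʳ (p i) false h) λ ()
... | no  i≢x = ∧-conicalˡ (p i) true h , i≢x

count-witness : ∀ {n} (p : Fin n → Bool) → 0 < countFin n p → ∃ λ i → p i ≡ true
count-witness {suc n} p 0<c with p zero in p0
... | true  = zero , p0
... | false with i , pi ← count-witness (p ∘ suc) 0<c = suc i , pi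

count≡0 : ∀ {n} {p : Fin n → Bool} → countFin n p ≡ 0 → ∀ i → p i ≡ false
count≡0 {p = p} c≡0 i with p i in pi
... | false = refl
... | true  with () ← trans (sym c≡0) (count-without p i pi)

count-member : ∀ {n} (p : Fin n → Bool) {i} → p i ≡ true → 0 < countFin n p
count-member p pi = subst (0 <_) (sym (count-without p _ pi)) (s≤s z≤n)

count≡1-unique : ∀ {n} (p : Fin n → Bool) → countFin n p ≡ 1 → ∃ λ x → p x ≡ true × (∀ i → p i ≡ true → i ≡ x)
count≡1-unique p c≡1 with x , px ← count-witness p (subst (0 <_) (sym c≡1) (s≤s z≤n)) = x , px , unique
  where
  unique : ∀ i → p i ≡ true → i ≡ x
  unique i pi with i ≟ x
  ... | yes i≡x = i≡x
  ... | no  i≢x = ⊥-elim (true≢false (without-true p pi i≢x)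
                    (count≡0 (suc-injective (trans (sym (count-without p x px)) c≡1)) i))

count≡2-other : ∀ {n} (p : Fin n → Bool) → countFin n p ≡ 2 → ∀ x → p x ≡ true →
                ∃ λ y → p y ≡ true × y ≢ x × (∀ i → p i ≡ true → i ≡ x ⊎ i ≡ y)
count≡2-other p c≡2 x px
  with y , py , unique ← count≡1-unique (p without x) (suc-injective (trans (sym (count-without p x px)) c≡2))
  = y , proj₁ (without-≢ p py) , proj₂ (without-≢ p py) , only
  where
  only : ∀ i → p i ≡ true → i ≡ x ⊎ i ≡ y
  only i pi with i ≟ x
  ... | yes i≡x = inj₁ i≡x
  ... | no  i≢x = inj₂ (unique i (without-true p pi i≢x))

count-permute : ∀ {n} (π : Permutation′ n) (p : Fin n → Bool) → countFin n (λ i → p (π ⟨$⟩ʳ i)) ≡ countFin n p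
count-permute {n} π p = begin
  countFin n (λ i → p (π ⟨$⟩ʳ i)) ≡⟨ countFin-∑ n _ ⟩
  ∑ (λ i → # p (π ⟨$⟩ʳ i))        ≡⟨ ∑-permute (λ i → # p i) π ⟨
  ∑ (λ i → # p i)                 ≡⟨ countFin-∑ n p ⟨
  countFin n p                    ∎
  where open ≡-Reasoning

-- Members of `q` outside `p` can be left out one at a time. This cuts the support of a graph down
-- to a set of prescribed size that still contains X.
between : ∀ {n} {p q : Fin n → Bool} c → p ⊆ q → countFin n p ≤ c → c ≤ countFin n q →
          ∃ λ r → p ⊆ r × r ⊆ q × countFin n r ≡ c
between {zero}  {p} c p⊆q _ c≤0 = p , (λ i → id) , p⊆q , sym (n≤0⇒n≡0 c≤0)
between {suc n} {p} {q} c p⊆q p≤c c≤q with p zero in p0 | q zero in q0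
between {suc n} {p} {q} zero    p⊆q () c≤q | true | _
between {suc n} {p} {q} c       p⊆q p≤c c≤q | true | false = ⊥-elim (true≢false (p⊆q zero p0) q0)
between {suc n} {p} {q} (suc c) p⊆q (s≤s p≤c) (s≤s c≤q) | true | true
  with r , p⊆r , r⊆q , eq ← between {p = p ∘ suc} {q ∘ suc} c (p⊆q ∘ suc) p≤c c≤q
  = (λ { zero → true ; (suc i) → r i }) , (λ { zero _ → refl ; (suc i) → p⊆r i }) ,
    (λ { zero _ → q0 ; (suc i) → r⊆q i }) , cong suc eq
between {suc n} {p} {q} c p⊆q p≤c c≤q | false | false
  with r , p⊆r , r⊆q , eq ← between {p = p ∘ suc} {q ∘ suc} c (p⊆q ∘ suc) p≤c c≤q
  = (λ { zero → false ; (suc i) → r i }) , (λ { zero h → ⊥-elim (true≢false h p0) ; (suc i) → p⊆r i }) ,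
    (λ { zero () ; (suc i) → r⊆q i }) , eq
between {suc n} {p} {q} c p⊆q p≤c c≤q | false | true with c ≤? countFin n (q ∘ suc)
... | yes c≤q′ with r , p⊆r , r⊆q , eq ← between {p = p ∘ suc} {q ∘ suc} c (p⊆q ∘ suc) p≤c c≤q′
  = (λ { zero → false ; (suc i) → r i }) , (λ { zero h → ⊥-elim (true≢false h p0) ; (suc i) → p⊆r i }) ,
    (λ { zero () ; (suc i) → r⊆q i }) , eq
-- The rest of `q` has fewer than `c` members, so `c` is the full size of `q` and nothing may be
-- dropped.
... | no c≰q′ = q , p⊆q , (λ i → id) , trans (cong (λ b → # b + countFin n (q ∘ suc)) q0) (≤-antisym (≰⇒> c≰q′) c≤q)

∑-mono : ∀ {n} {f g : Fin n → ℕ} → (∀ i → f i ≤ g i) → ∑ f ≤ ∑ g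
∑-mono {zero}  f≤g = z≤n
∑-mono {suc n} f≤g = +-mono-≤ (f≤g zero) (∑-mono (f≤g ∘ suc))

-- No slack in the total leaves no slack at any index. This turns the failure of density into exact
-- degrees.
∑-mono-eq : ∀ {n} {f g : Fin n → ℕ} → (∀ i → f i ≤ g i) → ∑ g ≤ ∑ f → ∀ i → f i ≡ g i
∑-mono-eq {suc n} {f} {g} f≤g ∑g≤∑f zero = ≤-antisym (f≤g zero)
  (+-cancelʳ-≤ (∑ (f ∘ suc)) (g zero) (f zero) (≤-trans (+-monoʳ-≤ (g zero) (∑-mono (f≤g ∘ suc))) ∑g≤∑f))
∑-mono-eq {suc n} {f} {g} f≤g ∑g≤∑f (suc i) = ∑-mono-eq (f≤g ∘ suc)
  (+-cancelˡ-≤ (g zero) _ _ (≤-trans ∑g≤∑f (+-mono-≤ (f≤g zero) ≤-refl))) i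

-- Walks, components and dense connected subgraphs

Rel : ℕ → Set
Rel n = Fin n → Fin n → Bool

Symmetric Irreflexive : ∀ {n} → Rel n → Set
Symmetric   r = ∀ u v → r u v ≡ r v u
Irreflexive r = ∀ u → r u u ≡ false

_on_ : ∀ {n} → Rel n → (Fin n → Bool) → Rel n
(r on T) u v = (T u ∧ T v) ∧ r u v

∧-true : ∀ {a b} → a ≡ true → b ≡ true → a ∧ b ≡ true
∧-true refl refl = refl

on-left : ∀ {n} {r : Rel n} {T u v} → (r on T) u v ≡ true → T u ≡ true
on-left {T = T} {u} {v} h = ∧-conicalˡ (T u) (T v) (∧-conicalˡ (T u ∧ T v) _ h)

on-rel : ∀ {n} {r : Rel n} {T u v} → (r on T) u v ≡ true → r u v ≡ true
on-rel {T = T} {u} {v} h = ∧-conicalʳ (T u ∧ T v) _ h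

on-sym : ∀ {n} {r : Rel n} {T} → Symmetric r → Symmetric (r on T)
on-sym {T = T} r-sym u v = cong₂ _∧_ (∧-comm (T u) (T v)) (r-sym u v)

-- Twice the number of edges for a symmetric loopless relation. Density is always stated as 2 ·
-- vertices < `degSum`, which avoids halving and ordering the ends of an edge.
degSum : ∀ {n} → Rel n → ℕ
degSum r = ∑ λ u → ∑ λ v → # r u v

walk-map : ∀ {n m} {r : Rel n} {s : Rel m} (f : Fin n → Fin m) → (∀ u v → r u v ≡ true → s (f u) (f v) ≡ true) →
           ∀ {u v} → Walk r u v → Walk s (f u) (f v)
walk-map f r⇒s here       = here
walk-map f r⇒s (step e w) = step (r⇒s _ _ e) (walk-map f r⇒s w)

walk-++ : ∀ {n} {r : Rel n} {u v w} → Walk r u v → Walk r v w → Walk r u w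
walk-++ here       q = q
walk-++ (step e p) q = step e (walk-++ p q)

walk-snoc : ∀ {n} {r : Rel n} {u v w} → Walk r u v → r v w ≡ true → Walk r u w
walk-snoc p e = walk-++ p (step e here)

walk-reverse : ∀ {n} {r : Rel n} → Symmetric r → ∀ {u v} → Walk r u v → Walk r v u
walk-reverse r-sym here       = here
walk-reverse r-sym (step e p) = walk-snoc (walk-reverse r-sym p) (trans (r-sym _ _) e)

ConnectedOn : ∀ {n} → Rel n → (Fin n → Bool) → Set
ConnectedOn r C = ∀ u v → C u ≡ true → C v ≡ true → Walk (r on C) u v

insert : ∀ {n} → Fin n → (Fin n → Bool) → (Fin n → Bool)
insert x C i = C i ∨ ⌊ i ≟ x ⌋

insert-self : ∀ {n} x (C : Fin n → Bool) → insert x C x ≡ true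
insert-self x C with x ≟ x
... | yes _   = ∨-zeroʳ (C x)
... | no  x≢x = contradiction refl x≢x

⊆-insert : ∀ {n} x (C : Fin n → Bool) → C ⊆ insert x C
⊆-insert x C i Ci rewrite Ci = refl

insert-elim : ∀ {n} x (C : Fin n → Bool) i → insert x C i ≡ true → C i ≡ true ⊎ i ≡ x
insert-elim x C i h with C i | i ≟ x
... | true  | _       = inj₁ refl
... | false | yes i≡x = inj₂ i≡x

count-insert : ∀ {n} x (C : Fin n → Bool) → C x ≡ false → countFin n (insert x C) ≡ suc (countFin n C)
count-insert x C Cx = trans (count-without (insert x C) x (insert-self x C)) (cong suc (count-cong same))
  where
  same : ∀ i → (insert x C without x) i ≡ C i
  same i with i ≟ x
  same i | yes refl rewrite Cx = refl
  same i | no _ with C i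
  ... | true  = refl
  ... | false = refl

∸ᵇ-count : ∀ {n} {C T : Fin n → Bool} → C ⊆ T → countFin n T ≡ countFin n C + countFin n (λ i → T i ∧ not (C i))
∸ᵇ-count {n} {C} {T} C⊆T = begin
  countFin n T                                                   ≡⟨ countFin-∑ n T ⟩
  ∑ (λ i → # T i)                                                ≡⟨ ∑-cong pointwise ⟩
  ∑ (λ i → # C i + # (T i ∧ not (C i)))                          ≡⟨ ∑-+ (λ i → # C i) _ ⟩
  ∑ (λ i → # C i) + ∑ (λ i → # (T i ∧ not (C i)))                ≡⟨ cong₂ _+_ (countFin-∑ n C) (countFin-∑ n _) ⟨
  countFin n C + countFin n (λ i → T i ∧ not (C i))              ∎
  where
  open ≡-Reasoning
  pointwise : ∀ i → # T i ≡ # C i + # (T i ∧ not (C i))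
  pointwise i with C i in Ci | T i in Ti
  ... | true  | true  = refl
  ... | true  | false = ⊥-elim (true≢false (C⊆T i Ci) Ti)
  ... | false | true  = refl
  ... | false | false = refl

∑∑-+ : ∀ {m n} (f g : Fin m → Fin n → ℕ) →
       ∑ (λ i → ∑ (λ j → f i j + g i j)) ≡ ∑ (λ i → ∑ (f i)) + ∑ (λ i → ∑ (g i))
∑∑-+ f g = trans (∑-cong λ i → ∑-+ (f i) (g i)) (∑-+ (λ i → ∑ (f i)) (λ i → ∑ (g i)))

module _ {n : ℕ} {r : Rel n} (r-sym : Symmetric r) where

  -- The component of `x` in `r on T`. The field `closed` is what makes degree sums additive over
  -- `C` and its complement in `T`.
  record Closed (T : Fin n → Bool) (x : Fin n) : Set where
    field
      C      : Fin n → Bool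
      C⊆T    : C ⊆ T
      x∈C    : C x ≡ true
      conn   : ConnectedOn r C
      closed : ∀ u v → C u ≡ true → T v ≡ true → r u v ≡ true → C v ≡ true

  -- One boundary vertex is added at a time. The fuel bounds the number of vertices of `T` still
  -- missing, so a boundary vertex at fuel zero would make `C′` larger than `T`.
  grow : ∀ {T x} fuel (C : Fin n → Bool) → countFin n T ≤ fuel + countFin n C →
         C ⊆ T → C x ≡ true → ConnectedOn r C → Closed T x
  grow {T} {x} fuel C bound C⊆T x∈C conn
    with any? (λ u → any? λ v → (C u ≟ᵇ true) ×-dec (T v ≟ᵇ true) ×-dec (r u v ≟ᵇ true) ×-dec (C v ≟ᵇ false))
  ... | no none = record { C = C ; C⊆T = C⊆T ; x∈C = x∈C ; conn = conn ; closed = closed }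
    where
    closed : ∀ u v → C u ≡ true → T v ≡ true → r u v ≡ true → C v ≡ true
    closed u v Cu Tv ruv with C v in Cv
    ... | true  = refl
    ... | false = contradiction (u , v , Cu , Tv , ruv , Cv) none
  ... | yes (u , v , Cu , Tv , ruv , Cv) = next fuel bound
    where
    C′ : Fin n → Bool
    C′ = insert v C
    C′⊆T : C′ ⊆ T
    C′⊆T i h with insert-elim v C i h
    ... | inj₁ Ci   = C⊆T i Ci
    ... | inj₂ refl = Tv
    lift : ∀ {i j} → Walk (r on C) i j → Walk (r on C′) i j
    lift = walk-map id λ i j e → ∧-true (∧-true (⊆-insert v C i (on-left {r = r} {T = C} e))
             (⊆-insert v C j (on-left {r = r} {T = C} (trans (on-sym {r = r} {T = C} r-sym j i) e)))) (on-rel {r = r} {T = C} e)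
    u→v : Walk (r on C′) u v
    u→v = step (∧-true (∧-true (⊆-insert v C u Cu) (insert-self v C)) ruv) here
    from-u : ∀ i → C′ i ≡ true → Walk (r on C′) u i
    from-u i h with insert-elim v C i h
    ... | inj₁ Ci   = lift (conn u i Cu Ci)
    ... | inj₂ refl = u→v
    conn′ : ConnectedOn r C′
    conn′ i j Ci Cj = walk-++ (walk-reverse (on-sym {r = r} {T = C′} r-sym) (from-u i Ci)) (from-u j Cj)
    next : ∀ fuel → countFin n T ≤ fuel + countFin n C → Closed T x
    next zero bound = contradiction
      (≤-trans (subst (_≤ countFin n T) (count-insert v C Cv) (count-mono C′⊆T)) bound) (<-irrefl refl)
    next (suc fuel) bound = grow fuel C′
      (subst (countFin n T ≤_) (trans (sym (+-suc fuel _)) (cong (_+_ fuel) (sym (count-insert v C Cv)))) bound)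
      C′⊆T (⊆-insert v C x x∈C) conn′

  degSum-split : ∀ {T x} (K : Closed T x) → let open Closed K in
    degSum (r on T) ≡ degSum (r on C) + degSum (r on (λ i → T i ∧ not (C i)))
  degSum-split {T} K = trans (∑-cong λ u → ∑-cong λ v → pointwise u v) (∑∑-+ (λ u v → # (r on C) u v) _)
    where
    open Closed K
    pointwise : ∀ u v → # (r on T) u v ≡ # (r on C) u v + # (r on (λ i → T i ∧ not (C i))) u v
    pointwise u v with r u v in ruv | C u in Cu | C v in Cv | T u in Tu | T v in Tv
    ... | true  | true  | true  | true  | true  = refl
    ... | true  | true  | false | true  | true  = ⊥-elim (true≢false (closed u v Cu Tv ruv) Cv)
    ... | true  | false | true  | true  | true  = ⊥-elim (true≢false (closed v u Cv Tu (trans (r-sym v u) ruv)) Cu)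
    ... | true  | false | false | true  | true  = refl
    ... | true  | true  | _     | false | _     = ⊥-elim (true≢false (C⊆T u Cu) Tu)
    ... | true  | _     | true  | _     | false = ⊥-elim (true≢false (C⊆T v Cv) Tv)
    ... | true  | true  | false | true  | false = refl
    ... | true  | false | true  | false | true  = refl
    ... | true  | false | false | true  | false = refl
    ... | true  | false | false | false | true  = refl
    ... | true  | false | false | false | false = refl
    ... | false | true  | true  | true  | true  = refl
    ... | false | true  | false | true  | true  = refl
    ... | false | false | true  | true  | true  = refl
    ... | false | false | false | true  | true  = refl
    ... | false | true  | _     | false | _     = ⊥-elim (true≢false (C⊆T u Cu) Tu)
    ... | false | _     | true  | _     | false = ⊥-elim (true≢false (C⊆T v Cv) Tv)
    ... | false | true  | false | true  | false = refl
    ... | false | false | true  | false | true  = refl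
    ... | false | false | false | true  | false = refl
    ... | false | false | false | false | true  = refl
    ... | false | false | false | false | false = refl

  -- An averaging argument: if the component of some vertex is not dense, its removal leaves a set
  -- that still is, because vertices and degree sums both split. The fuel bounds the size of the
  -- remaining set.
  dense-component : ∀ fuel T → countFin n T ≤ fuel → 2 * countFin n T < degSum (r on T) →
    ∃ λ C → C ⊆ T × ConnectedOn r C × 2 * countFin n C < degSum (r on C)
  dense-component fuel T bound dense with any? (λ x → T x ≟ᵇ true)
  ... | no empty = contradiction (subst (2 * countFin n T <_) degSum≡0 dense) n≮0
    where
    ∑-zero : ∀ {m} (f : Fin m → ℕ) → (∀ i → f i ≡ 0) → ∑ f ≡ 0
    ∑-zero {zero}  f f≡0 = refl
    ∑-zero {suc m} f f≡0 = cong₂ _+_ (f≡0 zero) (∑-zero (f ∘ suc) (f≡0 ∘ suc))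
    T≡false : ∀ i → T i ≡ false
    T≡false i with T i in Ti
    ... | true  = contradiction (i , Ti) empty
    ... | false = refl
    degSum≡0 : degSum (r on T) ≡ 0
    degSum≡0 = ∑-zero _ λ u → ∑-zero _ λ v → cong (λ b → # ((b ∧ T v) ∧ r u v)) (T≡false u)
  ... | yes (x , Tx) = [ (λ C-dense → C , C⊆T , conn , C-dense) , rest fuel bound ]′ alternative
    where
    point : Fin n → Bool
    point i = ⌊ i ≟ x ⌋
    point-≡ : ∀ i → point i ≡ true → i ≡ x
    point-≡ i h with i ≟ x
    ... | yes i≡x = i≡x
    point⊆T : point ⊆ T
    point⊆T i h with refl ← point-≡ i h = Tx
    point-x : point x ≡ true
    point-x with x ≟ x
    ... | yes _   = refl
    ... | no  x≢x = contradiction refl x≢x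
    point-conn : ConnectedOn r point
    point-conn i j hi hj with refl ← point-≡ i hi | refl ← point-≡ j hj = here
    K : Closed T x
    K = grow (countFin n T) point (m≤m+n _ _) point⊆T point-x point-conn
    open Closed K
    D : Fin n → Bool
    D i = T i ∧ not (C i)
    alternative : 2 * countFin n C < degSum (r on C) ⊎ 2 * countFin n D < degSum (r on D)
    alternative with 2 * countFin n C <? degSum (r on C)
    ... | yes C-dense = inj₁ C-dense
    ... | no  C-sparse = inj₂ (+-cancelˡ-< (2 * countFin n C) _ _ (begin-strict
      2 * countFin n C + 2 * countFin n D   ≡⟨ *-distribˡ-+ 2 (countFin n C) (countFin n D) ⟨
      2 * (countFin n C + countFin n D)     ≡⟨ cong (2 *_) (∸ᵇ-count C⊆T) ⟨
      2 * countFin n T                      <⟨ dense ⟩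
      degSum (r on T)                       ≡⟨ degSum-split K ⟩
      degSum (r on C) + degSum (r on D)     ≤⟨ +-mono-≤ (≮⇒≥ C-sparse) ≤-refl ⟩
      2 * countFin n C + degSum (r on D)    ∎))
      where
      open ≤-Reasoning
    D<T : suc (countFin n D) ≤ countFin n T
    D<T = subst (suc (countFin n D) ≤_) (sym (∸ᵇ-count C⊆T)) (+-mono-≤ (count-member C x∈C) ≤-refl)
    rest : ∀ fuel → countFin n T ≤ fuel → 2 * countFin n D < degSum (r on D) →
      ∃ λ C → C ⊆ T × ConnectedOn r C × 2 * countFin n C < degSum (r on C)
    rest zero bound D-dense = contradiction (≤-trans D<T bound) n≮0
    rest (suc fuel) bound D-dense
      with E , E⊆D , E-conn , E-dense ← dense-component fuel D (≤-pred (≤-trans D<T bound)) D-dense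
      = E , (λ i Ei → ∧-conicalˡ (T i) _ (E⊆D i Ei)) , E-conn , E-dense

-- The summation inside numEdges is local to Defs, and its hidden parameters do not affect its value.
-- Unification recovers it from an edgeless subgraph, after which it can be compared with ∑.
edgeless : ∀ n → Subgraph {n} (record { adj = λ _ _ → false ; sym = λ _ _ → refl ; irrefl = λ _ → refl })
edgeless n = record { vert = λ _ → false ; edge = λ _ _ → false ; edge-sym = λ _ _ → refl
                    ; edge-adj = λ _ _ → id ; edge-vert = λ _ _ → id }

∑-characterised : (s : ∀ m → (Fin m → ℕ) → ℕ) → (∀ f → s 0 f ≡ 0) →
  (∀ m f → s (suc m) f ≡ f zero + s m (f ∘ suc)) → ∀ m f → s m f ≡ ∑ f
∑-characterised s s-zero s-suc zero    f = s-zero f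
∑-characterised s s-zero s-suc (suc m) f =
  trans (s-suc m f) (cong (_+_ (f zero)) (∑-characterised s s-zero s-suc m (f ∘ suc)))

mutual
  sumFin : ∀ m → (Fin m → ℕ) → ℕ
  sumFin = _

  sumFin-edgeless : ∀ n → numEdges (edgeless n) ≡ sumFin n (λ u → countFin n (λ v → false))
  sumFin-edgeless n with (λ (u : Fin n) → countFin n (λ v → false))
  ... | f = refl {x = sumFin n f}

numEdges-∑ : ∀ {n} {G : Graph n} (S : Subgraph G) →
             numEdges S ≡ ∑ λ u → countFin n (λ v → edge S u v ∧ (toℕ u <ᵇ toℕ v))
numEdges-∑ {n} S with (λ u → countFin n (λ v → edge S u v ∧ (toℕ u <ᵇ toℕ v)))
... | f = ∑-characterised sumFin (λ _ → refl) (λ _ _ → refl) n f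

-- There are no loops, so every ordered edge goes upwards in exactly one of its two directions.
handshake : ∀ {n} {G : Graph n} (S : Subgraph G) → degSum (edge S) ≡ 2 * numEdges S
handshake {n} {G} S = begin
  degSum (edge S)
    ≡⟨ ∑-cong (λ u → ∑-cong λ v → pointwise u v) ⟩
  ∑ (λ u → ∑ λ v → up u v + up v u)
    ≡⟨ ∑∑-+ up (λ u v → up v u) ⟩
  ∑ (λ u → ∑ (up u)) + ∑ (λ u → ∑ λ v → up v u)
    ≡⟨ cong (_+_ (∑ (λ u → ∑ (up u)))) (∑-swap (λ u v → up v u)) ⟩
  ∑ (λ u → ∑ (up u)) + ∑ (λ u → ∑ (up u))
    ≡⟨ cong₂ _+_ up-total (trans up-total (sym (+-identityʳ _))) ⟩
  2 * numEdges S ∎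
  where
  open ≡-Reasoning
  up : Fin n → Fin n → ℕ
  up u v = # (edge S u v ∧ (toℕ u <ᵇ toℕ v))
  up-total : ∑ (λ u → ∑ (up u)) ≡ numEdges S
  up-total = sym (trans (numEdges-∑ S) (∑-cong {n} λ u → countFin-∑ n (λ v → edge S u v ∧ (toℕ u <ᵇ toℕ v))))
  trichotomy : ∀ a b → a ≡ b ⊎ ((a <ᵇ b) ≡ true × (b <ᵇ a) ≡ false) ⊎ ((a <ᵇ b) ≡ false × (b <ᵇ a) ≡ true)
  trichotomy zero    zero    = inj₁ refl
  trichotomy zero    (suc b) = inj₂ (inj₁ (refl , refl))
  trichotomy (suc a) zero    = inj₂ (inj₂ (refl , refl))
  trichotomy (suc a) (suc b) with trichotomy a b
  ... | inj₁ a≡b = inj₁ (cong suc a≡b)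
  ... | inj₂ a≢b = inj₂ a≢b
  loopless : ∀ u → edge S u u ≡ false
  loopless u = ¬-not λ h → true≢false (edge-adj S u u h) (adj-irrefl G u)
  pointwise : ∀ u v → # edge S u v ≡ up u v + up v u
  pointwise u v rewrite edge-sym S v u with trichotomy (toℕ u) (toℕ v)
  ... | inj₁ u≡v with refl ← toℕ-injective u≡v rewrite loopless u = refl
  ... | inj₂ (inj₁ (lt , gt)) rewrite lt | gt with edge S u v
  ...   | true  = refl
  ...   | false = refl
  pointwise u v | inj₂ (inj₂ (lt , gt)) rewrite lt | gt with edge S u v
  ...   | true  = refl
  ...   | false = refl

-- The subgraph keeps the edges of `r` only, not all edges of `G` on `C`, so that its edge count is
-- exactly half the degree sum found dense.
dense⇒subgraph : ∀ {n} (G : Graph n) {r : Rel n} → Symmetric r → (∀ u v → r u v ≡ true → adj G u v ≡ true) →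
  ∀ T → 2 * countFin n T < degSum (r on T) →
  Σ (Subgraph G) λ S → SubgraphConnected S × (numVertices S ≤ countFin n T) × (numVertices S < numEdges S)
dense⇒subgraph {n} G {r} r-sym r⇒adj T dense
  with C , C⊆T , conn , C-dense ← dense-component r-sym (countFin n T) T ≤-refl dense
  = S , conn , count-mono C⊆T , *-cancelˡ-< 2 _ _ (subst (2 * countFin n C <_) (handshake S) C-dense)
  where
  S : Subgraph G
  S = record
    { vert      = C
    ; edge      = r on C
    ; edge-sym  = on-sym {r = r} {T = C} r-sym
    ; edge-adj  = λ u v e → r⇒adj u v (on-rel {r = r} {T = C} e)
    ; edge-vert = λ u v → on-left {r = r} {T = C}
    }

-- Cycles as bi-infinite lines

-- Used to locate the centre of the reflection sending i + t to j - t: it is a vertex or the middle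
-- of an edge according to the parity of j - i.
parity : ∀ z → ∃ λ s → z ≡ s ℤ.+ s ⊎ z ≡ 1ℤ ℤ.+ (s ℤ.+ s)
parity (+ n) with parity-ℕ n
  where
  parity-ℕ : ∀ n → ∃ λ s → n ≡ s + s ⊎ n ≡ suc (s + s)
  parity-ℕ zero = 0 , inj₁ refl
  parity-ℕ (suc n) with parity-ℕ n
  ... | s , inj₁ eq = s , inj₂ (cong suc eq)
  ... | s , inj₂ eq = suc s , inj₁ (cong suc (trans eq (sym (+-suc s s))))
... | s , inj₁ refl = + s , inj₁ refl
... | s , inj₂ refl = + s , inj₂ refl
parity -[1+ n ] with parity (+ n)
... | s , inj₁ eq = ℤ.- s ℤ.+ -1ℤ , inj₂ (trans (cong (λ z → ℤ.- (1ℤ ℤ.+ z)) eq) (lemma s))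
  where
  lemma : ∀ s → ℤ.- (1ℤ ℤ.+ (s ℤ.+ s)) ≡ 1ℤ ℤ.+ ((ℤ.- s ℤ.+ -1ℤ) ℤ.+ (ℤ.- s ℤ.+ -1ℤ))
  lemma = solve-ℤ
... | s , inj₂ eq = ℤ.- s ℤ.+ -1ℤ , inj₁ (trans (cong (λ z → ℤ.- (1ℤ ℤ.+ z)) eq) (lemma s))
  where
  lemma : ∀ s → ℤ.- (1ℤ ℤ.+ (1ℤ ℤ.+ (s ℤ.+ s))) ≡ (ℤ.- s ℤ.+ -1ℤ) ℤ.+ (ℤ.- s ℤ.+ -1ℤ)
  lemma = solve-ℤ

-- In each pair of identities the first isolates `j ℤ.- i`, for which the parity equation is then
-- substituted, and the second simplifies the result.
via-difference-suc : ∀ i j s → j ℤ.+ ℤ.- (-1ℤ ℤ.+ s) ≡ 1ℤ ℤ.+ (i ℤ.+ ((j ℤ.- i) ℤ.+ ℤ.- s))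
via-difference-suc = solve-ℤ
halve-even : ∀ i s → 1ℤ ℤ.+ (i ℤ.+ ((s ℤ.+ s) ℤ.+ ℤ.- s)) ≡ 1ℤ ℤ.+ (i ℤ.+ s)
halve-even = solve-ℤ
via-difference : ∀ i j s → j ℤ.+ ℤ.- s ≡ i ℤ.+ ((j ℤ.- i) ℤ.+ ℤ.- s)
via-difference = solve-ℤ
halve-odd : ∀ i s → i ℤ.+ ((1ℤ ℤ.+ (s ℤ.+ s)) ℤ.+ ℤ.- s) ≡ 1ℤ ℤ.+ (i ℤ.+ s)
halve-odd = solve-ℤ

-- A cycle of r, unrolled to a bi-infinite walk that never turns back.
record Line {n} (r : Rel n) : Set where
  field
    at   : ℤ → Fin n
    next : ∀ i → r (at i) (at (ℤ.suc i)) ≡ true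
    nbr  : ∀ i v → r (at i) v ≡ true → v ≡ at (ℤ.pred i) ⊎ v ≡ at (ℤ.suc i)
    turn : ∀ i → at (ℤ.pred i) ≢ at (ℤ.suc i)
open Line

module _ {n : ℕ} {r : Rel n} (r-sym : Symmetric r) (r-irrefl : Irreflexive r) where

  private
    +-sucʳ : ∀ j i → j ℤ.+ (1ℤ ℤ.+ i) ≡ 1ℤ ℤ.+ (j ℤ.+ i)
    +-sucʳ = solve-ℤ

    +-predʳ : ∀ j i → j ℤ.+ (-1ℤ ℤ.+ i) ≡ -1ℤ ℤ.+ (j ℤ.+ i)
    +-predʳ = solve-ℤ

    neg-suc : ∀ i → ℤ.- (1ℤ ℤ.+ i) ≡ -1ℤ ℤ.+ (ℤ.- i)
    neg-suc = solve-ℤ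

    neg-pred : ∀ i → ℤ.- (-1ℤ ℤ.+ i) ≡ 1ℤ ℤ.+ (ℤ.- i)
    neg-pred = solve-ℤ

  prev : ∀ (γ : Line r) i → r (at γ i) (at γ (ℤ.pred i)) ≡ true
  prev γ i = trans (r-sym _ _) (subst (λ j → r (at γ (ℤ.pred i)) (at γ j) ≡ true) (ℤ.suc-pred i) (next γ (ℤ.pred i)))

  shift : ℤ → Line r → Line r
  shift j γ .at i = at γ (j ℤ.+ i)
  shift j γ .next i rewrite +-sucʳ j i = next γ (j ℤ.+ i)
  shift j γ .nbr i v rewrite +-sucʳ j i | +-predʳ j i = nbr γ (j ℤ.+ i) v
  shift j γ .turn i rewrite +-sucʳ j i | +-predʳ j i = turn γ (j ℤ.+ i)

  reverse : Line r → Line r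
  reverse γ .at i = at γ (ℤ.- i)
  reverse γ .next i rewrite neg-suc i = prev γ (ℤ.- i)
  reverse γ .nbr i v e rewrite neg-suc i | neg-pred i with nbr γ (ℤ.- i) v e
  ... | inj₁ v≡ = inj₂ v≡
  ... | inj₂ v≡ = inj₁ v≡
  reverse γ .turn i eq rewrite neg-suc i | neg-pred i = turn γ (ℤ.- i) (sym eq)

  -- Two consecutive vertices determine a line: of the two neighbours of the current vertex, `turn`
  -- rules out the one just left. Reversing both lines gives the negative half.
  agree : ∀ (γ δ : Line r) → at γ 0ℤ ≡ at δ 0ℤ → at γ 1ℤ ≡ at δ 1ℤ → ∀ i → at γ i ≡ at δ i
  agree γ δ eq₀ eq₁ = all
    where
    forward : ∀ (γ δ : Line r) → at γ 0ℤ ≡ at δ 0ℤ → at γ 1ℤ ≡ at δ 1ℤ →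
              ∀ m → at γ (+ m) ≡ at δ (+ m) × at γ (+ suc m) ≡ at δ (+ suc m)
    forward γ δ eq₀ eq₁ zero = eq₀ , eq₁
    forward γ δ eq₀ eq₁ (suc m) with eqₘ , eqₛ ← forward γ δ eq₀ eq₁ m
      with nbr δ (+ suc m) _ (subst (λ u → r u (at γ (+ suc (suc m))) ≡ true) eqₛ (next γ (+ suc m)))
    ... | inj₂ eq = eqₛ , eq
    ... | inj₁ eq = contradiction (trans eqₘ (sym eq)) (turn γ (+ suc m))
    eq₋₁ : at γ -1ℤ ≡ at δ -1ℤ
    eq₋₁ with nbr δ 0ℤ _ (subst (λ u → r u (at γ -1ℤ) ≡ true) eq₀ (prev γ 0ℤ))
    ... | inj₁ eq = eq
    ... | inj₂ eq = contradiction (trans eq (sym eq₁)) (turn γ 0ℤ)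
    all : ∀ i → at γ i ≡ at δ i
    all (+ m)    = proj₁ (forward γ δ eq₀ eq₁ m)
    all -[1+ m ] = proj₂ (forward (reverse γ) (reverse δ) eq₀ eq₋₁ m)

  agree-or-reverse : ∀ (γ δ : Line r) → at γ 0ℤ ≡ at δ 0ℤ →
                     (∀ i → at γ i ≡ at δ i) ⊎ (∀ i → at γ i ≡ at δ (ℤ.- i))
  agree-or-reverse γ δ eq₀ with nbr δ 0ℤ _ (subst (λ u → r u (at γ 1ℤ) ≡ true) eq₀ (next γ 0ℤ))
  ... | inj₁ eq = inj₂ (agree γ (reverse δ) eq₀ eq)
  ... | inj₂ eq = inj₁ (agree γ δ eq₀ eq)

  -- A line meeting a vertex in both directions would have a loop or a turn at the midpoint of the fold.
  no-fold : ∀ (γ : Line r) i j → ¬ (∀ t → at γ (i ℤ.+ t) ≡ at γ (j ℤ.+ ℤ.- t))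
  no-fold γ i j fold = excluded (parity (j ℤ.- i))
    where
    excluded : (∃ λ s → j ℤ.- i ≡ s ℤ.+ s ⊎ j ℤ.- i ≡ 1ℤ ℤ.+ (s ℤ.+ s)) → ⊥
    excluded (s , inj₁ even) = turn γ (i ℤ.+ s) (begin
      at γ (ℤ.pred (i ℤ.+ s))        ≡⟨ cong (at γ) (+-predʳ i s) ⟨
      at γ (i ℤ.+ ℤ.pred s)          ≡⟨ fold (ℤ.pred s) ⟩
      at γ (j ℤ.+ ℤ.- (ℤ.pred s))    ≡⟨ cong (at γ) midpoint ⟩
      at γ (ℤ.suc (i ℤ.+ s))         ∎)
      where
      open ≡-Reasoning
      midpoint : j ℤ.+ ℤ.- (ℤ.pred s) ≡ ℤ.suc (i ℤ.+ s)
      midpoint = trans (via-difference-suc i j s) (trans (cong (λ z → 1ℤ ℤ.+ (i ℤ.+ (z ℤ.+ ℤ.- s))) even) (halve-even i s))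
    excluded (s , inj₂ odd) = true≢false (next γ (i ℤ.+ s))
      (subst (λ u → r (at γ (i ℤ.+ s)) u ≡ false) (trans (fold s) (cong (at γ) midpoint)) (r-irrefl _))
      where
      midpoint : j ℤ.+ ℤ.- s ≡ ℤ.suc (i ℤ.+ s)
      midpoint = trans (via-difference i j s) (trans (cong (λ z → i ℤ.+ (z ℤ.+ ℤ.- s)) odd) (halve-odd i s))

  -- When a line returns to a vertex, it either repeats itself or runs backwards, and the latter is
  -- a fold.
  period : ∀ (γ : Line r) {i j} → at γ i ≡ at γ j → ∀ t → at γ (i ℤ.+ t) ≡ at γ (j ℤ.+ t)
  period γ {i} {j} eq = [ id , (λ fold → contradiction fold (no-fold γ i j)) ]′
    (agree-or-reverse (shift i γ) (shift j γ)
      (trans (cong (at γ) (ℤ.+-identityʳ i)) (trans eq (cong (at γ) (sym (ℤ.+-identityʳ j))))))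

  -- By `nbr`, the vertices of a line are closed under taking neighbours, so a line exhausts its
  -- component.
  on-line : ∀ (γ : Line r) {u v} → Walk r u v → (∃ λ i → at γ i ≡ u) → ∃ λ i → at γ i ≡ v
  on-line γ here       on-γ = on-γ
  on-line γ (step {v = v} e w) (i , refl) with nbr γ i v e
  ... | inj₁ eq = on-line γ w (_ , sym eq)
  ... | inj₂ eq = on-line γ w (_ , sym eq)

  line-walk : ∀ (γ : Line r) i → Walk r (at γ 0ℤ) (at γ i)
  line-walk γ (+ m)    = forward m
    where
    forward : ∀ m → Walk r (at γ 0ℤ) (at γ (+ m))
    forward zero    = here
    forward (suc m) = walk-snoc (forward m) (next γ (+ m))
  line-walk γ -[1+ m ] = backward m
    where
    backward : ∀ m → Walk r (at γ 0ℤ) (at γ -[1+ m ])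
    backward zero    = step (prev γ 0ℤ) here
    backward (suc m) = walk-snoc (backward m) (prev γ -[1+ m ])

  -- The two directions along the cycle are followed separately and glued at 0.
  continue-line : (∀ {p c} → r p c ≡ true → ∃ λ d → r c d ≡ true × d ≢ p × (∀ v → r c v ≡ true → v ≡ p ⊎ v ≡ d)) →
                  ∀ b x → r b x ≡ true → Σ (Line r) λ γ → at γ 0ℤ ≡ b
  continue-line other b x rbx = γ , refl
    where
    onward : ∀ {p c} (e : r p c ≡ true) → r c (proj₁ (other e)) ≡ true
    onward e = proj₁ (proj₂ (other e))
    path : ∀ {p c} → r p c ≡ true → ℕ → Fin n
    path {p} e zero    = p
    path     e (suc m) = path (onward e) m
    path-next : ∀ {p c} (e : r p c ≡ true) m → r (path e m) (path e (suc m)) ≡ true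
    path-next e zero    = e
    path-next e (suc m) = path-next (onward e) m
    path-nbr : ∀ {p c} (e : r p c ≡ true) m v → r (path e (suc m)) v ≡ true → v ≡ path e m ⊎ v ≡ path e (suc (suc m))
    path-nbr e zero    = proj₂ (proj₂ (proj₂ (other e)))
    path-nbr e (suc m) = path-nbr (onward e) m
    path-turn : ∀ {p c} (e : r p c ≡ true) m → path e m ≢ path e (suc (suc m))
    path-turn e zero    eq = proj₁ (proj₂ (proj₂ (other e))) (sym eq)
    path-turn e (suc m) = path-turn (onward e) m
    -- Entering `b` from `x` makes `other` return the second neighbour of `b`, with which the
    -- negative direction starts.
    rxb : r x b ≡ true
    rxb = trans (r-sym x b) rbx
    rby : r b (proj₁ (other rxb)) ≡ true
    rby = onward rxb
    γ : Line r
    γ .at (+ m)              = path rbx m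
    -- Both paths begin at `b`. The positive one supplies index 0, so the negative one is used from
    -- its second vertex on.
    γ .at -[1+ m ]           = path rby (suc m)
    γ .next (+ m)            = path-next rbx m
    γ .next -[1+ zero ]      = trans (r-sym _ _) (path-next rby 0)
    γ .next -[1+ suc m ]     = trans (r-sym _ _) (path-next rby (suc m))
    γ .nbr (+ zero) v e      with proj₂ (proj₂ (proj₂ (other rxb))) v e
    ... | inj₁ v≡x = inj₂ v≡x
    ... | inj₂ v≡y = inj₁ v≡y
    γ .nbr (+ suc m) v e     = path-nbr rbx m v e
    γ .nbr -[1+ zero ] v e   with path-nbr rby 0 v e
    ... | inj₁ v≡ = inj₂ v≡
    ... | inj₂ v≡ = inj₁ v≡
    γ .nbr -[1+ suc m ] v e  with path-nbr rby (suc m) v e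
    ... | inj₁ v≡ = inj₂ v≡
    ... | inj₂ v≡ = inj₁ v≡
    γ .turn (+ zero)         = proj₁ (proj₂ (proj₂ (other rxb)))
    γ .turn (+ suc m)        = path-turn rbx m
    γ .turn -[1+ zero ]      = path-turn rby 0 ∘ sym
    γ .turn -[1+ suc m ]     = path-turn rby (suc m) ∘ sym

  degree2-line : (∀ u v → r u v ≡ true → countFin n (r u) ≡ 2) →
                 ∀ b x → r b x ≡ true → Σ (Line r) λ γ → at γ 0ℤ ≡ b
  degree2-line deg2 = continue-line λ {p} {c} e →
    count≡2-other (r c) (deg2 c p (trans (r-sym c p) e)) p (trans (r-sym c p) e)

-- Permutations, finite choice under double negation, least elements

from-does : ∀ {P : Set} (P? : Dec P) → does P? ≡ true → P
from-does (yes p) _ = p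

true-irrelevant : ∀ {b} (p q : b ≡ true) → p ≡ q
true-irrelevant refl refl = refl

-- A missed value could be punched out of the codomain, which would leave an injection into a
-- smaller set.
injective⇒permutation : ∀ {n} (f : Fin n → Fin n) → (∀ {x y} → f x ≡ f y → x ≡ y) →
                        Σ (Permutation′ n) λ φ → ∀ x → φ ⟨$⟩ʳ x ≡ f x
injective⇒permutation {n} f inj =
  permutation f (proj₁ ∘ onto f inj) (proj₂ ∘ onto f inj) (λ x → inj (proj₂ (onto f inj (f x)))) , λ _ → refl
  where
  onto : ∀ {n} (f : Fin n → Fin n) → (∀ {x y} → f x ≡ f y → x ≡ y) → ∀ y → ∃ λ x → f x ≡ y
  onto {suc n} f inj y with any? (λ x → f x ≟ y)
  ... | yes hit  = hit
  ... | no  miss = contradiction (injective⇒≤ {f = λ x → punchOut (avoids x)}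
                     (inj ∘ punchOut-injective (avoids _) (avoids _))) (<-irrefl refl)
    where
    avoids : ∀ x → y ≢ f x
    avoids x y≡fx = miss (x , sym y≡fx)

-- Double negation commutes with finite conjunction, so one classical choice per vertex can be made
-- simultaneously.
¬¬-choice : ∀ {n} {P : Fin n → Set} → (∀ i → ¬ ¬ P i) → ¬ ¬ (∀ i → P i)
¬¬-choice {zero}  p k = k λ ()
¬¬-choice {suc n} p k = p zero λ p₀ → ¬¬-choice (p ∘ suc) λ ps → k λ { zero → p₀ ; (suc i) → ps i }

-- Selects one base per component. The result depends only on the set of candidates, so all vertices
-- of a component select the same base.
least : ∀ {n} → (Fin n → Bool) → Maybe (Fin n)
least {zero}  p = nothing
least {suc n} p = if p zero then just zero else Maybe.map suc (least (p ∘ suc))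

least-cong : ∀ {n} {p q : Fin n → Bool} → (∀ i → p i ≡ q i) → least p ≡ least q
least-cong {zero}  p≗q = refl
least-cong {suc n} p≗q = cong₂ (λ b m → if b then just zero else Maybe.map suc m) (p≗q zero) (least-cong (p≗q ∘ suc))

least-complete : ∀ {n} (p : Fin n → Bool) {i} → p i ≡ true → ∃ λ j → least p ≡ just j × p j ≡ true
least-complete {suc n} p {i} pi with p zero in p₀ | i
... | true  | _     = zero , refl , p₀
... | false | zero  = ⊥-elim (true≢false pi p₀)
... | false | suc i with j , eq , pj ← least-complete (p ∘ suc) pi = suc j , cong (Maybe.map suc) eq , pj

-- Aligning two cycles through their common vertices

Meets : ∀ {n} {r : Rel n} → Line r → ℤ → Fin n → Set
Meets γ t w = at γ t ≡ w ⊎ at γ (ℤ.- t) ≡ w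

-- Ranging over all pairs of lines with a common starting vertex in `N` allows a second application
-- after both lines are shifted to another common vertex.
DistancePreserving : ∀ {n} → (Fin n → Bool) → Rel n → Rel n → Set
DistancePreserving N a h = ∀ (γ : Line a) (η : Line h) → at γ 0ℤ ≡ at η 0ℤ → N (at γ 0ℤ) ≡ true →
  ∀ t w → N w ≡ true → Meets γ t w → Meets η t w

Follows : ∀ {n} {a h : Rel n} → (Fin n → Bool) → Line a → Line h → Set
Follows N γ η = ∀ t w → N w ≡ true → at γ t ≡ w → at η t ≡ w

+-difference : ∀ d t → d ℤ.+ (t ℤ.+ ℤ.- d) ≡ t
+-difference = solve-ℤ

module Matching {n : ℕ} {a h : Rel n} (a-sym : Symmetric a) (a-irrefl : Irreflexive a)
  (h-sym : Symmetric h) (h-irrefl : Irreflexive h) (N : Fin n → Bool) (a⇒h : DistancePreserving N a h) where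

  -- Coincidence of t and -t means that 2t is a period, that is, the base is at distance 2t from
  -- itself. In this form `a⇒h` transfers it to `η`.
  antipodal : ∀ (γ : Line a) (η : Line h) → at γ 0ℤ ≡ at η 0ℤ → N (at γ 0ℤ) ≡ true →
    ∀ t → at γ t ≡ at γ (ℤ.- t) → at η t ≡ at η (ℤ.- t)
  antipodal γ η eq₀ b∈N t fold with a⇒h γ η eq₀ b∈N (t ℤ.+ t) (at γ 0ℤ) b∈N (inj₁ (trans
      (period a-sym a-irrefl γ fold t) (cong (at γ) (ℤ.+-inverseˡ t))))
  ... | inj₁ eq = begin
    at η t                          ≡⟨ cong (at η) (lemma t) ⟨
    at η ((t ℤ.+ t) ℤ.+ ℤ.- t)      ≡⟨ period h-sym h-irrefl η (trans eq eq₀) (ℤ.- t) ⟩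
    at η (0ℤ ℤ.+ ℤ.- t)             ≡⟨ cong (at η) (ℤ.+-identityˡ _) ⟩
    at η (ℤ.- t)                    ∎
    where
    open ≡-Reasoning
    lemma : ∀ t → (t ℤ.+ t) ℤ.+ ℤ.- t ≡ t
    lemma = solve-ℤ
  ... | inj₂ eq = sym (begin
    at η (ℤ.- t)                        ≡⟨ cong (at η) (lemma t) ⟨
    at η (ℤ.- (t ℤ.+ t) ℤ.+ t)          ≡⟨ period h-sym h-irrefl η (trans eq eq₀) t ⟩
    at η (0ℤ ℤ.+ t)                     ≡⟨ cong (at η) (ℤ.+-identityˡ t) ⟩
    at η t                              ∎)
    where
    open ≡-Reasoning
    lemma : ∀ t → ℤ.- (t ℤ.+ t) ℤ.+ t ≡ ℤ.- t
    lemma = solve-ℤ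

  -- A common vertex that is not antipodal to the base fixes the direction of travel.
  oriented⇒follows : ∀ (γ : Line a) (η : Line h) → at γ 0ℤ ≡ at η 0ℤ → N (at γ 0ℤ) ≡ true →
    ∀ d → N (at γ d) ≡ true → at γ d ≡ at η d → at η d ≢ at η (ℤ.- d) → Follows N γ η
  oriented⇒follows γ η eq₀ b∈N d d∈N eq-d oriented t w w∈N γt≡w
    with a⇒h γ η eq₀ b∈N t w w∈N (inj₁ γt≡w)
  ... | inj₁ ηt≡w  = ηt≡w
  ... | inj₂ η-t≡w
    -- Seen from index `d`, the vertex `w` is at t - d. If `η` takes the wrong sign from both bases,
    -- `w` is at -t and at 2d - t, so 2d is a period of `η` and `d` meets `- d`.
    with a⇒h (shift a-sym a-irrefl d γ) (shift h-sym h-irrefl d η)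
           (trans (cong (at γ) (ℤ.+-identityʳ d)) (trans eq-d (cong (at η) (sym (ℤ.+-identityʳ d)))))
           (subst (λ i → N (at γ i) ≡ true) (sym (ℤ.+-identityʳ d)) d∈N)
           (t ℤ.+ ℤ.- d) w w∈N (inj₁ (trans (cong (at γ) (+-difference d t)) γt≡w))
  ... | inj₁ eq = trans (cong (at η) (sym (+-difference d t))) eq
  ... | inj₂ eq = contradiction (begin
    at η d                                                       ≡⟨ cong (at η) (lemma d t) ⟨
    at η ((d ℤ.+ ℤ.- (t ℤ.+ ℤ.- d)) ℤ.+ (t ℤ.+ ℤ.- d))           ≡⟨ period h-sym h-irrefl η (trans eq (sym η-t≡w)) (t ℤ.+ ℤ.- d) ⟩
    at η (ℤ.- t ℤ.+ (t ℤ.+ ℤ.- d))                               ≡⟨ cong (at η) (lemma′ d t) ⟩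
    at η (ℤ.- d)                                                 ∎) oriented
    where
    open ≡-Reasoning
    lemma : ∀ d t → (d ℤ.+ ℤ.- (t ℤ.+ ℤ.- d)) ℤ.+ (t ℤ.+ ℤ.- d) ≡ d
    lemma = solve-ℤ
    lemma′ : ∀ d t → ℤ.- t ℤ.+ (t ℤ.+ ℤ.- d) ≡ ℤ.- d
    lemma′ = solve-ℤ

  -- Every common vertex is its own mirror image here, so the ambiguity of sign is harmless once
  -- `antipodal` has carried this over to `η`.
  unoriented⇒follows : ∀ (γ : Line a) (η : Line h) → at γ 0ℤ ≡ at η 0ℤ → N (at γ 0ℤ) ≡ true →
    (∀ d → N (at γ d) ≡ true → at γ d ≡ at γ (ℤ.- d)) → Follows N γ η
  unoriented⇒follows γ η eq₀ b∈N folded t w w∈N refl with a⇒h γ η eq₀ b∈N t w w∈N (inj₁ refl)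
  ... | inj₁ ηt≡w  = ηt≡w
  ... | inj₂ η-t≡w = trans (antipodal γ η eq₀ b∈N t (folded t w∈N)) η-t≡w

record Matched {n} (a h : Rel n) (N : Fin n → Bool) (b : Fin n) : Set where
  field
    γ   : Line a
    η   : Line h
    γ₀  : at γ 0ℤ ≡ b
    η₀  : at η 0ℤ ≡ b
    γ⇒η : Follows N γ η
    η⇒γ : Follows N η γ

module _ {n : ℕ} {a h : Rel n} (a-sym : Symmetric a) (a-irrefl : Irreflexive a)
  (h-sym : Symmetric h) (h-irrefl : Irreflexive h) {N : Fin n → Bool}
  (a⇒h : DistancePreserving N a h) (h⇒a : DistancePreserving N h a) where

  private
    module A = Matching a-sym a-irrefl h-sym h-irrefl N a⇒h
    module H = Matching h-sym h-irrefl a-sym a-irrefl N h⇒a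

  match-oriented : ∀ {b} → N b ≡ true → (γ : Line a) (η : Line h) → at γ 0ℤ ≡ b → at η 0ℤ ≡ b →
    ∀ d → N (at γ d) ≡ true → at γ d ≢ at γ (ℤ.- d) → at γ d ≡ at η d → Matched a h N b
  match-oriented b∈N γ η refl η₀ d d∈N oriented eq = record
    { γ = γ ; η = η ; γ₀ = refl ; η₀ = η₀
    ; γ⇒η = A.oriented⇒follows γ η (sym η₀) b∈N d d∈N eq (oriented ∘ H.antipodal η γ η₀ η₀∈N d)
    ; η⇒γ = H.oriented⇒follows η γ η₀ η₀∈N d (trans (cong N (sym eq)) d∈N) (sym eq) oriented }
    where
    η₀∈N : N (at η 0ℤ) ≡ true
    η₀∈N = trans (cong N η₀) b∈N

  match-unoriented : ∀ {b} → N b ≡ true → (γ : Line a) (η : Line h) → at γ 0ℤ ≡ b → at η 0ℤ ≡ b →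
    (∀ d → N (at γ d) ≡ true → at γ d ≡ at γ (ℤ.- d)) → Matched a h N b
  match-unoriented b∈N γ η refl η₀ folded = record
    { γ = γ ; η = η ; γ₀ = refl ; η₀ = η₀
    ; γ⇒η = A.unoriented⇒follows γ η (sym η₀) b∈N folded
    ; η⇒γ = H.unoriented⇒follows η γ η₀ η₀∈N λ d d∈N → A.antipodal γ η (sym η₀) b∈N d (γ-folded d d∈N) }
    where
    η₀∈N : N (at η 0ℤ) ≡ true
    η₀∈N = trans (cong N η₀) b∈N
    γ-folded : ∀ d → N (at η d) ≡ true → at γ d ≡ at γ (ℤ.- d)
    γ-folded d d∈N with h⇒a η γ η₀ η₀∈N d (at η d) d∈N (inj₁ refl)
    ... | inj₁ eq = folded d (trans (cong N eq) d∈N)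
    ... | inj₂ eq = sym (trans (folded (ℤ.- d) (trans (cong N eq) d∈N)) (cong (at γ) (ℤ.neg-involutive d)))

  -- Whether some common vertex differs from its mirror image is a question about all integer
  -- indices, hence the double negation. If one does, `η` or its reverse has it at the same index as
  -- `γ`.
  match : ∀ {b} → N b ≡ true → (γ : Line a) (η : Line h) → at γ 0ℤ ≡ b → at η 0ℤ ≡ b → ¬ ¬ Matched a h N b
  match b∈N γ η γ₀ η₀ k = ¬¬-excluded-middle λ where
    (no unoriented) → k (match-unoriented b∈N γ η γ₀ η₀ λ d d∈N →
      decidable-stable (at γ d ≟ at γ (ℤ.- d)) λ oriented → unoriented (d , d∈N , oriented))
    (yes (d , d∈N , oriented)) → k ([
      (λ eq → match-oriented b∈N γ η γ₀ η₀ d d∈N oriented (sym eq)) ,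
      (λ eq → match-oriented b∈N γ (reverse h-sym h-irrefl η) γ₀ η₀ d d∈N oriented (sym eq)) ]′
      (a⇒h γ η (trans γ₀ (sym η₀)) (trans (cong N γ₀) b∈N) d (at γ d) d∈N (inj₁ refl)))

matched-sym : ∀ {n} {a h : Rel n} {N b} → Matched a h N b → Matched h a N b
matched-sym m = record { γ = η ; η = γ ; γ₀ = η₀ ; η₀ = γ₀ ; γ⇒η = η⇒γ ; η⇒γ = γ⇒η }
  where open Matched m

-- Makes sending `at γ i` to `at η i` well defined. A coincidence brings index i - j back to the
-- base, a common vertex, and `γ⇒η` moves this return to `η`.
matched-transfer : ∀ {n} {a h : Rel n} → Symmetric a → Irreflexive a → Symmetric h → Irreflexive h →
  ∀ {N b} → N b ≡ true → (m : Matched a h N b) → let open Matched m in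
  ∀ i j → at γ i ≡ at γ j → at η i ≡ at η j
matched-transfer a-sym a-irrefl h-sym h-irrefl {N} {b} b∈N m i j eq = begin
  at η i                       ≡⟨ cong (at η) (lemma i j) ⟨
  at η ((i ℤ.+ ℤ.- j) ℤ.+ j)   ≡⟨ period h-sym h-irrefl η (trans (γ⇒η (i ℤ.+ ℤ.- j) b b∈N returns) (sym η₀)) j ⟩
  at η (0ℤ ℤ.+ j)              ≡⟨ cong (at η) (ℤ.+-identityˡ j) ⟩
  at η j                       ∎
  where
  open ≡-Reasoning
  open Matched m
  lemma : ∀ i j → (i ℤ.+ ℤ.- j) ℤ.+ j ≡ i
  lemma = solve-ℤ
  returns : at γ (i ℤ.+ ℤ.- j) ≡ b
  returns = trans (period a-sym a-irrefl γ eq (ℤ.- j)) (trans (cong (at γ) (ℤ.+-inverseʳ j)) γ₀)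

-- Gluing the matched cycles into one isomorphism

module _ {n : ℕ} {a h : Rel n} (a-sym : Symmetric a) (a-irrefl : Irreflexive a)
  (h-sym : Symmetric h) (h-irrefl : Irreflexive h) {N S : Fin n → Bool}
  (a⊆S : ∀ u v → a u v ≡ true → S u ≡ true) (h⊆S : ∀ u v → h u v ≡ true → S u ≡ true)
  (cover : ∀ u → S u ≡ true → ∃ λ b → N b ≡ true × Walk a b u) where

  module Assemble (matched : ∀ b → N b ≡ true → Matched a h N b) (walk? : ∀ b u → Dec (Walk a b u)) where

    open Matched

    candidate : Fin n → Fin n → Bool
    candidate u b = N b ∧ does (walk? b u)

    -- Coordinates of `u` on its cycle. The index is determined only up to a period, so
    -- `target-unique` must show that the image does not depend on it.
    record Place (u : Fin n) : Set where
      field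
        base  : Fin n
        base∈ : N base ≡ true
        least-base : least (candidate u) ≡ just base
        index : ℤ
        at≡   : at (γ (matched base base∈)) index ≡ u
    open Place

    target : ∀ {u} → Place u → Fin n
    target p = at (η (matched (base p) (base∈ p))) (index p)

    on-η : ∀ {b} (b∈N : N b ≡ true) {u} → Walk h b u → ∃ λ i → at (η (matched b b∈N)) i ≡ u
    on-η b∈N w = on-line h-sym h-irrefl (η (matched _ b∈N)) w (0ℤ , η₀ (matched _ b∈N))

    place : ∀ u → S u ≡ true → Place u
    place u u∈S
      with c , c∈N , c→u ← cover u u∈S
      with b , eq , b-cand ← least-complete (candidate u) {c} (∧-true c∈N (dec-true (walk? c u) c→u))
      with i , atᵢ ← on-line a-sym a-irrefl (γ (matched b (∧-conicalˡ _ _ b-cand)))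
                       (from-does (walk? b u) (∧-conicalʳ (N b) _ b-cand)) (0ℤ , γ₀ (matched b (∧-conicalˡ _ _ b-cand)))
      = record { base = b ; base∈ = ∧-conicalˡ _ _ b-cand ; least-base = eq ; index = i ; at≡ = atᵢ }

    same-index : ∀ {b} (p q : N b ≡ true) i j →
      at (γ (matched b p)) i ≡ at (γ (matched b q)) j → at (η (matched b p)) i ≡ at (η (matched b q)) j
    same-index p q i j with true-irrelevant p q
    ... | refl = matched-transfer a-sym a-irrefl h-sym h-irrefl p (matched _ p) i j

    same-index⁻¹ : ∀ {b} (p q : N b ≡ true) i j →
      at (η (matched b p)) i ≡ at (η (matched b q)) j → at (γ (matched b p)) i ≡ at (γ (matched b q)) j
    same-index⁻¹ p q i j with true-irrelevant p q
    ... | refl = matched-transfer h-sym h-irrefl a-sym a-irrefl p (matched-sym (matched _ p)) i j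

    target-unique : ∀ {u} (p q : Place u) → target p ≡ target q
    target-unique record { base = b ; base∈ = b∈ ; least-base = eqb ; index = i ; at≡ = atᵢ }
                  record { base = c ; base∈ = c∈ ; least-base = eqc ; index = j ; at≡ = atⱼ }
      with refl ← just-injective (trans (sym eqb) eqc) = same-index b∈ c∈ i j (trans atᵢ (sym atⱼ))

    φ′ : ∀ u b → S u ≡ b → Fin n
    φ′ u true  u∈S = target (place u u∈S)
    φ′ u false u∉S = u

    φ : Fin n → Fin n
    φ u = φ′ u (S u) refl

    φ-in : ∀ {u} → S u ≡ true → (p : Place u) → φ u ≡ target p
    φ-in {u} u∈S p = go (S u) refl u∈S
      where
      go : ∀ b (eq : S u ≡ b) → b ≡ true → φ′ u b eq ≡ target p
      go true eq _ = target-unique (place u eq) p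

    φ-out : ∀ {u} → S u ≡ false → φ u ≡ u
    φ-out {u} u∉S = go (S u) refl u∉S
      where
      go : ∀ b (eq : S u ≡ b) → b ≡ false → φ′ u b eq ≡ u
      go false eq _ = refl

    candidate-cong : ∀ {u v} → Walk a u v → ∀ b → candidate u b ≡ candidate v b
    candidate-cong {u} {v} u→v b = cong (N b ∧_) (go (walk? b u) (walk? b v))
      where
      go : (p : Dec (Walk a b u)) (q : Dec (Walk a b v)) → does p ≡ does q
      go (yes p) (yes q) = refl
      go (yes p) (no ¬q) = contradiction (walk-++ p u→v) ¬q
      go (no ¬p) (yes q) = contradiction (walk-++ q (walk-reverse a-sym u→v)) ¬p
      go (no ¬p) (no ¬q) = refl

    move : ∀ {u v} (p : Place u) j → at (γ (matched (base p) (base∈ p))) j ≡ v → Walk a u v → Place v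
    move p j eq u→v = record { base = base p ; base∈ = base∈ p ; index = j ; at≡ = eq
                             ; least-base = trans (least-cong (λ b → sym (candidate-cong u→v b))) (least-base p) }

    φ-edge : ∀ u v → a u v ≡ true → h (φ u) (φ v) ≡ true
    φ-edge u v e = go (place u u∈S)
      where
      u∈S = a⊆S u v e
      v∈S = a⊆S v u (trans (a-sym v u) e)
      go : Place u → h (φ u) (φ v) ≡ true
      go p = [ (λ eq → subst₂ (λ x y → h x y ≡ true) (sym (φ-in u∈S p))
                   (sym (φ-in v∈S (move p (ℤ.pred (index p)) (sym eq) (step e here))))
                   (prev h-sym h-irrefl (η m) (index p)))
             , (λ eq → subst₂ (λ x y → h x y ≡ true) (sym (φ-in u∈S p))
                   (sym (φ-in v∈S (move p (ℤ.suc (index p)) (sym eq) (step e here))))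
                   (next (η m) (index p))) ]′
             (nbr (γ m) (index p) v (subst (λ x → a x v ≡ true) (sym (at≡ p)) e))
        where m = matched (base p) (base∈ p)

    base→ : ∀ {u} (p : Place u) → Walk a (base p) u
    base→ p = subst₂ (Walk a) (γ₀ m) (at≡ p) (line-walk a-sym a-irrefl (γ m) (index p))
      where m = matched (base p) (base∈ p)

    -- Equal targets put `c` in the component of `b` in `h`, hence on the line `η` of `b`. As `c` is
    -- in `N`, `η⇒γ` places it on the line `γ` of `b` as well. Then both vertices lie in one
    -- component of `a` and share their least base.
    target-injective : ∀ {u v} (p : Place u) (q : Place v) → target p ≡ target q → u ≡ v
    target-injective {u} {v} p@(record { base = b ; base∈ = b∈ ; index = i }) q@(record { base = c ; base∈ = c∈ ; index = j }) eq
      = conclude p q eq (just-injective (trans (sym (least-base p)) (trans (least-cong (candidate-cong u→v)) (least-base q))))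
      where
      mb = matched b b∈
      mc = matched c c∈
      b→c : Walk a b c
      b→c with k , atₖ ← on-η b∈ (walk-++ (subst₂ (Walk h) (η₀ mb) refl (line-walk h-sym h-irrefl (η mb) i))
                                   (walk-reverse h-sym (subst₂ (Walk h) (η₀ mc) (sym eq) (line-walk h-sym h-irrefl (η mc) j))))
        = subst₂ (Walk a) (γ₀ mb) (η⇒γ mb k c c∈ atₖ) (line-walk a-sym a-irrefl (γ mb) k)
      u→v : Walk a u v
      u→v = walk-++ (walk-reverse a-sym (base→ p)) (walk-++ b→c (base→ q))
      conclude : ∀ {u v} (p : Place u) (q : Place v) → target p ≡ target q → base p ≡ base q → u ≡ v
      conclude record { base∈ = p∈ ; index = i ; at≡ = atᵢ } record { base∈ = q∈ ; index = j ; at≡ = atⱼ } eq refl =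
        trans (sym atᵢ) (trans (same-index⁻¹ p∈ q∈ i j eq) atⱼ)

    φ-S : ∀ u → S (φ u) ≡ S u
    φ-S u = go (S u) refl
      where
      target∈S : (p : Place u) → S (target p) ≡ true
      target∈S p = h⊆S _ _ (next (η (matched (base p) (base∈ p))) (index p))
      go : ∀ b → S u ≡ b → S (φ u) ≡ b
      go true  u∈S = trans (cong S (φ-in u∈S (place u u∈S))) (target∈S (place u u∈S))
      go false u∉S = trans (cong S (φ-out u∉S)) u∉S

    φ-injective : ∀ {u v} → φ u ≡ φ v → u ≡ v
    φ-injective {u} {v} eq = go (S u) (S v) refl refl (trans (sym (φ-S u)) (trans (cong S eq) (φ-S v)))
      where
      go : ∀ b c → S u ≡ b → S v ≡ c → S u ≡ S v → u ≡ v
      go true  true  u∈S v∈S _ = target-injective (place u u∈S) (place v v∈S)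
        (trans (sym (φ-in u∈S (place u u∈S))) (trans eq (φ-in v∈S (place v v∈S))))
      go false false u∉S v∉S _ = trans (sym (φ-out u∉S)) (trans eq (φ-out v∉S))
      go true  false u∈S v∉S e = ⊥-elim (true≢false (trans (sym e) u∈S) v∉S)
      go false true  u∉S v∈S e = ⊥-elim (true≢false (trans e v∈S) u∉S)

    -- A neighbour of `φ u` is adjacent to it on `η`, so it is the image of a neighbour of `u` on
    -- `γ`; injectivity identifies that neighbour with `v`.
    φ-edge⁻¹ : ∀ u v → h (φ u) (φ v) ≡ true → a u v ≡ true
    φ-edge⁻¹ u v e = go (place u u∈S)
      where
      u∈S : S u ≡ true
      u∈S = trans (sym (φ-S u)) (h⊆S _ _ e)
      go : Place u → a u v ≡ true
      go p = [ (λ eq → back (ℤ.pred (index p)) eq (prev a-sym a-irrefl (γ m) (index p)))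
             , (λ eq → back (ℤ.suc (index p)) eq (next (γ m) (index p))) ]′
             (nbr (η m) (index p) (φ v) (subst (λ x → h x (φ v) ≡ true) (φ-in u∈S p) e))
        where
        m = matched (base p) (base∈ p)
        back : ∀ j → φ v ≡ at (η m) j → a (at (γ m) (index p)) (at (γ m) j) ≡ true → a u v ≡ true
        back j eq e′ = subst₂ (λ x y → a x y ≡ true) (at≡ p) (φ-injective (trans (φ-in w∈S (move p j refl u→w)) (sym eq))) e′
          where
          u→w : Walk a u (at (γ m) j)
          u→w = step (subst (λ x → a x (at (γ m) j) ≡ true) (at≡ p) e′) here
          w∈S : S (at (γ m) j) ≡ true
          w∈S = a⊆S _ _ (trans (a-sym _ _) e′)

    φ-fixes : ∀ u → N u ≡ true → φ u ≡ u
    φ-fixes u u∈N = go (S u) refl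
      where
      go : ∀ b → S u ≡ b → φ u ≡ u
      go false u∉S = φ-out u∉S
      go true  u∈S = trans (φ-in u∈S p) (γ⇒η (matched (base p) (base∈ p)) (index p) u u∈N (at≡ p))
        where p = place u u∈S

    φ-iso : ∀ u v → h (φ u) (φ v) ≡ a u v
    φ-iso u v with a u v in e | h (φ u) (φ v) in e′
    ... | true  | true  = refl
    ... | false | false = refl
    ... | true  | false = ⊥-elim (true≢false (φ-edge u v e) e′)
    ... | false | true  = ⊥-elim (true≢false (φ-edge⁻¹ u v e′) e)

  -- All classical input is gathered here: a matching for every common vertex, and decidability of
  -- the existence of walks, by which least bases are selected.
  cycles-isomorphic : (∀ b → N b ≡ true → Σ (Line a) λ γ → at γ 0ℤ ≡ b) → (∀ b → N b ≡ true → Σ (Line h) λ η → at η 0ℤ ≡ b) →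
    DistancePreserving N a h → DistancePreserving N h a →
    ¬ ¬ (Σ (Permutation′ n) λ φ → (∀ u v → h (φ ⟨$⟩ʳ u) (φ ⟨$⟩ʳ v) ≡ a u v) ×
          (∀ u → N u ≡ true ⊎ S u ≡ false → φ ⟨$⟩ʳ u ≡ u))
  cycles-isomorphic a-line h-line a⇒h h⇒a k =
    ¬¬-choice matched λ m → ¬¬-choice (λ b → ¬¬-choice (λ u → ¬¬-excluded-middle)) λ walk? →
    let module I = Assemble m walk?
        φ , φ≡ = injective⇒permutation I.φ I.φ-injective
    in k (φ , (λ u v → trans (cong₂ h (φ≡ u) (φ≡ v)) (I.φ-iso u v)) ,
          (λ u → λ { (inj₁ u∈N) → trans (φ≡ u) (I.φ-fixes u u∈N) ; (inj₂ u∉S) → trans (φ≡ u) (I.φ-out u∉S) }))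
    where
    matched : ∀ b → ¬ ¬ (N b ≡ true → Matched a h N b)
    matched b k = go (N b) refl
      where
      go : ∀ c → N b ≡ c → ⊥
      go true  b∈N = match a-sym a-irrefl h-sym h-irrefl a⇒h h⇒a b∈N
        (proj₁ (a-line b b∈N)) (proj₁ (h-line b b∈N)) (proj₂ (a-line b b∈N)) (proj₂ (h-line b b∈N)) λ m → k λ _ → m
      go false b∉N = k λ b∈N → ⊥-elim (true≢false b∈N b∉N)

-- Ordered fields, finite sums and orthogonal matrices

module OverField (ℝ : RealField) where

  module R = RealField ℝ
  open R using (Carrier; _≈_; 0#; 1#; _<ᴿ_)
    renaming (_+_ to infixl 6 _+ᴿ_; _*_ to infixl 7 _*ᴿ_; -_ to infix 8 -ᴿ_) public
  open Algebra.Properties.Ring R.ring using (-‿distribˡ-*; -‿distribʳ-*; -‿involutive; x∙y⁻¹≈ε⇒x≈y) public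
  open Algebra.Properties.Semiring.Sum R.semiring
    using () renaming (sum to ∑ᴿ; sum-cong-≋ to ∑ᴿ-cong; ∑-distrib-+ to ∑ᴿ-+; ∑-comm to ∑ᴿ-swap;
                       *-distribˡ-sum to ∑ᴿ-*ˡ; *-distribʳ-sum to ∑ᴿ-*ʳ) public
  open Algebra.Solver.Ring.NaturalCoefficients.Default R.commutativeSemiring using (solve; _:=_; _:+_; _:*_) public
  open Relation.Binary.Reasoning.Setoid R.setoid public
  private module O = IsStrictTotalOrder R.isStrictTotal

  <-respʳ : ∀ {x y z} → y ≈ z → x <ᴿ y → x <ᴿ z
  <-respʳ = proj₁ O.<-resp-≈

  <-respˡ : ∀ {x y z} → y ≈ z → y <ᴿ x → z <ᴿ x
  <-respˡ = proj₂ O.<-resp-≈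

  NonNeg : Carrier → Set
  NonNeg x = 0# <ᴿ x ⊎ x ≈ 0#

  positive+nonneg : ∀ {x y} → 0# <ᴿ x → NonNeg y → 0# <ᴿ (x +ᴿ y)
  positive+nonneg {x} {y} 0<x (inj₁ 0<y) = O.trans 0<y (<-respˡ (R.+-identityˡ y) (R.+-mono-< y 0<x))
  positive+nonneg {x} {y} 0<x (inj₂ y≈0) = <-respʳ (R.trans (R.sym (R.+-identityʳ x)) (R.+-congˡ (R.sym y≈0))) 0<x

  nonneg+nonneg : ∀ {x y} → NonNeg x → NonNeg y → NonNeg (x +ᴿ y)
  nonneg+nonneg (inj₁ 0<x) y≥0 = inj₁ (positive+nonneg 0<x y≥0)
  nonneg+nonneg {x} {y} (inj₂ x≈0) y≥0 = [ (λ 0<y → inj₁ (<-respʳ (R.sym x+y≈y) 0<y)) , (λ y≈0 → inj₂ (R.trans x+y≈y y≈0)) ]′ y≥0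
    where
    x+y≈y : x +ᴿ y ≈ y
    x+y≈y = R.trans (R.+-congʳ x≈0) (R.+-identityˡ y)

  nonneg-sum-zero : ∀ {x y} → NonNeg x → NonNeg y → x +ᴿ y ≈ 0# → x ≈ 0#
  nonneg-sum-zero (inj₂ x≈0) _ _ = x≈0
  nonneg-sum-zero (inj₁ 0<x) y≥0 x+y≈0 = ⊥-elim (O.irrefl R.refl (<-respʳ x+y≈0 (positive+nonneg 0<x y≥0)))

  square-nonneg : ∀ x → NonNeg (x *ᴿ x)
  square-nonneg x with O.compare x 0#
  ... | tri≈ _ x≈0 _ = inj₂ (R.trans (R.*-congʳ x≈0) (R.zeroˡ x))
  ... | tri> _ _ 0<x = inj₁ (R.*-pos 0<x 0<x)
  ... | tri< x<0 _ _ = inj₁ (<-respʳ -x*-x≈x*x (R.*-pos 0<-x 0<-x))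
    where
    0<-x : 0# <ᴿ (-ᴿ x)
    0<-x = <-respʳ (R.+-identityˡ _) (<-respˡ (R.-‿inverseʳ x) (R.+-mono-< (-ᴿ x) x<0))
    -x*-x≈x*x : -ᴿ x *ᴿ -ᴿ x ≈ x *ᴿ x
    -x*-x≈x*x = R.trans (R.sym (-‿distribˡ-* x (-ᴿ x)))
                  (R.trans (R.-‿cong (R.sym (-‿distribʳ-* x x))) (-‿involutive (x *ᴿ x)))

  square-zero : ∀ {x} → x *ᴿ x ≈ 0# → x ≈ 0#
  square-zero {x} xx≈0 with O.compare x 0#
  ... | tri≈ _ x≈0 _ = x≈0
  ... | tri> _ _ 0<x = ⊥-elim (O.irrefl R.refl (<-respʳ xx≈0 (R.*-pos 0<x 0<x)))
  ... | tri< x<0 x≉0 _ with y , xy≈1 ← R.inverse x x≉0 = begin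
    x                       ≈⟨ R.*-identityʳ x ⟨
    x *ᴿ 1#                 ≈⟨ R.*-congˡ xy≈1 ⟨
    x *ᴿ (x *ᴿ y)           ≈⟨ R.*-assoc x x y ⟨
    x *ᴿ x *ᴿ y             ≈⟨ R.*-congʳ xx≈0 ⟩
    0# *ᴿ y                 ≈⟨ R.zeroˡ y ⟩
    0#                      ∎

  0<1 : 0# <ᴿ 1#
  0<1 with square-nonneg 1#
  ... | inj₁ 0<1*1 = <-respʳ (R.*-identityˡ 1#) 0<1*1
  ... | inj₂ 1*1≈0 = ⊥-elim (R.0≉1 (R.trans (R.sym 1*1≈0) (R.*-identityˡ 1#)))

  +-cancelˡ : ∀ x {y z} → x +ᴿ y ≈ x +ᴿ z → y ≈ z
  +-cancelˡ x {y} {z} eq = begin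
    y                       ≈⟨ R.+-identityˡ y ⟨
    0# +ᴿ y                 ≈⟨ R.+-congʳ (R.-‿inverseˡ x) ⟨
    -ᴿ x +ᴿ x +ᴿ y          ≈⟨ R.+-assoc _ _ _ ⟩
    -ᴿ x +ᴿ (x +ᴿ y)        ≈⟨ R.+-congˡ eq ⟩
    -ᴿ x +ᴿ (x +ᴿ z)        ≈⟨ R.+-assoc _ _ _ ⟨
    -ᴿ x +ᴿ x +ᴿ z          ≈⟨ R.+-congʳ (R.-‿inverseˡ x) ⟩
    0# +ᴿ z                 ≈⟨ R.+-identityˡ z ⟩
    z                       ∎

  natℝ-nonneg : ∀ m → NonNeg (natℝ ℝ m)
  natℝ-nonneg zero    = inj₂ R.refl
  natℝ-nonneg (suc m) = inj₁ (positive+nonneg 0<1 (natℝ-nonneg m))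

  natℝ-suc≉0 : ∀ m → ¬ (natℝ ℝ (suc m) ≈ 0#)
  natℝ-suc≉0 m eq = O.irrefl R.refl (<-respʳ eq (positive+nonneg 0<1 (natℝ-nonneg m)))

  natℝ-injective : ∀ m p → natℝ ℝ m ≈ natℝ ℝ p → m ≡ p
  natℝ-injective zero    zero    eq = refl
  natℝ-injective zero    (suc p) eq = ⊥-elim (natℝ-suc≉0 p (R.sym eq))
  natℝ-injective (suc m) zero    eq = ⊥-elim (natℝ-suc≉0 m eq)
  natℝ-injective (suc m) (suc p) eq = cong suc (natℝ-injective m p (+-cancelˡ 1# eq))

  ⟦_⟧ : Bool → Carrier
  ⟦ b ⟧ = if b then 1# else 0#

  ⟦⟧-idem : ∀ b → ⟦ b ⟧ *ᴿ ⟦ b ⟧ ≈ ⟦ b ⟧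
  ⟦⟧-idem true  = R.*-identityˡ 1#
  ⟦⟧-idem false = R.zeroˡ 0#

  ∑ᴿ-zero : ∀ {n} {f : Fin n → Carrier} → (∀ i → f i ≈ 0#) → ∑ᴿ f ≈ 0#
  ∑ᴿ-zero {zero}  f≈0 = R.refl
  ∑ᴿ-zero {suc n} f≈0 = R.trans (R.+-cong (f≈0 zero) (∑ᴿ-zero (f≈0 ∘ suc))) (R.+-identityˡ 0#)

  ∑ᴿ-single : ∀ {n} (f : Fin n → Carrier) i → (∀ j → j ≢ i → f j ≈ 0#) → ∑ᴿ f ≈ f i
  ∑ᴿ-single f zero    f≈0 = R.trans (R.+-congˡ (∑ᴿ-zero λ j → f≈0 (suc j) λ ())) (R.+-identityʳ _)
  ∑ᴿ-single f (suc i) f≈0 = R.trans (R.+-cong (f≈0 zero λ ()) (∑ᴿ-single (f ∘ suc) i λ j j≢i → f≈0 (suc j) (j≢i ∘ Fin-suc-injective)))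
                              (R.+-identityˡ _)

  ∑ᴿ-count : ∀ {n} (p : Fin n → Bool) → ∑ᴿ (λ i → ⟦ p i ⟧) ≈ natℝ ℝ (countFin n p)
  ∑ᴿ-count {zero}  p = R.refl
  ∑ᴿ-count {suc n} p with p zero
  ... | true  = R.+-congˡ (∑ᴿ-count (p ∘ suc))
  ... | false = R.trans (R.+-identityˡ _) (∑ᴿ-count (p ∘ suc))

  ∑ᴿ-nonneg : ∀ {n} {f : Fin n → Carrier} → (∀ i → NonNeg (f i)) → NonNeg (∑ᴿ f)
  ∑ᴿ-nonneg {zero}  f≥0 = inj₂ R.refl
  ∑ᴿ-nonneg {suc n} f≥0 = nonneg+nonneg (f≥0 zero) (∑ᴿ-nonneg (f≥0 ∘ suc))

  ∑ᴿ-nonneg-zero : ∀ {n} {f : Fin n → Carrier} → (∀ i → NonNeg (f i)) → ∑ᴿ f ≈ 0# → ∀ i → f i ≈ 0#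
  ∑ᴿ-nonneg-zero {suc n} f≥0 ∑≈0 zero    = nonneg-sum-zero (f≥0 zero) (∑ᴿ-nonneg (f≥0 ∘ suc)) ∑≈0
  ∑ᴿ-nonneg-zero {suc n} f≥0 ∑≈0 (suc i) = ∑ᴿ-nonneg-zero (f≥0 ∘ suc)
    (nonneg-sum-zero (∑ᴿ-nonneg (f≥0 ∘ suc)) (f≥0 zero) (R.trans (R.+-comm _ _) ∑≈0)) i

  ∑∑ᴿ-cong : ∀ {m n} {f g : Fin m → Fin n → Carrier} → (∀ i j → f i j ≈ g i j) →
             ∑ᴿ (λ i → ∑ᴿ (f i)) ≈ ∑ᴿ (λ i → ∑ᴿ (g i))
  ∑∑ᴿ-cong {f = f} {g} f≈g = ∑ᴿ-cong {x = λ i → ∑ᴿ (f i)} {y = λ i → ∑ᴿ (g i)} λ i → ∑ᴿ-cong (f≈g i)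

  ∑∑ᴿ-+ : ∀ {m n} (f g : Fin m → Fin n → Carrier) →
          ∑ᴿ (λ i → ∑ᴿ (λ j → f i j +ᴿ g i j)) ≈ ∑ᴿ (λ i → ∑ᴿ (f i)) +ᴿ ∑ᴿ (λ i → ∑ᴿ (g i))
  ∑∑ᴿ-+ f g = R.trans (∑ᴿ-cong (λ i → ∑ᴿ-+ (f i) (g i))) (∑ᴿ-+ (λ i → ∑ᴿ (f i)) (λ i → ∑ᴿ (g i)))

  -- The equality case of Cauchy–Schwarz: the sum of all (x − y)² is s − 2s + s = 0.
  equal-moments : ∀ {m n} (x y : Fin m → Fin n → Carrier) s →
    ∑ᴿ (λ i → ∑ᴿ λ j → x i j *ᴿ x i j) ≈ s → ∑ᴿ (λ i → ∑ᴿ λ j → x i j *ᴿ y i j) ≈ s →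
    ∑ᴿ (λ i → ∑ᴿ λ j → y i j *ᴿ y i j) ≈ s → ∀ i j → x i j ≈ y i j
  equal-moments x y s xx xy yy i j = x∙y⁻¹≈ε⇒x≈y _ _ (square-zero
    (∑ᴿ-nonneg-zero (λ j → square-nonneg (d i j)) (∑ᴿ-nonneg-zero (λ i → ∑ᴿ-nonneg λ j → square-nonneg (d i j)) dd≈0 i) j))
    where
    d : ∀ i j → Carrier
    d i j = x i j +ᴿ -ᴿ (y i j)
    restore : ∀ i j → d i j +ᴿ y i j ≈ x i j
    restore i j = R.trans (R.+-assoc _ _ _) (R.trans (R.+-congˡ (R.-‿inverseˡ _)) (R.+-identityʳ _))
    -- With x = d + y, the identity d² + 2xy = x² + y² involves no subtraction and holds in every
    -- commutative semiring.
    expand : ∀ d y → (d *ᴿ d) +ᴿ ((d +ᴿ y) *ᴿ y +ᴿ (d +ᴿ y) *ᴿ y) ≈ (d +ᴿ y) *ᴿ (d +ᴿ y) +ᴿ y *ᴿ y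
    expand = solve 2 (λ d y → (d :* d) :+ ((d :+ y) :* y :+ (d :+ y) :* y) := (d :+ y) :* (d :+ y) :+ y :* y) R.refl
    pointwise : ∀ i j → (d i j *ᴿ d i j) +ᴿ (x i j *ᴿ y i j +ᴿ x i j *ᴿ y i j) ≈ x i j *ᴿ x i j +ᴿ y i j *ᴿ y i j
    pointwise i j = begin
      (d i j *ᴿ d i j) +ᴿ (x i j *ᴿ y i j +ᴿ x i j *ᴿ y i j)
        ≈⟨ R.+-congˡ (R.+-cong (R.*-congʳ (restore i j)) (R.*-congʳ (restore i j))) ⟨
      (d i j *ᴿ d i j) +ᴿ ((d i j +ᴿ y i j) *ᴿ y i j +ᴿ (d i j +ᴿ y i j) *ᴿ y i j)
        ≈⟨ expand (d i j) (y i j) ⟩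
      (d i j +ᴿ y i j) *ᴿ (d i j +ᴿ y i j) +ᴿ y i j *ᴿ y i j
        ≈⟨ R.+-congʳ (R.*-cong (restore i j) (restore i j)) ⟩
      x i j *ᴿ x i j +ᴿ y i j *ᴿ y i j ∎
    dd≈0 : ∑ᴿ (λ i → ∑ᴿ λ j → d i j *ᴿ d i j) ≈ 0#
    dd≈0 = +-cancelˡ (s +ᴿ s) (begin
      s +ᴿ s +ᴿ ∑ᴿ (λ i → ∑ᴿ λ j → d i j *ᴿ d i j)
        ≈⟨ R.+-comm _ _ ⟩
      ∑ᴿ (λ i → ∑ᴿ λ j → d i j *ᴿ d i j) +ᴿ (s +ᴿ s)
        ≈⟨ R.+-congˡ (R.trans (∑∑ᴿ-+ (λ i j → x i j *ᴿ y i j) (λ i j → x i j *ᴿ y i j)) (R.+-cong xy xy)) ⟨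
      ∑ᴿ (λ i → ∑ᴿ λ j → d i j *ᴿ d i j) +ᴿ ∑ᴿ (λ i → ∑ᴿ λ j → x i j *ᴿ y i j +ᴿ x i j *ᴿ y i j)
        ≈⟨ ∑∑ᴿ-+ (λ i j → d i j *ᴿ d i j) (λ i j → x i j *ᴿ y i j +ᴿ x i j *ᴿ y i j) ⟨
      ∑ᴿ (λ i → ∑ᴿ λ j → (d i j *ᴿ d i j) +ᴿ (x i j *ᴿ y i j +ᴿ x i j *ᴿ y i j))
        ≈⟨ ∑∑ᴿ-cong pointwise ⟩
      ∑ᴿ (λ i → ∑ᴿ λ j → x i j *ᴿ x i j +ᴿ y i j *ᴿ y i j)
        ≈⟨ ∑∑ᴿ-+ (λ i j → x i j *ᴿ x i j) (λ i j → y i j *ᴿ y i j) ⟩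
      ∑ᴿ (λ i → ∑ᴿ λ j → x i j *ᴿ x i j) +ᴿ ∑ᴿ (λ i → ∑ᴿ λ j → y i j *ᴿ y i j)
        ≈⟨ R.+-cong xx yy ⟩
      s +ᴿ s
        ≈⟨ R.+-identityʳ _ ⟨
      s +ᴿ s +ᴿ 0# ∎)

  Vector : ℕ → Set
  Vector n = Fin n → Carrier

  infix 4 _≋_
  _≋_ : ∀ {n} → Vector n → Vector n → Set
  x ≋ y = ∀ i → x i ≈ y i

  infixr 8 _·_
  _·_ : ∀ {m n} → Matrix ℝ m n → Vector n → Vector m
  (M · z) i = ∑ᴿ λ j → M i j *ᴿ z j

  _ᵀ : ∀ {m n} → Matrix ℝ m n → Matrix ℝ n m
  (M ᵀ) i j = M j i

  ⟨_,_⟩ : ∀ {n} → Vector n → Vector n → Carrier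
  ⟨ x , y ⟩ = ∑ᴿ λ i → x i *ᴿ y i

  ⟨⟩-cong : ∀ {n} {x x′ y y′ : Vector n} → x ≋ x′ → y ≋ y′ → ⟨ x , y ⟩ ≈ ⟨ x′ , y′ ⟩
  ⟨⟩-cong x≋x′ y≋y′ = ∑ᴿ-cong λ i → R.*-cong (x≋x′ i) (y≋y′ i)

  ·-congˡ : ∀ {m n} (M : Matrix ℝ m n) {x y : Vector n} → x ≋ y → M · x ≋ M · y
  ·-congˡ M x≋y i = ∑ᴿ-cong λ j → R.*-congˡ (x≋y j)

  ·-+ : ∀ {m n} (M : Matrix ℝ m n) (x y : Vector n) → M · (λ i → x i +ᴿ y i) ≋ λ i → (M · x) i +ᴿ (M · y) i
  ·-+ M x y i = R.trans (∑ᴿ-cong λ j → R.distribˡ (M i j) (x j) (y j)) (∑ᴿ-+ (λ j → M i j *ᴿ x j) _)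

  ·-* : ∀ {m n} (M : Matrix ℝ m n) q (x : Vector n) → M · (λ i → q *ᴿ x i) ≋ λ i → q *ᴿ (M · x) i
  ·-* M q x i = R.sym (R.trans (∑ᴿ-*ˡ q (λ j → M i j *ᴿ x j)) (∑ᴿ-cong λ j → exchange q (M i j) (x j)))
    where
    exchange : ∀ a b c → a *ᴿ (b *ᴿ c) ≈ b *ᴿ (a *ᴿ c)
    exchange = solve 3 (λ a b c → a :* (b :* c) := b :* (a :* c)) R.refl

  ·-assoc : ∀ {l m n} (M : Matrix ℝ l m) (K : Matrix ℝ m n) z →
            M · K · z ≋ (λ i j → ∑ᴿ λ a → M i a *ᴿ K a j) · z
  ·-assoc M K z i = begin
    ∑ᴿ (λ a → M i a *ᴿ ∑ᴿ (λ j → K a j *ᴿ z j))        ≈⟨ ∑ᴿ-cong (λ a → ∑ᴿ-*ˡ (M i a) (λ j → K a j *ᴿ z j)) ⟩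
    ∑ᴿ (λ a → ∑ᴿ (λ j → M i a *ᴿ (K a j *ᴿ z j)))      ≈⟨ ∑ᴿ-swap (λ a j → M i a *ᴿ (K a j *ᴿ z j)) ⟩
    ∑ᴿ (λ j → ∑ᴿ (λ a → M i a *ᴿ (K a j *ᴿ z j)))      ≈⟨ ∑∑ᴿ-cong (λ j a → R.sym (R.*-assoc (M i a) (K a j) (z j))) ⟩
    ∑ᴿ (λ j → ∑ᴿ (λ a → M i a *ᴿ K a j *ᴿ z j))        ≈⟨ ∑ᴿ-cong (λ j → ∑ᴿ-*ʳ (z j) (λ a → M i a *ᴿ K a j)) ⟨
    ∑ᴿ (λ j → ∑ᴿ (λ a → M i a *ᴿ K a j) *ᴿ z j)        ∎

  adjoint : ∀ {m n} (M : Matrix ℝ m n) x y → ⟨ M · x , y ⟩ ≈ ⟨ x , M ᵀ · y ⟩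
  adjoint M x y = begin
    ∑ᴿ (λ i → ∑ᴿ (λ j → M i j *ᴿ x j) *ᴿ y i)          ≈⟨ ∑ᴿ-cong (λ i → ∑ᴿ-*ʳ (y i) (λ j → M i j *ᴿ x j)) ⟩
    ∑ᴿ (λ i → ∑ᴿ (λ j → M i j *ᴿ x j *ᴿ y i))          ≈⟨ ∑ᴿ-swap (λ i j → M i j *ᴿ x j *ᴿ y i) ⟩
    ∑ᴿ (λ j → ∑ᴿ (λ i → M i j *ᴿ x j *ᴿ y i))          ≈⟨ ∑∑ᴿ-cong (λ j i → exchange (M i j) (x j) (y i)) ⟩
    ∑ᴿ (λ j → ∑ᴿ (λ i → x j *ᴿ (M i j *ᴿ y i)))        ≈⟨ ∑ᴿ-cong (λ j → ∑ᴿ-*ˡ (x j) (λ i → M i j *ᴿ y i)) ⟨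
    ∑ᴿ (λ j → x j *ᴿ ∑ᴿ (λ i → M i j *ᴿ y i))          ∎
    where
    exchange : ∀ a b c → a *ᴿ b *ᴿ c ≈ b *ᴿ (a *ᴿ c)
    exchange = solve 3 (λ a b c → a :* b :* c := b :* (a :* c)) R.refl

  δ-≡ : ∀ {n} (i : Fin n) → identity ℝ i i ≈ 1#
  δ-≡ i with i ≟ i
  ... | yes _   = R.refl
  ... | no  i≢i = contradiction refl i≢i

  δ-≢ : ∀ {n} {i j : Fin n} → i ≢ j → identity ℝ i j ≈ 0#
  δ-≢ {i = i} {j} i≢j with i ≟ j
  ... | yes i≡j = contradiction i≡j i≢j
  ... | no  _   = R.refl

  identity-· : ∀ {n} (z : Vector n) → identity ℝ · z ≋ z
  identity-· z i = R.trans (∑ᴿ-single _ i λ j j≢i → R.trans (R.*-congʳ (δ-≢ (j≢i ∘ sym))) (R.zeroˡ (z j)))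
    (R.trans (R.*-congʳ (δ-≡ i)) (R.*-identityˡ (z i)))

  Isometric : ∀ {n} → Matrix ℝ n n → Set
  Isometric D = ∀ i j → ∑ᴿ (λ l → D l i *ᴿ D l j) ≈ identity ℝ i j

  module _ {n} {D : Matrix ℝ n n} (DᵀD : Isometric D) where

    ᵀ-cancel : ∀ z → D ᵀ · D · z ≋ z
    ᵀ-cancel z i = R.trans (·-assoc (D ᵀ) D z i) (R.trans (∑ᴿ-cong λ j → R.*-congʳ (DᵀD i j)) (identity-· z i))

    isometry : ∀ x y → ⟨ D · x , D · y ⟩ ≈ ⟨ x , y ⟩
    isometry x y = R.trans (adjoint D x (D · y)) (⟨⟩-cong (λ _ → R.refl) (ᵀ-cancel y))

    ·-injective : ∀ {x y} → D · x ≋ D · y → x ≋ y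
    ·-injective {x} {y} eq i = R.trans (R.sym (ᵀ-cancel x i)) (R.trans (·-congˡ (D ᵀ) eq i) (ᵀ-cancel y i))

    -- That a left inverse is a right inverse follows without determinants. For P = DDᵀ, the
    -- entrywise inner products of I with I, I with P and P with P all equal the trace of P, so
    -- `equal-moments` gives P = I.
    ᵀ-isometric : Isometric (D ᵀ)
    ᵀ-isometric i j = R.sym (equal-moments (identity ℝ) P (∑ᴿ (λ i → P i i)) δδ δP PP i j)
      where
      P : Matrix ℝ n n
      P i j = ∑ᴿ λ l → D i l *ᴿ D j l
      trace : ∑ᴿ (λ i → P i i) ≈ ∑ᴿ (λ i → identity ℝ {n} i i)
      trace = R.trans (∑ᴿ-swap (λ i l → D i l *ᴿ D i l)) (∑ᴿ-cong λ l → DᵀD l l)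
      δδ : ∑ᴿ (λ i → ∑ᴿ λ j → identity ℝ {n} i j *ᴿ identity ℝ i j) ≈ ∑ᴿ (λ i → P i i)
      δδ = R.trans (∑ᴿ-cong {n} λ i → identity-· (identity ℝ i) i) (R.sym trace)
      δP : ∑ᴿ (λ i → ∑ᴿ λ j → identity ℝ i j *ᴿ P i j) ≈ ∑ᴿ (λ i → P i i)
      δP = ∑ᴿ-cong {n} λ i → identity-· (P i) i
      PP : ∑ᴿ (λ i → ∑ᴿ λ j → P i j *ᴿ P i j) ≈ ∑ᴿ (λ i → P i i)
      PP = ∑ᴿ-cong {n} λ i → R.trans (⟨⟩-cong (P≋ i) (P≋ i)) (isometry (D i) (D i))
        where
        P≋ : ∀ i → P i ≋ D · D i
        P≋ i j = ∑ᴿ-cong λ l → R.*-comm (D i l) (D j l)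

-- Laplacian forms and orthogonal conjugation

module Spectra (ℝ : RealField) where
  open OverField ℝ

  adjᴿ : ∀ {n} → Rel n → Matrix ℝ n n
  adjᴿ a i j = ⟦ a i j ⟧

  degᴿ : ∀ {n} → Rel n → Vector n
  degᴿ a u = ∑ᴿ λ v → ⟦ a u v ⟧

  private
    ×-exchange : ∀ a b c d → (a *ᴿ b) *ᴿ (c *ᴿ d) ≈ (a *ᴿ c) *ᴿ (b *ᴿ d)
    ×-exchange = solve 4 (λ a b c d → (a :* b) :* (c :* d) := (a :* c) :* (b :* d)) R.refl

    ×-rotate : ∀ a b c → a *ᴿ (b *ᴿ c) ≈ b *ᴿ (a *ᴿ c)
    ×-rotate = solve 3 (λ a b c → a :* (b :* c) := b :* (a :* c)) R.refl

  -- The hypothesis says that the Laplacian quadratic form of a vanishes at z.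
  laplacian-zero : ∀ {n} {a : Rel n} → Symmetric a → ∀ z →
    ⟨ z , adjᴿ a · z ⟩ ≈ ∑ᴿ (λ u → degᴿ a u *ᴿ (z u *ᴿ z u)) → ∀ u v → a u v ≡ true → z u ≈ z v
  laplacian-zero {n} {a} a-sym z form u v e = begin
    z u                 ≈⟨ R.*-identityˡ (z u) ⟨
    1# *ᴿ z u           ≡⟨ cong (λ b → ⟦ b ⟧ *ᴿ z u) e ⟨
    ⟦ a u v ⟧ *ᴿ z u    ≈⟨ equal-moments x y s xx xy yy u v ⟩
    ⟦ a u v ⟧ *ᴿ z v    ≡⟨ cong (λ b → ⟦ b ⟧ *ᴿ z v) e ⟩
    1# *ᴿ z v           ≈⟨ R.*-identityˡ (z v) ⟩
    z v                 ∎
    where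
    -- The values of `z` at the two ends of each ordered edge. The Laplacian form is half the sum of
    -- (x - y)², so its vanishing is the equality case of Cauchy-Schwarz.
    x y : Matrix ℝ n n
    x u v = ⟦ a u v ⟧ *ᴿ z u
    y u v = ⟦ a u v ⟧ *ᴿ z v
    s : Carrier
    s = ∑ᴿ λ u → degᴿ a u *ᴿ (z u *ᴿ z u)
    masked : ∀ b p q → (⟦ b ⟧ *ᴿ p) *ᴿ (⟦ b ⟧ *ᴿ q) ≈ ⟦ b ⟧ *ᴿ (p *ᴿ q)
    masked b p q = R.trans (×-exchange ⟦ b ⟧ p ⟦ b ⟧ q) (R.*-congʳ (⟦⟧-idem b))
    xx : ∑ᴿ (λ u → ∑ᴿ λ v → x u v *ᴿ x u v) ≈ s
    xx = ∑ᴿ-cong λ u → R.trans (∑ᴿ-cong λ v → masked (a u v) (z u) (z u)) (R.sym (∑ᴿ-*ʳ (z u *ᴿ z u) (λ v → ⟦ a u v ⟧)))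
    xy : ∑ᴿ (λ u → ∑ᴿ λ v → x u v *ᴿ y u v) ≈ s
    xy = R.trans (∑ᴿ-cong λ u → R.trans (∑ᴿ-cong λ v → R.trans (masked (a u v) (z u) (z v)) (×-rotate ⟦ a u v ⟧ (z u) (z v)))
                                  (R.sym (∑ᴿ-*ˡ (z u) (λ v → ⟦ a u v ⟧ *ᴿ z v)))) form
    yy : ∑ᴿ (λ u → ∑ᴿ λ v → y u v *ᴿ y u v) ≈ s
    yy = R.trans (∑ᴿ-swap (λ u v → y u v *ᴿ y u v))
      (R.trans (∑∑ᴿ-cong λ v u → R.reflexive (cong (λ b → (⟦ b ⟧ *ᴿ z v) *ᴿ (⟦ b ⟧ *ᴿ z v)) (a-sym u v))) xx)

  adj-locally-constant : ∀ {n} {a : Rel n} (z : Vector n) → (∀ u v → a u v ≡ true → z u ≈ z v) →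
    adjᴿ a · z ≋ λ u → degᴿ a u *ᴿ z u
  adj-locally-constant {a = a} z const u = R.trans (∑ᴿ-cong pointwise) (R.sym (∑ᴿ-*ʳ (z u) (λ v → ⟦ a u v ⟧)))
    where
    pointwise : ∀ v → ⟦ a u v ⟧ *ᴿ z v ≈ ⟦ a u v ⟧ *ᴿ z u
    pointwise v with a u v in e
    ... | true  = R.*-congˡ (R.sym (const u v e))
    ... | false = R.trans (R.zeroˡ (z v)) (R.sym (R.zeroˡ (z u)))

  constant-along : ∀ {n} {a : Rel n} (z : Vector n) → (∀ u v → a u v ≡ true → z u ≈ z v) → ∀ {u v} → Walk a u v → z u ≈ z v
  constant-along z const here       = R.refl
  constant-along z const (step e w) = R.trans (const _ _ e) (constant-along z const w)

  sumℝ-∑ᴿ : ∀ {n} (f : Vector n) → sumℝ ℝ n f ≈ ∑ᴿ f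
  sumℝ-∑ᴿ {zero}  f = R.refl
  sumℝ-∑ᴿ {suc n} f = R.+-congˡ (sumℝ-∑ᴿ (f ∘ suc))

  conj-column : ∀ {n} (D A : Matrix ℝ n n) i j → conj ℝ D A i j ≈ (D ᵀ · A · λ b → D b j) i
  conj-column D A i j = begin
    sumℝ ℝ _ (λ a → sumℝ ℝ _ λ b → D a i *ᴿ (A a b *ᴿ D b j))   ≈⟨ sumℝ-∑ᴿ (λ a → sumℝ ℝ _ λ b → D a i *ᴿ (A a b *ᴿ D b j)) ⟩
    ∑ᴿ (λ a → sumℝ ℝ _ λ b → D a i *ᴿ (A a b *ᴿ D b j))         ≈⟨ ∑ᴿ-cong (λ a → sumℝ-∑ᴿ (λ b → D a i *ᴿ (A a b *ᴿ D b j))) ⟩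
    ∑ᴿ (λ a → ∑ᴿ λ b → D a i *ᴿ (A a b *ᴿ D b j))               ≈⟨ ∑ᴿ-cong (λ a → ∑ᴿ-*ˡ (D a i) (λ b → A a b *ᴿ D b j)) ⟨
    (D ᵀ · A · λ b → D b j) i                                   ∎

  conj-· : ∀ {n} {D A B : Matrix ℝ n n} → (∀ i j → B i j ≈ conj ℝ D A i j) → ∀ z → B · z ≋ D ᵀ · A · D · z
  conj-· {D = D} {A} {B} B≈ z i = begin
    ∑ᴿ (λ j → B i j *ᴿ z j)
      ≈⟨ ∑ᴿ-cong (λ j → R.*-congʳ (R.trans (B≈ i j) (conj-column D A i j))) ⟩
    ((λ i j → ∑ᴿ λ a → D a i *ᴿ ∑ᴿ λ b → A a b *ᴿ D b j) · z) i
      ≈⟨ ·-assoc (D ᵀ) (λ a j → ∑ᴿ λ b → A a b *ᴿ D b j) z i ⟨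
    (D ᵀ · (λ a j → ∑ᴿ λ b → A a b *ᴿ D b j) · z) i
      ≈⟨ ·-congˡ (D ᵀ) (λ a → R.sym (·-assoc A D z a)) i ⟩
    (D ᵀ · A · D · z) i ∎

  Intertwines : ∀ {n} → Matrix ℝ n n → Rel n → Rel n → Set
  Intertwines D h a = ∀ z → D · adjᴿ h · z ≋ adjᴿ a · D · z

  module Conjugate {n} {D : Matrix ℝ n n} (DᵀD : Isometric D) {a h : Rel n}
    (h≈ : ∀ i j → ⟦ h i j ⟧ ≈ conj ℝ D (adjᴿ a) i j) where

    DDᵀ : Isometric (D ᵀ)
    DDᵀ = ᵀ-isometric DᵀD

    intertwines : Intertwines D h a
    intertwines z i = R.trans (·-congˡ D (conj-· h≈ z) i) (ᵀ-cancel DDᵀ (adjᴿ a · D · z) i)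

    intertwinesᵀ : Intertwines (D ᵀ) a h
    intertwinesᵀ z i = begin
      (D ᵀ · adjᴿ a · z) i               ≈⟨ ·-congˡ (D ᵀ) (·-congˡ (adjᴿ a) (ᵀ-cancel DDᵀ z)) i ⟨
      (D ᵀ · adjᴿ a · D · D ᵀ · z) i     ≈⟨ conj-· h≈ (D ᵀ · z) i ⟨
      (adjᴿ h · D ᵀ · z) i               ∎

    -- Entries are 0 or 1, so the total degree is the squared Frobenius norm. This is unchanged by
    -- an orthogonal factor on either side: one is removed column by column, the other row by row.
    same-total : ∑ᴿ (degᴿ h) ≈ ∑ᴿ (degᴿ a)
    same-total = begin
      ∑ᴿ (λ i → ∑ᴿ λ j → ⟦ h i j ⟧)
        ≈⟨ ∑∑ᴿ-cong (λ i j → ⟦⟧-idem (h i j)) ⟨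
      ∑ᴿ (λ i → ∑ᴿ λ j → ⟦ h i j ⟧ *ᴿ ⟦ h i j ⟧)
        ≈⟨ ∑ᴿ-swap (λ i j → ⟦ h i j ⟧ *ᴿ ⟦ h i j ⟧) ⟩
      ∑ᴿ (λ j → ⟨ (λ i → ⟦ h i j ⟧) , (λ i → ⟦ h i j ⟧) ⟩)
        ≈⟨ ∑ᴿ-cong (λ j → ⟨⟩-cong (column j) (column j)) ⟩
      ∑ᴿ (λ j → ⟨ D ᵀ · Ad j , D ᵀ · Ad j ⟩)
        ≈⟨ ∑ᴿ-cong (λ j → isometry DDᵀ (Ad j) (Ad j)) ⟩
      ∑ᴿ (λ j → ⟨ Ad j , Ad j ⟩)
        ≈⟨ ∑ᴿ-swap (λ j i → Ad j i *ᴿ Ad j i) ⟩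
      ∑ᴿ (λ i → ∑ᴿ λ j → Ad j i *ᴿ Ad j i)
        ≈⟨ ∑ᴿ-cong (λ i → ⟨⟩-cong (row i) (row i)) ⟩
      ∑ᴿ (λ i → ⟨ D ᵀ · (λ w → ⟦ a i w ⟧) , D ᵀ · (λ w → ⟦ a i w ⟧) ⟩)
        ≈⟨ ∑ᴿ-cong (λ i → isometry DDᵀ (λ w → ⟦ a i w ⟧) (λ w → ⟦ a i w ⟧)) ⟩
      ∑ᴿ (λ i → ∑ᴿ λ w → ⟦ a i w ⟧ *ᴿ ⟦ a i w ⟧)
        ≈⟨ ∑∑ᴿ-cong (λ i w → ⟦⟧-idem (a i w)) ⟩
      ∑ᴿ (λ i → ∑ᴿ λ w → ⟦ a i w ⟧) ∎
      where
      Ad : Fin n → Vector n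
      Ad j = adjᴿ a · λ b → D b j
      column : ∀ j → (λ i → ⟦ h i j ⟧) ≋ D ᵀ · Ad j
      column j i = R.trans (h≈ i j) (conj-column D (adjᴿ a) i j)
      row : ∀ i → (λ j → Ad j i) ≋ D ᵀ · (λ w → ⟦ a i w ⟧)
      row i j = ∑ᴿ-cong λ w → R.*-comm ⟦ a i w ⟧ (D w j)

    -- D1 lies in the kernel of the Laplacian of a: its quadratic form there is Σ deg a − Σ deg h = 0.
    same-degrees : Symmetric a → (∀ u v → D u v *ᴿ degᴿ a v ≈ degᴿ a u *ᴿ D u v) →
                   ∀ u → countFin n (h u) ≡ countFin n (a u)
    same-degrees a-sym commutes u = natℝ-injective _ _ (begin
      natℝ ℝ (countFin n (h u))     ≈⟨ ∑ᴿ-count (h u) ⟨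
      degᴿ h u                      ≈⟨ degᴿ≋ h u ⟨
      (adjᴿ h · 𝟙) u                ≈⟨ ·-injective DᵀD kernel u ⟩
      degᴿ a u                      ≈⟨ ∑ᴿ-count (a u) ⟩
      natℝ ℝ (countFin n (a u))     ∎)
      where
      𝟙 : Vector n
      𝟙 _ = 1#
      degᴿ≋ : ∀ r → adjᴿ r · 𝟙 ≋ degᴿ r
      degᴿ≋ r u = ∑ᴿ-cong λ v → R.*-identityʳ ⟦ r u v ⟧
      D-deg : D · degᴿ a ≋ λ u → degᴿ a u *ᴿ (D · 𝟙) u
      D-deg u = R.trans (∑ᴿ-cong λ v → R.trans (commutes u v) (R.*-congˡ (R.sym (R.*-identityʳ (D u v)))))
                  (R.sym (∑ᴿ-*ˡ (degᴿ a u) (λ v → D u v *ᴿ 1#)))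
      form : ⟨ D · 𝟙 , adjᴿ a · D · 𝟙 ⟩ ≈ ∑ᴿ (λ u → degᴿ a u *ᴿ ((D · 𝟙) u *ᴿ (D · 𝟙) u))
      form = begin
        ⟨ D · 𝟙 , adjᴿ a · D · 𝟙 ⟩      ≈⟨ ⟨⟩-cong (λ _ → R.refl) (intertwines 𝟙) ⟨
        ⟨ D · 𝟙 , D · adjᴿ h · 𝟙 ⟩      ≈⟨ isometry DᵀD 𝟙 (adjᴿ h · 𝟙) ⟩
        ⟨ 𝟙 , adjᴿ h · 𝟙 ⟩              ≈⟨ ∑ᴿ-cong (λ u → R.trans (R.*-identityˡ _) (degᴿ≋ h u)) ⟩
        ∑ᴿ (degᴿ h)                     ≈⟨ same-total ⟩
        ∑ᴿ (degᴿ a)                     ≈⟨ ∑ᴿ-cong (λ u → R.*-identityˡ (degᴿ a u)) ⟨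
        ⟨ 𝟙 , degᴿ a ⟩                  ≈⟨ isometry DᵀD 𝟙 (degᴿ a) ⟨
        ⟨ D · 𝟙 , D · degᴿ a ⟩          ≈⟨ ∑ᴿ-cong (λ u → R.trans (R.*-congˡ (D-deg u)) (×-rotate ((D · 𝟙) u) (degᴿ a u) ((D · 𝟙) u))) ⟩
        ∑ᴿ (λ u → degᴿ a u *ᴿ ((D · 𝟙) u *ᴿ (D · 𝟙) u)) ∎
      -- As D1 is constant along edges of `a`, both sides are the degree of `a` times D1. Cancelling
      -- `D` then compares the degrees themselves.
      kernel : D · adjᴿ h · 𝟙 ≋ D · degᴿ a
      kernel u = begin
        (D · adjᴿ h · 𝟙) u        ≈⟨ intertwines 𝟙 u ⟩
        (adjᴿ a · D · 𝟙) u        ≈⟨ adj-locally-constant (D · 𝟙) (laplacian-zero a-sym (D · 𝟙) form) u ⟩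
        degᴿ a u *ᴿ (D · 𝟙) u     ≈⟨ D-deg u ⟨
        (D · degᴿ a) u            ∎

  -- If both graphs are d-regular and a is connected, then d is a simple eigenvalue of a, hence of h.
  regular-connected : ∀ {n} {D : Matrix ℝ n n} → Isometric D → ∀ {a h : Rel n} → Intertwines D h a → Symmetric a →
    ∀ d → (∀ u → countFin n (a u) ≡ d) → (∀ u → countFin n (h u) ≡ d) → ∀ r → (∀ u → Walk a r u) →
    (C : Fin n → Bool) → C r ≡ true → (∀ u v → h u v ≡ true → C u ≡ C v) → ∀ u → C u ≡ true
  regular-connected {n} {D} DᵀD {a} {h} tw a-sym d a-reg h-reg r reach C Cr C-closed u with C u in Cu
  ... | true  = refl
  ... | false = ⊥-elim (R.0≉1 (R.sym (·-injective DᵀD {λ _ → 1#} {λ _ → 0#} (λ v → R.trans (R.trans (R.sym (flat (λ _ → 1#) (λ _ _ _ → R.refl) v)) q≈0) (R.sym (∑ᴿ-zero λ w → R.zeroʳ (D v w)))) u)))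
    where
    deg≈ : ∀ (r : Rel n) → (∀ u → countFin n (r u) ≡ d) → ∀ u → degᴿ r u ≈ natℝ ℝ d
    deg≈ r r-reg u = R.trans (∑ᴿ-count (r u)) (R.reflexive (cong (natℝ ℝ) (r-reg u)))
    eigen : ∀ z → (∀ u v → h u v ≡ true → z u ≈ z v) → adjᴿ a · D · z ≋ λ u → natℝ ℝ d *ᴿ (D · z) u
    eigen z const u = begin
      (adjᴿ a · D · z) u                    ≈⟨ tw z u ⟨
      (D · adjᴿ h · z) u                    ≈⟨ ·-congˡ D (λ v → R.trans (adj-locally-constant z const v) (R.*-congʳ (deg≈ h h-reg v))) u ⟩
      (D · (λ v → natℝ ℝ d *ᴿ z v)) u       ≈⟨ ·-* D (natℝ ℝ d) z u ⟩
      natℝ ℝ d *ᴿ (D · z) u                 ∎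
    flat : ∀ z → (∀ u v → h u v ≡ true → z u ≈ z v) → ∀ u → (D · z) r ≈ (D · z) u
    flat z const u = constant-along (D · z) (laplacian-zero a-sym (D · z) (∑ᴿ-cong λ u → begin
      (D · z) u *ᴿ (adjᴿ a · D · z) u               ≈⟨ R.*-congˡ (eigen z const u) ⟩
      (D · z) u *ᴿ (natℝ ℝ d *ᴿ (D · z) u)          ≈⟨ ×-rotate _ _ _ ⟩
      natℝ ℝ d *ᴿ ((D · z) u *ᴿ (D · z) u)          ≈⟨ R.*-congʳ (deg≈ a a-reg u) ⟨
      degᴿ a u *ᴿ ((D · z) u *ᴿ (D · z) u)          ∎)) (reach u)
    χ : Vector n
    χ u = ⟦ C u ⟧
    p q : Carrier
    p = (D · χ) r
    q = (D · λ _ → 1#) r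
    -- `D` sends the indicator of `C` and the vector 1 to constant vectors with values p and q, so
    -- qχ = p1. Comparing a vertex in `C` with one outside gives q = 0, that is, D1 = 0.
    proportional : ∀ v → q *ᴿ χ v ≈ p *ᴿ 1#
    proportional = ·-injective DᵀD λ v → begin
      (D · λ w → q *ᴿ χ w) v         ≈⟨ ·-* D q χ v ⟩
      q *ᴿ (D · χ) v                 ≈⟨ R.*-congˡ (flat χ (λ x y e → R.reflexive (cong ⟦_⟧ (C-closed x y e))) v) ⟨
      q *ᴿ p                         ≈⟨ R.*-comm q p ⟩
      p *ᴿ q                         ≈⟨ R.*-congˡ (flat (λ _ → 1#) (λ _ _ _ → R.refl) v) ⟩
      p *ᴿ (D · λ _ → 1#) v          ≈⟨ ·-* D p (λ _ → 1#) v ⟨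
      (D · λ _ → p *ᴿ 1#) v          ∎
    q≈0 : q ≈ 0#
    q≈0 = begin
      q                    ≈⟨ R.*-identityʳ q ⟨
      q *ᴿ 1#              ≡⟨ cong (λ b → q *ᴿ ⟦ b ⟧) Cr ⟨
      q *ᴿ χ r             ≈⟨ proportional r ⟩
      p *ᴿ 1#              ≈⟨ proportional u ⟨
      q *ᴿ χ u             ≡⟨ cong (λ b → q *ᴿ ⟦ b ⟧) Cu ⟩
      q *ᴿ 0#              ≈⟨ R.zeroʳ q ⟩
      0#                   ∎

-- Chebyshev operators and distances along cycles

module Distances (ℝ : RealField) where
  open OverField ℝ
  open Spectra ℝ

  ∑ᴿ-pair : ∀ {n} (f : Vector n) {x y} → x ≢ y → (∀ j → j ≢ x → j ≢ y → f j ≈ 0#) → ∑ᴿ f ≈ f x +ᴿ f y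
  ∑ᴿ-pair {n} f {x} {y} x≢y f≈0 = begin
    ∑ᴿ f                               ≈⟨ ∑ᴿ-cong split ⟩
    ∑ᴿ (λ j → f≢x j +ᴿ f=x j)          ≈⟨ ∑ᴿ-+ f≢x f=x ⟩
    ∑ᴿ f≢x +ᴿ ∑ᴿ f=x                   ≈⟨ R.+-cong (∑ᴿ-single f≢x y off-y) (∑ᴿ-single f=x x off-x) ⟩
    f≢x y +ᴿ f=x x                     ≈⟨ R.+-cong (R.reflexive f≢x-y) (R.reflexive f=x-x) ⟩
    f y +ᴿ f x                         ≈⟨ R.+-comm (f y) (f x) ⟩
    f x +ᴿ f y                         ∎
    where
    f=x f≢x : Vector n
    f=x j = if does (j ≟ x) then f j else 0#
    f≢x j = if does (j ≟ x) then 0# else f j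
    split : ∀ j → f j ≈ f≢x j +ᴿ f=x j
    split j with does (j ≟ x)
    ... | true  = R.sym (R.+-identityˡ _)
    ... | false = R.sym (R.+-identityʳ _)
    off-x : ∀ j → j ≢ x → f=x j ≈ 0#
    off-x j j≢x = R.reflexive (cong (λ b → if b then f j else 0#) (dec-false (j ≟ x) j≢x))
    off-y : ∀ j → j ≢ y → f≢x j ≈ 0#
    off-y j j≢y with j ≟ x
    ... | yes _  = R.refl
    ... | no j≢x = f≈0 j j≢x j≢y
    f≢x-y : f≢x y ≡ f y
    f≢x-y = cong (λ b → if b then 0# else f y) (dec-false (y ≟ x) (x≢y ∘ sym))
    f=x-x : f=x x ≡ f x
    f=x-x = cong (λ b → if b then f x else 0#) (dec-true (x ≟ x) refl)

  nonzero-* : ∀ {x y} → ¬ x ≈ 0# → ¬ y ≈ 0# → ¬ x *ᴿ y ≈ 0#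
  nonzero-* {x} {y} x≉0 y≉0 xy≈0 with x⁻¹ , xx⁻¹≈1 ← R.inverse x x≉0 = y≉0 (begin
    y                      ≈⟨ R.*-identityˡ y ⟨
    1# *ᴿ y                ≈⟨ R.*-congʳ (R.trans (R.*-comm x⁻¹ x) xx⁻¹≈1) ⟨
    (x⁻¹ *ᴿ x) *ᴿ y        ≈⟨ R.*-assoc x⁻¹ x y ⟩
    x⁻¹ *ᴿ (x *ᴿ y)        ≈⟨ R.*-congˡ xy≈0 ⟩
    x⁻¹ *ᴿ 0#              ≈⟨ R.zeroʳ x⁻¹ ⟩
    0#                     ∎)

  -- 2 T_t(A/2) for the Chebyshev polynomials T_t; on a cycle with rotation σ it acts as σᵗ + σ⁻ᵗ.
  chebyshev : ∀ {n} → Rel n → ℕ → Vector n → Vector n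
  chebyshev a zero          z = λ u → z u +ᴿ z u
  chebyshev a (suc zero)    z = adjᴿ a · z
  chebyshev a (suc (suc t)) z = λ u → (adjᴿ a · chebyshev a (suc t) z) u +ᴿ -ᴿ 1# *ᴿ chebyshev a t z u

  chebyshev-intertwines : ∀ {n} {D : Matrix ℝ n n} {h a : Rel n} → Intertwines D h a →
    ∀ t z → D · chebyshev h t z ≋ chebyshev a t (D · z)
  chebyshev-intertwines {D = D} tw zero          z = ·-+ D z z
  chebyshev-intertwines         tw (suc zero)    z = tw z
  chebyshev-intertwines {D = D} {h} {a} tw (suc (suc t)) z u = begin
    (D · chebyshev h (suc (suc t)) z) u
      ≈⟨ ·-+ D (adjᴿ h · chebyshev h (suc t) z) (λ v → -ᴿ 1# *ᴿ chebyshev h t z v) u ⟩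
    (D · adjᴿ h · chebyshev h (suc t) z) u +ᴿ (D · λ v → -ᴿ 1# *ᴿ chebyshev h t z v) u
      ≈⟨ R.+-cong (tw (chebyshev h (suc t) z) u) (·-* D (-ᴿ 1#) (chebyshev h t z) u) ⟩
    (adjᴿ a · D · chebyshev h (suc t) z) u +ᴿ -ᴿ 1# *ᴿ (D · chebyshev h t z) u
      ≈⟨ R.+-cong (·-congˡ (adjᴿ a) (chebyshev-intertwines tw (suc t) z) u) (R.*-congˡ (chebyshev-intertwines tw t z u)) ⟩
    chebyshev a (suc (suc t)) (D · z) u ∎

  -- `turn` makes the two neighbours distinct, so both contribute their own term to the row sum.
  adj-line : ∀ {n} {a : Rel n} → Symmetric a → Irreflexive a → (γ : Line a) → ∀ z i →
    (adjᴿ a · z) (at γ i) ≈ z (at γ (ℤ.pred i)) +ᴿ z (at γ (ℤ.suc i))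
  adj-line {a = a} a-sym a-irrefl γ z i = R.trans (∑ᴿ-pair _ (turn γ i) off)
    (R.+-cong (one (prev a-sym a-irrefl γ i)) (one (next γ i)))
    where
    one : ∀ {v} → a (at γ i) v ≡ true → ⟦ a (at γ i) v ⟧ *ᴿ z v ≈ z v
    one {v} e = R.trans (R.reflexive (cong (λ b → ⟦ b ⟧ *ᴿ z v) e)) (R.*-identityˡ (z v))
    off : ∀ v → v ≢ at γ (ℤ.pred i) → v ≢ at γ (ℤ.suc i) → ⟦ a (at γ i) v ⟧ *ᴿ z v ≈ 0#
    off v v≢pred v≢suc with a (at γ i) v in e
    ... | false = R.zeroˡ (z v)
    ... | true  = ⊥-elim ([ v≢pred , v≢suc ]′ (nbr γ i v e))

  private
    pred-+ : ∀ i s → (-1ℤ ℤ.+ i) ℤ.+ (1ℤ ℤ.+ s) ≡ i ℤ.+ s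
    pred-+ = solve-ℤ
    pred-- : ∀ i s → (-1ℤ ℤ.+ i) ℤ.+ ℤ.- (1ℤ ℤ.+ s) ≡ i ℤ.+ ℤ.- (1ℤ ℤ.+ (1ℤ ℤ.+ s))
    pred-- = solve-ℤ
    suc-+ : ∀ i s → (1ℤ ℤ.+ i) ℤ.+ (1ℤ ℤ.+ s) ≡ i ℤ.+ (1ℤ ℤ.+ (1ℤ ℤ.+ s))
    suc-+ = solve-ℤ
    suc-- : ∀ i s → (1ℤ ℤ.+ i) ℤ.+ ℤ.- (1ℤ ℤ.+ s) ≡ i ℤ.+ ℤ.- s
    suc-- = solve-ℤ

    cancel-inner : ∀ p q r s → ((p +ᴿ q) +ᴿ (r +ᴿ s)) +ᴿ -ᴿ 1# *ᴿ (p +ᴿ s) ≈ r +ᴿ q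
    cancel-inner p q r s = begin
      ((p +ᴿ q) +ᴿ (r +ᴿ s)) +ᴿ -ᴿ 1# *ᴿ (p +ᴿ s)
        ≈⟨ R.+-cong (regroup p q r s) (R.trans (R.sym (-‿distribˡ-* 1# (p +ᴿ s))) (R.-‿cong (R.*-identityˡ (p +ᴿ s)))) ⟩
      ((r +ᴿ q) +ᴿ (p +ᴿ s)) +ᴿ -ᴿ (p +ᴿ s)
        ≈⟨ R.+-assoc _ _ _ ⟩
      (r +ᴿ q) +ᴿ ((p +ᴿ s) +ᴿ -ᴿ (p +ᴿ s))
        ≈⟨ R.+-congˡ (R.-‿inverseʳ (p +ᴿ s)) ⟩
      (r +ᴿ q) +ᴿ 0#
        ≈⟨ R.+-identityʳ _ ⟩
      r +ᴿ q ∎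
      where
      regroup : ∀ p q r s → (p +ᴿ q) +ᴿ (r +ᴿ s) ≈ (r +ᴿ q) +ᴿ (p +ᴿ s)
      regroup = solve 4 (λ p q r s → (p :+ q) :+ (r :+ s) := (r :+ q) :+ (p :+ s)) R.refl

  -- The recurrence is (σ + σ⁻¹)(σᵗ⁺¹ + σ⁻ᵗ⁻¹) = (σᵗ⁺² + σ⁻ᵗ⁻²) + (σᵗ + σ⁻ᵗ), read off along the
  -- line.
  chebyshev-line : ∀ {n} {a : Rel n} → Symmetric a → Irreflexive a → (γ : Line a) → ∀ t z i →
    chebyshev a t z (at γ i) ≈ z (at γ (i ℤ.+ + t)) +ᴿ z (at γ (i ℤ.+ ℤ.- (+ t)))
  chebyshev-line a-sym a-irrefl γ zero z i rewrite ℤ.+-identityʳ i = R.refl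
  chebyshev-line a-sym a-irrefl γ (suc zero) z i
    rewrite ℤ.+-comm i 1ℤ | ℤ.+-comm i -1ℤ = R.trans (adj-line a-sym a-irrefl γ z i) (R.+-comm _ _)
  chebyshev-line {a = a} a-sym a-irrefl γ (suc (suc t)) z i = begin
    (adjᴿ a · chebyshev a (suc t) z) (at γ i) +ᴿ -ᴿ 1# *ᴿ chebyshev a t z (at γ i)
      ≈⟨ R.+-cong (R.trans (adj-line a-sym a-irrefl γ (chebyshev a (suc t) z) i)
                    (R.+-cong (chebyshev-line a-sym a-irrefl γ (suc t) z (ℤ.pred i)) (chebyshev-line a-sym a-irrefl γ (suc t) z (ℤ.suc i))))
                  (R.*-congˡ (chebyshev-line a-sym a-irrefl γ t z i)) ⟩
    ((ζ (ℤ.pred i ℤ.+ + suc t) +ᴿ ζ (ℤ.pred i ℤ.+ ℤ.- (+ suc t))) +ᴿ (ζ (ℤ.suc i ℤ.+ + suc t) +ᴿ ζ (ℤ.suc i ℤ.+ ℤ.- (+ suc t))))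
      +ᴿ -ᴿ 1# *ᴿ (ζ (i ℤ.+ + t) +ᴿ ζ (i ℤ.+ ℤ.- (+ t)))
      ≈⟨ R.+-congʳ (R.+-cong (R.+-cong (index (pred-+ i (+ t))) (index (pred-- i (+ t)))) (R.+-cong (index (suc-+ i (+ t))) (index (suc-- i (+ t))))) ⟩
    ((ζ (i ℤ.+ + t) +ᴿ ζ (i ℤ.+ ℤ.- (+ suc (suc t)))) +ᴿ (ζ (i ℤ.+ + suc (suc t)) +ᴿ ζ (i ℤ.+ ℤ.- (+ t))))
      +ᴿ -ᴿ 1# *ᴿ (ζ (i ℤ.+ + t) +ᴿ ζ (i ℤ.+ ℤ.- (+ t)))
      ≈⟨ cancel-inner _ _ _ _ ⟩
    ζ (i ℤ.+ + suc (suc t)) +ᴿ ζ (i ℤ.+ ℤ.- (+ suc (suc t))) ∎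
    where
    ζ : ℤ → Carrier
    ζ j = z (at γ j)
    index : ∀ {j k} → j ≡ k → ζ j ≈ ζ k
    index = R.reflexive ∘ cong ζ

  basis : ∀ {n} → Fin n → Vector n
  basis w u = ⟦ does (u ≟ w) ⟧

  -- An entry of σᵗ + σ⁻ᵗ, hence counted with multiplicity: it is 2 if t and -t both lead to `w`.
  meetings : ∀ {n} {a : Rel n} → Line a → ℕ → Fin n → ℕ
  meetings γ t w = # does (at γ (+ t) ≟ w) + # does (at γ (ℤ.- (+ t)) ≟ w)

  meetings≢0 : ∀ {n} {a : Rel n} (γ : Line a) t {w} → Meets γ (+ t) w → meetings γ t w ≢ 0
  meetings≢0 γ t {w} (inj₁ eq) m≡0 rewrite dec-true (at γ (+ t) ≟ w) eq with () ← m≡0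
  meetings≢0 γ t {w} (inj₂ eq) m≡0 rewrite dec-true (at γ (ℤ.- (+ t)) ≟ w) eq | +-comm (# does (at γ (+ t) ≟ w)) 1 with () ← m≡0

  meets : ∀ {n} {a : Rel n} (γ : Line a) t {w} → meetings γ t w ≢ 0 → Meets γ (+ t) w
  meets γ t {w} m≢0 with at γ (+ t) ≟ w | at γ (ℤ.- (+ t)) ≟ w
  ... | yes eq | _      = inj₁ eq
  ... | no _   | yes eq = inj₂ eq
  ... | no _   | no _   = contradiction refl m≢0

  ⟦⟧-+ : ∀ b c → ⟦ b ⟧ +ᴿ ⟦ c ⟧ ≈ natℝ ℝ (# b + # c)
  ⟦⟧-+ true  true  = R.+-congˡ (R.sym (R.+-identityʳ 1#))
  ⟦⟧-+ true  false = R.refl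
  ⟦⟧-+ false true  = R.trans (R.+-identityˡ 1#) (R.sym (R.+-identityʳ 1#))
  ⟦⟧-+ false false = R.+-identityˡ 0#

  chebyshev-basis : ∀ {n} {a : Rel n} → Symmetric a → Irreflexive a → (γ : Line a) → ∀ t w →
    chebyshev a t (basis w) (at γ 0ℤ) ≈ natℝ ℝ (meetings γ t w)
  chebyshev-basis a-sym a-irrefl γ t w = R.trans (chebyshev-line a-sym a-irrefl γ t (basis w) 0ℤ)
    (R.trans (R.reflexive (cong₂ (λ i j → basis w (at γ i) +ᴿ basis w (at γ j)) (ℤ.+-identityˡ _) (ℤ.+-identityˡ _)))
             (⟦⟧-+ (does (at γ (+ t) ≟ w)) (does (at γ (ℤ.- (+ t)) ≟ w))))

  symmetric-in-t : ∀ {n} {a h : Rel n} (γ : Line a) (η : Line h) {w} →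
    (∀ t → Meets γ (+ t) w → Meets η (+ t) w) → ∀ t → Meets γ t w → Meets η t w
  symmetric-in-t γ η f (+ t)    m        = f t m
  symmetric-in-t γ η f -[1+ t ] (inj₁ m) = [ inj₂ , inj₁ ]′ (f (suc t) (inj₂ m))
  symmetric-in-t γ η f -[1+ t ] (inj₂ m) = [ inj₂ , inj₁ ]′ (f (suc t) (inj₁ m))

  record Splits {n} (D : Matrix ℝ n n) (b : Fin n) : Set where
    field
      row      : ∀ v → v ≢ b → D b v ≈ 0#
      column   : ∀ v → v ≢ b → D v b ≈ 0#
      diagonal : ¬ D b b ≈ 0#

  -- The entry at (b, w) of the intertwining relation for the Chebyshev operators reads D b b · m =
  -- D w w · m′, where m and m′ are the numbers of meetings on `η` and `γ`. The diagonal factor at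
  -- `w` is nonzero, so m = 0 forces m′ = 0.
  splits⇒distance-preserving : ∀ {n} {D : Matrix ℝ n n} {a h : Rel n} → Intertwines D h a →
    Symmetric a → Irreflexive a → Symmetric h → Irreflexive h →
    ∀ {N} → (∀ b → N b ≡ true → Splits D b) → DistancePreserving N a h
  splits⇒distance-preserving {D = D} {a} {h} tw a-sym a-irrefl h-sym h-irrefl {N} splits γ η eq₀ b∈N t w w∈N =
    symmetric-in-t γ η preserve t
    where
    open Splits
    b = at γ 0ℤ
    Sb = splits b b∈N
    Sw = splits w w∈N
    D-row : ∀ z → (D · z) b ≈ D b b *ᴿ z b
    D-row z = ∑ᴿ-single _ b λ v v≢b → R.trans (R.*-congʳ (row Sb v v≢b)) (R.zeroˡ (z v))
    D-basis : ∀ u → (D · basis w) u ≈ D w w *ᴿ basis w u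
    D-basis u = R.trans (∑ᴿ-single _ w off) (on u)
      where
      off : ∀ v → v ≢ w → D u v *ᴿ basis w v ≈ 0#
      off v v≢w = R.trans (R.*-congˡ (R.reflexive (cong ⟦_⟧ (dec-false (v ≟ w) v≢w)))) (R.zeroʳ (D u v))
      on : ∀ u → D u w *ᴿ basis w w ≈ D w w *ᴿ basis w u
      on u with u ≟ w
      ... | yes refl = R.*-congˡ (R.reflexive (cong ⟦_⟧ (dec-true (w ≟ w) refl)))
      ... | no  u≢w  = R.trans (R.trans (R.*-congʳ (column Sw u u≢w)) (R.zeroˡ _)) (R.sym (R.zeroʳ (D w w)))
    weighted : ∀ t → D b b *ᴿ natℝ ℝ (meetings η t w) ≈ D w w *ᴿ natℝ ℝ (meetings γ t w)
    weighted t = begin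
      D b b *ᴿ natℝ ℝ (meetings η t w)
        ≈⟨ R.*-congˡ (chebyshev-basis h-sym h-irrefl η t w) ⟨
      D b b *ᴿ chebyshev h t (basis w) (at η 0ℤ)
        ≡⟨ cong (λ u → D b b *ᴿ chebyshev h t (basis w) u) eq₀ ⟨
      D b b *ᴿ chebyshev h t (basis w) b
        ≈⟨ D-row (chebyshev h t (basis w)) ⟨
      (D · chebyshev h t (basis w)) b
        ≈⟨ chebyshev-intertwines tw t (basis w) b ⟩
      chebyshev a t (D · basis w) (at γ 0ℤ)
        ≈⟨ chebyshev-line a-sym a-irrefl γ t (D · basis w) 0ℤ ⟩
      (D · basis w) (at γ (0ℤ ℤ.+ + t)) +ᴿ (D · basis w) (at γ (0ℤ ℤ.+ ℤ.- (+ t)))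
        ≈⟨ R.+-cong (D-basis _) (D-basis _) ⟩
      D w w *ᴿ basis w (at γ (0ℤ ℤ.+ + t)) +ᴿ D w w *ᴿ basis w (at γ (0ℤ ℤ.+ ℤ.- (+ t)))
        ≈⟨ R.distribˡ (D w w) _ _ ⟨
      D w w *ᴿ (basis w (at γ (0ℤ ℤ.+ + t)) +ᴿ basis w (at γ (0ℤ ℤ.+ ℤ.- (+ t))))
        ≈⟨ R.*-congˡ (chebyshev-line a-sym a-irrefl γ t (basis w) 0ℤ) ⟨
      D w w *ᴿ chebyshev a t (basis w) (at γ 0ℤ)
        ≈⟨ R.*-congˡ (chebyshev-basis a-sym a-irrefl γ t w) ⟩
      D w w *ᴿ natℝ ℝ (meetings γ t w) ∎
    preserve : ∀ t → Meets γ (+ t) w → Meets η (+ t) w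
    preserve t m = meets η t λ η≡0 → nonzero-* (diagonal Sw)
      (λ eq → meetings≢0 γ t m (natℝ-injective _ 0 eq))
      (R.trans (R.sym (weighted t)) (R.trans (R.*-congˡ (R.reflexive (cong (natℝ ℝ) η≡0))) (R.zeroʳ (D b b))))

  -- If γ covers all vertices and has period t, then σᵗ + σ⁻ᵗ = 2 on all of a, hence on h.
  period-preserved : ∀ {n} {D : Matrix ℝ n n} → Isometric D → ∀ {a h : Rel n} → Intertwines D h a →
    Symmetric a → Irreflexive a → Symmetric h → Irreflexive h → (γ : Line a) (η : Line h) →
    (∀ u → ∃ λ i → at γ i ≡ u) → at γ 0ℤ ≡ at η 0ℤ → ∀ t → Meets γ t (at γ 0ℤ) → Meets η t (at γ 0ℤ)
  period-preserved {D = D} DᵀD {a} {h} tw a-sym a-irrefl h-sym h-irrefl γ η cover eq₀ t = symmetric-in-t γ η preserve t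
    where
    b = at γ 0ℤ
    periodic : ∀ t → Meets γ (+ t) b → ∀ i → at γ (i ℤ.+ + t) ≡ at γ i × at γ (i ℤ.+ ℤ.- (+ t)) ≡ at γ i
    periodic t m i = [ (λ eq → fwd (+ t) eq i , bwd (+ t) eq i)
                     , (λ eq → trans (cong (λ s → at γ (i ℤ.+ s)) (sym (ℤ.neg-involutive (+ t)))) (bwd (ℤ.- (+ t)) eq i) , fwd (ℤ.- (+ t)) eq i) ]′ m
      where
      fwd : ∀ s → at γ s ≡ b → ∀ i → at γ (i ℤ.+ s) ≡ at γ i
      fwd s eq i = trans (cong (at γ) (ℤ.+-comm i s))
        (trans (period a-sym a-irrefl γ eq i) (cong (at γ) (ℤ.+-identityˡ i)))
      bwd : ∀ s → at γ s ≡ b → ∀ i → at γ (i ℤ.+ ℤ.- s) ≡ at γ i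
      bwd s eq i = trans (sym (fwd s eq (i ℤ.+ ℤ.- s))) (cong (at γ) (lemma i s))
        where
        lemma : ∀ i s → (i ℤ.+ ℤ.- s) ℤ.+ s ≡ i
        lemma = solve-ℤ
    doubling : ∀ t → Meets γ (+ t) b → ∀ z → chebyshev a t z ≋ λ u → z u +ᴿ z u
    doubling t m z u with i , refl ← cover u = R.trans (chebyshev-line a-sym a-irrefl γ t z i)
      (R.reflexive (cong₂ (λ x y → z x +ᴿ z y) (proj₁ (periodic t m i)) (proj₂ (periodic t m i))))
    preserve : ∀ t → Meets γ (+ t) b → Meets η (+ t) b
    preserve t m = meets η t λ η≡0 → natℝ-suc≉0 1 (begin
      natℝ ℝ 2
        ≈⟨ ⟦⟧-+ true true ⟨
      1# +ᴿ 1#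
        ≡⟨ cong (λ c → ⟦ c ⟧ +ᴿ ⟦ c ⟧) (dec-true (at η 0ℤ ≟ b) (sym eq₀)) ⟨
      basis b (at η 0ℤ) +ᴿ basis b (at η 0ℤ)
        ≈⟨ ·-injective DᵀD same (at η 0ℤ) ⟨
      chebyshev h t (basis b) (at η 0ℤ)
        ≈⟨ chebyshev-basis h-sym h-irrefl η t b ⟩
      natℝ ℝ (meetings η t b)
        ≡⟨ cong (natℝ ℝ) η≡0 ⟩
      0# ∎)
      where
      same : D · chebyshev h t (basis b) ≋ D · λ u → basis b u +ᴿ basis b u
      same u = begin
        (D · chebyshev h t (basis b)) u            ≈⟨ chebyshev-intertwines tw t (basis b) u ⟩
        chebyshev a t (D · basis b) u              ≈⟨ doubling t m (D · basis b) u ⟩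
        (D · basis b) u +ᴿ (D · basis b) u         ≈⟨ ·-+ D (basis b) (basis b) u ⟨
        (D · λ u → basis b u +ᴿ basis b u) u       ∎

-- Counting the edges that meet the switching set

_touching_ : ∀ {n} → Rel n → (Fin n → Bool) → Rel n
(g touching X) u v = g u v ∧ (X u ∨ X v)

touching-sym : ∀ {n} {g : Rel n} {X} → Symmetric g → Symmetric (g touching X)
touching-sym {X = X} g-sym u v = cong₂ _∧_ (g-sym u v) (∨-comm (X u) (X v))

touching-irrefl : ∀ {n} {g : Rel n} {X} → Irreflexive g → Irreflexive (g touching X)
touching-irrefl {X = X} g-irrefl u = cong (_∧ (X u ∨ X u)) (g-irrefl u)

touching-true : ∀ {n} {g : Rel n} {X : Fin n → Bool} {u v} → X u ∨ X v ≡ true → (g touching X) u v ≡ g u v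
touching-true {g = g} {u = u} {v} eq = trans (cong (g u v ∧_) eq) (∧-identityʳ (g u v))

touching-false : ∀ {n} {g : Rel n} {X : Fin n → Bool} {u v} → X u ∨ X v ≡ false → (g touching X) u v ≡ false
touching-false {g = g} {u = u} {v} eq = trans (cong (g u v ∧_) eq) (∧-zeroʳ (g u v))

positive? : ℕ → Bool
positive? d = 0 <ᵇ d

support : ∀ {n} → Rel n → Fin n → Bool
support {n} a u = positive? (countFin n (a u))

support-edge : ∀ {n} (a : Rel n) u v → a u v ≡ true → support a u ≡ true
support-edge {n} a u v e with countFin n (a u) | count-member (a u) e
... | suc d | _ = refl

-- An edge of `a` that starts outside X ends in X. A set containing X therefore retains the full
-- `a`-degree of each of its outside vertices. The equation in the second alternative encodes degree
-- 0 or 2.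
sparse⇒2-regular : ∀ {n} (G : Graph n) (X : Fin n → Bool) → let a = adj G touching X in
  (∀ u → support a u ≡ true → 2 ≤ countFin n (a u)) → X ⊆ support a →
  (Σ (Subgraph G) λ S → SubgraphConnected S × (numVertices S ≤ 2 * countFin n X + 1) × (numVertices S < numEdges S))
  ⊎ (∀ u → countFin n (a u) ≡ 2 * # support a u)
sparse⇒2-regular {n} G X 2≤deg X⊆S with countFin n (support (adj G touching X)) ≤? 2 * countFin n X + 1
... | yes few = decide (2 * countFin n S <? degSum (a on S))
  where
  a : Rel n
  a = adj G touching X
  a-sym : Symmetric a
  a-sym = touching-sym {X = X} (adj-sym G)
  S : Fin n → Bool
  S = support a
  on-S : degSum (a on S) ≡ degSum a
  on-S = ∑-cong λ u → ∑-cong λ v → cong #_ (pointwise u v)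
    where
    pointwise : ∀ u v → (a on S) u v ≡ a u v
    pointwise u v with a u v in e
    ... | true  = ∧-true (∧-true (support-edge a u v e) (support-edge a v u (trans (a-sym v u) e))) refl
    ... | false = ∧-zeroʳ _
  degree-bound : ∀ u → 2 * # S u ≤ countFin n (a u)
  degree-bound u with S u in Su
  ... | true  = 2≤deg u Su
  ... | false = z≤n
  decide : Dec (2 * countFin n S < degSum (a on S)) → _
  decide (yes dense) with K , conn , size , excess ← dense⇒subgraph G a-sym (λ u v → ∧-conicalˡ (adj G u v) _) S dense
    = inj₁ (K , conn , ≤-trans size few , excess)
  -- The degrees add up to at most 2 |S|, while every vertex of `S` contributes at least 2.
  decide (no sparse) = inj₂ λ u → sym (∑-mono-eq degree-bound total u)
    where
    open ≤-Reasoning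
    total : ∑ (λ u → countFin n (a u)) ≤ ∑ (λ u → 2 * # S u)
    total = begin
      ∑ (λ u → countFin n (a u))      ≡⟨ ∑-cong (λ u → countFin-∑ n (a u)) ⟩
      degSum a                        ≡⟨ on-S ⟨
      degSum (a on S)                 ≤⟨ ≮⇒≥ sparse ⟩
      2 * countFin n S                ≡⟨ cong (2 *_) (countFin-∑ n S) ⟩
      2 * ∑ (λ u → # S u)             ≡⟨ ∑-*ˡ 2 (λ u → # S u) ⟩
      ∑ (λ u → 2 * # S u)             ∎
... | no many = many-outside (between (2 * countFin n X + 1) X⊆S
    (≤-trans (m≤m+n _ _) (m≤m+n (2 * countFin n X) 1)) (<⇒≤ (≰⇒> many)))
  where
  a : Rel n
  a = adj G touching X
  a-sym : Symmetric a
  a-sym = touching-sym {X = X} (adj-sym G)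
  S : Fin n → Bool
  S = support a
  many-outside : (∃ λ T → X ⊆ T × T ⊆ S × countFin n T ≡ 2 * countFin n X + 1) → _
  many-outside (T , X⊆T , T⊆S , |T|) = inj₁ (map₂ (λ { (conn , size , excess) → conn , ≤-trans size (≤-reflexive |T|) , excess })
    (dense⇒subgraph G a-sym (λ u v → ∧-conicalˡ (adj G u v) _) T dense))
    where
    Y : Fin n → Bool
    Y u = T u ∧ not (X u)
    y = countFin n Y
    |Y| : y ≡ suc (countFin n X)
    |Y| = +-cancelˡ-≡ (countFin n X) _ _ (trans (sym (∸ᵇ-count X⊆T)) (trans |T| (double (countFin n X))))
      where
      double : ∀ x → 2 * x + 1 ≡ x + suc x
      double x = trans (+-comm (2 * x) 1) (trans (cong suc (cong (_+_ x) (+-identityʳ x))) (sym (+-suc x x)))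
    -- No edge of `a` has both ends in `Y`, so at most one summand on the left is 1; the other end
    -- of such an edge is in X, hence in `T`.
    pointwise : ∀ u v → # (Y u ∧ a u v) + # (Y v ∧ a u v) ≤ # (a on T) u v
    pointwise u v with adj G u v | X u in Xu | X v in Xv | T u in Tu | T v in Tv
    ... | _ | true  | _     | false | _     = ⊥-elim (true≢false (X⊆T u Xu) Tu)
    ... | _ | _     | true  | _     | false = ⊥-elim (true≢false (X⊆T v Xv) Tv)
    ... | true | true  | true  | true  | true  = z≤n
    ... | true | true  | false | true  | true  = ≤-refl
    ... | true | true  | false | true  | false = z≤n
    ... | true | false | true  | true  | true  = ≤-refl
    ... | true | false | true  | false | true  = z≤n
    ... | true | false | false | true  | true  = z≤n
    ... | true | false | false | true  | false = z≤n
    ... | true | false | false | false | true  = z≤n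
    ... | true | false | false | false | false = z≤n
    ... | false | true  | true  | true  | true  = z≤n
    ... | false | true  | false | true  | true  = z≤n
    ... | false | true  | false | true  | false = z≤n
    ... | false | false | true  | true  | true  = z≤n
    ... | false | false | true  | false | true  = z≤n
    ... | false | false | false | true  | true  = z≤n
    ... | false | false | false | true  | false = z≤n
    ... | false | false | false | false | true  = z≤n
    ... | false | false | false | false | false = z≤n
    open ≤-Reasoning
    from-Y : 2 * y ≤ ∑ (λ u → ∑ λ v → # (Y u ∧ a u v))
    from-Y = begin
      2 * y                                  ≡⟨ cong (2 *_) (countFin-∑ n Y) ⟩
      2 * ∑ (λ u → # Y u)                    ≡⟨ ∑-*ˡ 2 (λ u → # Y u) ⟩
      ∑ (λ u → 2 * # Y u)                    ≤⟨ ∑-mono two ⟩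
      ∑ (λ u → ∑ λ v → # (Y u ∧ a u v))      ∎
      where
      two : ∀ u → 2 * # Y u ≤ ∑ (λ v → # (Y u ∧ a u v))
      two u with Y u in Yu
      ... | false = z≤n
      ... | true  = subst (2 ≤_) (countFin-∑ n (a u)) (2≤deg u (T⊆S u (∧-conicalˡ (T u) _ Yu)))
    dense : 2 * countFin n T < degSum (a on T)
    dense = begin-strict
      2 * countFin n T             ≡⟨ cong (2 *_) |T| ⟩
      -- With k = |X| this is 4k + 2 < 4k + 4: each of the k + 1 vertices of `Y` supplies two edges,
      -- counted in both directions.
      2 * (2 * countFin n X + 1)   <⟨ room (countFin n X) ⟩
      2 * suc (countFin n X) + 2 * suc (countFin n X)
                                   ≡⟨ cong₂ (λ p q → 2 * p + 2 * q) |Y| |Y| ⟨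
      2 * y + 2 * y                ≤⟨ +-mono-≤ from-Y (≤-trans from-Y (≤-reflexive mirrored)) ⟩
      ∑ (λ u → ∑ λ v → # (Y u ∧ a u v)) + ∑ (λ u → ∑ λ v → # (Y v ∧ a u v))
                                   ≡⟨ ∑∑-+ (λ u v → # (Y u ∧ a u v)) (λ u v → # (Y v ∧ a u v)) ⟨
      ∑ (λ u → ∑ λ v → # (Y u ∧ a u v) + # (Y v ∧ a u v))
                                   ≤⟨ ∑-mono (λ u → ∑-mono (pointwise u)) ⟩
      degSum (a on T)              ∎
      where
      room : ∀ x → 2 * (2 * x + 1) < 2 * suc x + 2 * suc x
      room x = subst (2 * (2 * x + 1) <_) (arith x) (m≤m+n (suc (2 * (2 * x + 1))) 1)
        where
        arith : ∀ x → suc (2 * (2 * x + 1)) + 1 ≡ 2 * suc x + 2 * suc x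
        arith = solve-∀
      mirrored : ∑ (λ u → ∑ λ v → # (Y u ∧ a u v)) ≡ ∑ (λ u → ∑ λ v → # (Y v ∧ a u v))
      mirrored = trans (∑-cong λ u → ∑-cong λ v → cong (λ e → # (Y u ∧ e)) (a-sym u v)) (∑-swap (λ u v → # (Y u ∧ a v u)))

-- Switching with a block matrix, and the case of cycles

∧-falseˡ : ∀ {a b} → a ≡ false → a ∧ b ≡ false
∧-falseˡ refl = refl

∧-falseʳ : ∀ {a b} → b ≡ false → a ∧ b ≡ false
∧-falseʳ {a} refl = ∧-zeroʳ a

module BlockSwitching (ℝ : RealField) where
  open OverField ℝ
  open Spectra ℝ
  open Distances ℝ

  -- D is an arbitrary block on X, extended by a diagonal of signs.
  record BlockDiagonal {n} (D : Matrix ℝ n n) (X : Fin n → Bool) : Set where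
    field
      off  : ∀ u v → X u ∧ X v ≡ false → u ≢ v → D u v ≈ 0#
      sign : ∀ u → X u ≡ false → D u u *ᴿ D u u ≈ 1#

    sign≉0 : ∀ u → X u ≡ false → ¬ D u u ≈ 0#
    sign≉0 u u∉X eq = R.0≉1 (R.trans (R.sym (R.trans (R.*-congʳ eq) (R.zeroˡ (D u u)))) (sign u u∉X))

    splits : ∀ b → X b ≡ false → Splits D b
    splits b b∉X = record
      { row      = λ v v≢b → off b v (∧-falseˡ b∉X) (v≢b ∘ sym)
      ; column   = λ v v≢b → off v b (∧-falseʳ b∉X) v≢b
      ; diagonal = sign≉0 b b∉X }

    column-· : ∀ (A : Matrix ℝ n n) v → X v ≡ false → ∀ u → (A · λ b → D b v) u ≈ A u v *ᴿ D v v
    column-· A v v∉X u = ∑ᴿ-single _ v λ b b≢v → R.trans (R.*-congˡ (off b v (∧-falseʳ v∉X) b≢v)) (R.zeroʳ (A u b))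

  ᵀ-blockDiagonal : ∀ {n} {D : Matrix ℝ n n} {X} → BlockDiagonal D X → BlockDiagonal (D ᵀ) X
  ᵀ-blockDiagonal {X = X} block = record
    { off = λ u v h u≢v → off v u (trans (∧-comm (X v) (X u)) h) (u≢v ∘ sym) ; sign = sign }
    where open BlockDiagonal block

  module Switched {n} {D : Matrix ℝ n n} {X : Fin n → Bool} (block : BlockDiagonal D X) {g h : Rel n}
    (h≈ : ∀ i j → ⟦ h i j ⟧ ≈ conj ℝ D (adjᴿ g) i j) where
    open BlockDiagonal block

    outside-column : ∀ v → X v ≡ false → ∀ l → ⟦ h l v ⟧ ≈ ∑ᴿ (λ a → D a l *ᴿ (⟦ g a v ⟧ *ᴿ D v v))
    outside-column v v∉X l = R.trans (h≈ l v) (R.trans (conj-column D (adjᴿ g) l v)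
      (·-congˡ (D ᵀ) (column-· (adjᴿ g) v v∉X) l))

    -- Conjugation multiplies such an entry by two nonzero diagonal entries of `D`, and among 0 and
    -- 1 vanishing determines the entry.
    outside-unchanged : ∀ u v → X u ≡ false → X v ≡ false → h u v ≡ g u v
    outside-unchanged u v u∉X v∉X = compare (g u v) (h u v) (R.trans (outside-column v v∉X u)
      (∑ᴿ-single _ u λ a a≢u → R.trans (R.*-congʳ (off a u (∧-falseʳ u∉X) a≢u)) (R.zeroˡ _)))
      where
      compare : ∀ b c → ⟦ c ⟧ ≈ D u u *ᴿ (⟦ b ⟧ *ᴿ D v v) → c ≡ b
      compare true  true  eq = refl
      compare false false eq = refl
      compare true  false eq = ⊥-elim (nonzero-* (sign≉0 u u∉X) (nonzero-* (R.0≉1 ∘ R.sym) (sign≉0 v v∉X)) (R.sym eq))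
      compare false true  eq = ⊥-elim (R.0≉1 (R.sym (R.trans eq (R.trans (R.*-congˡ (R.zeroˡ (D v v))) (R.zeroʳ (D u u))))))

    -- On X, only `x` contributes to the column of `h` at `v`, so `h l v` equals D x l · D v v. The
    -- factor D v v squares to 1 and can be moved across.
    single-neighbour-row : ∀ v x → X v ≡ false → g x v ≡ true → (∀ y → X y ∧ g y v ≡ true → y ≡ x) →
      ∀ l → X l ≡ true → D x l ≈ ⟦ h l v ⟧ *ᴿ D v v
    single-neighbour-row v x v∉X gxv unique l l∈X = begin
      D x l                                ≈⟨ R.*-identityʳ (D x l) ⟨
      D x l *ᴿ 1#                          ≈⟨ R.*-congˡ (sign v v∉X) ⟨
      D x l *ᴿ (D v v *ᴿ D v v)            ≈⟨ R.*-assoc (D x l) (D v v) (D v v) ⟨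
      D x l *ᴿ D v v *ᴿ D v v              ≈⟨ R.*-congʳ (R.*-congˡ (R.*-identityˡ (D v v))) ⟨
      D x l *ᴿ (1# *ᴿ D v v) *ᴿ D v v      ≡⟨ cong (λ b → D x l *ᴿ (⟦ b ⟧ *ᴿ D v v) *ᴿ D v v) gxv ⟨
      D x l *ᴿ (⟦ g x v ⟧ *ᴿ D v v) *ᴿ D v v
                                           ≈⟨ R.*-congʳ (R.trans (outside-column v v∉X l) (∑ᴿ-single _ x others)) ⟨
      ⟦ h l v ⟧ *ᴿ D v v                   ∎
      where
      others : ∀ a → a ≢ x → D a l *ᴿ (⟦ g a v ⟧ *ᴿ D v v) ≈ 0#
      others a a≢x with g a v in gav | X a in Xa
      ... | false | _     = R.trans (R.*-congˡ (R.zeroˡ (D v v))) (R.zeroʳ (D a l))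
      ... | true  | true  = contradiction (unique a (∧-true Xa gav)) a≢x
      ... | true  | false = R.trans (R.*-congʳ (off a l (∧-falseˡ Xa) (λ { refl → true≢false l∈X Xa }))) (R.zeroˡ _)

    -- D respects the partition into X and its complement, so the block of A outside X can be erased on both sides.
    touching-conj : ∀ i j → ⟦ (h touching X) i j ⟧ ≈ conj ℝ D (adjᴿ (g touching X)) i j
    touching-conj i j = R.trans (pointwise (X i ∨ X j) refl) (R.sym (conj-∑ (adjᴿ (g touching X))))
      where
      conj-∑ : ∀ A → conj ℝ D A i j ≈ ∑ᴿ (λ a → ∑ᴿ λ b → D a i *ᴿ (A a b *ᴿ D b j))
      conj-∑ A = R.trans (sumℝ-∑ᴿ (λ a → sumℝ ℝ n λ b → D a i *ᴿ (A a b *ᴿ D b j)))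
        (∑ᴿ-cong λ a → sumℝ-∑ᴿ (λ b → D a i *ᴿ (A a b *ᴿ D b j)))
      left-zero : ∀ {a c} → X a ∧ X i ≡ false → a ≢ i → D a i *ᴿ c ≈ 0#
      left-zero {a} {c} h a≢i = R.trans (R.*-congʳ (off a i h a≢i)) (R.zeroˡ c)
      right-zero : ∀ {b c d} → X b ∧ X j ≡ false → b ≢ j → c *ᴿ (d *ᴿ D b j) ≈ 0#
      right-zero {b} {c} {d} h b≢j = R.trans (R.*-congˡ (R.trans (R.*-congˡ (off b j h b≢j)) (R.zeroʳ d))) (R.zeroʳ c)
      term : Rel n → Fin n → Fin n → Carrier
      term r a b = D a i *ᴿ (⟦ r a b ⟧ *ᴿ D b j)
      term-touching : X i ∨ X j ≡ true → ∀ a b → term g a b ≈ term (g touching X) a b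
      term-touching ij∈X a b with X a ∨ X b in ab
      ... | true  = R.reflexive (cong (λ c → D a i *ᴿ (⟦ c ⟧ *ᴿ D b j)) (sym (∧-identityʳ (g a b))))
      ... | false = [ (λ i∈X → R.trans (left-zero (∧-falseˡ a∉X) λ { refl → true≢false i∈X a∉X })
                                 (R.sym (left-zero (∧-falseˡ a∉X) λ { refl → true≢false i∈X a∉X })))
                    , (λ j∈X → R.trans (right-zero (∧-falseˡ b∉X) λ { refl → true≢false j∈X b∉X })
                                 (R.sym (right-zero (∧-falseˡ b∉X) λ { refl → true≢false j∈X b∉X }))) ]′ (∨-true (X i) ij∈X)
        where
        a∉X : X a ≡ false
        a∉X = ∨-conicalˡ (X a) (X b) ab
        b∉X : X b ≡ false
        b∉X = ∨-conicalʳ (X a) (X b) ab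
        ∨-true : ∀ b {c} → b ∨ c ≡ true → b ≡ true ⊎ c ≡ true
        ∨-true true  _ = inj₁ refl
        ∨-true false e = inj₂ e
      term-outside : X i ∨ X j ≡ false → ∀ a b → term (g touching X) a b ≈ 0#
      term-outside ij∉X a b with a ≟ i | b ≟ j
      ... | no a≢i   | _        = left-zero (∧-falseʳ (∨-conicalˡ (X i) (X j) ij∉X)) a≢i
      ... | yes _    | no b≢j   = right-zero (∧-falseʳ (∨-conicalʳ (X i) (X j) ij∉X)) b≢j
      ... | yes refl | yes refl = R.trans (R.*-congˡ (R.trans (R.*-congʳ (R.reflexive (cong ⟦_⟧ (touching-false {g = g} {X} ij∉X))))
                                    (R.zeroˡ (D j j)))) (R.zeroʳ (D i i))
      pointwise : ∀ c → X i ∨ X j ≡ c → ⟦ (h touching X) i j ⟧ ≈ ∑ᴿ (λ a → ∑ᴿ (term (g touching X) a))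
      pointwise true  ij∈X = R.trans (R.reflexive (cong ⟦_⟧ (touching-true {g = h} {X} ij∈X)))
        (R.trans (h≈ i j) (R.trans (conj-∑ (adjᴿ g)) (∑∑ᴿ-cong (term-touching ij∈X))))
      pointwise false ij∉X = R.trans (R.reflexive (cong ⟦_⟧ (touching-false {g = h} {X} ij∉X)))
        (R.sym (∑ᴿ-zero λ a → ∑ᴿ-zero (term-outside ij∉X a)))

  module TwoRegular {n} {D : Matrix ℝ n n} (DᵀD : Isometric D) {X : Fin n → Bool} (block : BlockDiagonal D X) (G H : Graph n)
    (connected : ∀ u v → Walk (adj G) u v) (h≈ : ∀ i j → ⟦ adj H i j ⟧ ≈ conj ℝ D (adjᴿ (adj G)) i j)
    (X⊆S : X ⊆ support (adj G touching X))
    (2-regular : ∀ u → countFin n ((adj G touching X) u) ≡ 2 * # support (adj G touching X) u) where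

    private
      a h : Rel n
      a = adj G touching X
      h = adj H touching X

    open BlockDiagonal block
    open Switched block {adj G} {adj H} h≈
    open Conjugate DᵀD {a} {h} touching-conj

    private
      S : Fin n → Bool
      S = support a

      a-sym : Symmetric a
      a-sym = touching-sym {X = X} (adj-sym G)
      a-irrefl : Irreflexive a
      a-irrefl = touching-irrefl {g = adj G} {X} (adj-irrefl G)
      h-sym : Symmetric h
      h-sym = touching-sym {X = X} (adj-sym H)
      h-irrefl : Irreflexive h
      h-irrefl = touching-irrefl {g = adj H} {X} (adj-irrefl H)

    degree-on-S : ∀ {u} → S u ≡ true → countFin n (a u) ≡ 2
    degree-on-S {u} u∈S = trans (2-regular u) (cong (λ b → 2 * # b) u∈S)

    -- `D` commutes with the degree matrix of `a`: its block on X meets only vertices of degree 2,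
    -- and the rest of it is diagonal.
    degrees : ∀ u → countFin n (h u) ≡ countFin n (a u)
    degrees = same-degrees a-sym commutes
      where
      commutes : ∀ u v → D u v *ᴿ degᴿ a v ≈ degᴿ a u *ᴿ D u v
      commutes u v with u ≟ v | X u ∧ X v in uv
      ... | yes refl | _     = R.*-comm (D u u) (degᴿ a u)
      ... | no u≢v   | false = R.trans (R.trans (R.*-congʳ (off u v uv u≢v)) (R.zeroˡ _))
                                 (R.sym (R.trans (R.*-congˡ (off u v uv u≢v)) (R.zeroʳ _)))
      ... | no u≢v   | true  = R.trans (R.*-comm (D u v) (degᴿ a v)) (R.*-congʳ (R.trans (two (∧-conicalʳ (X u) (X v) uv))
                                 (R.sym (two (∧-conicalˡ (X u) (X v) uv)))))
        where
        two : ∀ {w} → X w ≡ true → degᴿ a w ≈ natℝ ℝ 2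
        two {w} w∈X = R.trans (∑ᴿ-count (a w)) (R.reflexive (cong (natℝ ℝ) (degree-on-S (X⊆S w w∈X))))

    h⊆S : ∀ u v → h u v ≡ true → S u ≡ true
    h⊆S u v e = trans (cong positive? (sym (degrees u))) (support-edge h u v e)

    line-at : ∀ {r : Rel n} → Symmetric r → Irreflexive r → (∀ u → countFin n (r u) ≡ countFin n (a u)) →
              ∀ {b} → S b ≡ true → Σ (Line r) λ γ → at γ 0ℤ ≡ b
    line-at {r} r-sym r-irrefl r-deg {b} b∈S
      with x , e ← count-witness (r b) (subst (0 <_) (sym (trans (r-deg b) (degree-on-S b∈S))) (s≤s z≤n))
      = degree2-line r-sym r-irrefl (λ u v e → trans (r-deg u) (degree-on-S (trans (cong positive? (sym (r-deg u))) (support-edge r u v e)))) b x e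

    -- `N` is a set of common vertices meeting every cycle. It is a parameter because two choices
    -- occur: all touched vertices outside X, or one arbitrary vertex when X is everything.
    isomorphic-from : ∀ N → N ⊆ S → (∀ u → S u ≡ true → ∃ λ b → N b ≡ true × Walk a b u) →
      (∀ u → X u ≡ false → N u ≡ true ⊎ S u ≡ false) →
      DistancePreserving N a h → DistancePreserving N h a → ¬ ¬ Isomorphic G H
    isomorphic-from N N⊆S cover fixed a⇒h h⇒a k =
      cycles-isomorphic a-sym a-irrefl h-sym h-irrefl (support-edge a) h⊆S cover
        (λ b b∈N → line-at a-sym a-irrefl (λ _ → refl) (N⊆S b b∈N))
        (λ b b∈N → line-at h-sym h-irrefl degrees (N⊆S b b∈N))
        a⇒h h⇒a λ { (φ , φ-iso , φ-fixes) → k (φ , extend φ φ-iso λ u u∉X → φ-fixes u (fixed u u∉X)) }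
      where
      extend : ∀ φ → (∀ u v → h (φ ⟨$⟩ʳ u) (φ ⟨$⟩ʳ v) ≡ a u v) → (∀ u → X u ≡ false → φ ⟨$⟩ʳ u ≡ u) →
               ∀ u v → adj H (φ ⟨$⟩ʳ u) (φ ⟨$⟩ʳ v) ≡ adj G u v
      extend φ φ-iso fixes u v = case (X u ∨ X v) refl
        where
        -- A bijection that fixes the complement of X pointwise maps X to X.
        φ-X : ∀ w → X (φ ⟨$⟩ʳ w) ≡ X w
        φ-X w with X w in w∈ | X (φ ⟨$⟩ʳ w) in φw∈
        ... | true  | true  = refl
        ... | false | false = refl
        ... | false | true  = ⊥-elim (true≢false φw∈ (trans (cong X (fixes w w∈)) w∈))
        ... | true  | false = ⊥-elim (true≢false w∈ (trans (cong X (sym φw≡w)) φw∈))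
          where
          φw≡w : φ ⟨$⟩ʳ w ≡ w
          φw≡w = trans (sym (inverseˡ φ)) (trans (cong (φ ⟨$⟩ˡ_) (fixes _ φw∈)) (inverseˡ φ))
        case : ∀ c → X u ∨ X v ≡ c → adj H (φ ⟨$⟩ʳ u) (φ ⟨$⟩ʳ v) ≡ adj G u v
        case true uv = trans (sym (touching-true {g = adj H} {X} (trans (cong₂ _∨_ (φ-X u) (φ-X v)) uv)))
          (trans (φ-iso u v) (touching-true {g = adj G} {X} uv))
        case false uv = trans (cong₂ (adj H) (fixes u u∉X) (fixes v v∉X)) (outside-unchanged u v u∉X v∉X)
          where
          u∉X = ∨-conicalˡ (X u) (X v) uv
          v∉X = ∨-conicalʳ (X u) (X v) uv

    N : Fin n → Bool
    N u = S u ∧ not (X u)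

    N⇒outside : ∀ {u} → N u ≡ true → X u ≡ false
    N⇒outside {u} u∈N with X u | ∧-conicalʳ (S u) _ u∈N
    ... | false | _ = refl

    outside⇒N : ∀ u → X u ≡ false → N u ≡ true ⊎ S u ≡ false
    outside⇒N u u∉X with S u
    ... | false = inj₂ refl
    ... | true  rewrite u∉X = inj₁ refl

    step-touching : ∀ {u v} → X u ≡ true → adj G u v ≡ true → a u v ≡ true
    step-touching {u} {v} u∈X e = trans (touching-true {g = adj G} {X} (cong (_∨ X v) u∈X)) e

    -- Up to and including its first step out of X, a walk in `G` uses only edges that meet X.
    -- Connectedness of `G` thus yields a common vertex on every cycle.
    exit : ∀ {u v} → Walk (adj G) u v → X u ≡ true → X v ≡ false → ∃ λ b → N b ≡ true × Walk a u b
    exit here u∈X v∉X = ⊥-elim (true≢false u∈X v∉X)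
    exit {u} (step {v = v} e w) u∈X v∉X = go (X v) refl
      where
      u→v : a u v ≡ true
      u→v = step-touching u∈X e
      go : ∀ c → X v ≡ c → ∃ λ b → N b ≡ true × Walk a u b
      go true  v∈X with b , b∈N , v→b ← exit w v∈X v∉X = b , b∈N , step u→v v→b
      go false v∉X = v , ∧-true (support-edge a v u (trans (a-sym v u) u→v)) (cong not v∉X) , step u→v here

    isomorphic-outside : ((∃ λ y → N y ≡ true) ⊎ (∀ u → X u ≡ false)) → ¬ ¬ Isomorphic G H
    isomorphic-outside reach = isomorphic-from N (λ u → ∧-conicalˡ (S u) _) cover outside⇒N
      (splits⇒distance-preserving {D = D} {a} {h} intertwines a-sym a-irrefl h-sym h-irrefl
        λ b b∈N → splits b (N⇒outside b∈N))
      (splits⇒distance-preserving {D = D ᵀ} {h} {a} intertwinesᵀ h-sym h-irrefl a-sym a-irrefl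
        λ b b∈N → BlockDiagonal.splits (ᵀ-blockDiagonal block) b (N⇒outside b∈N))
      where
      cover : ∀ u → S u ≡ true → ∃ λ b → N b ≡ true × Walk a b u
      cover u u∈S = go (X u) refl reach
        where
        go : ∀ c → X u ≡ c → ((∃ λ y → N y ≡ true) ⊎ (∀ u → X u ≡ false)) → ∃ λ b → N b ≡ true × Walk a b u
        go false u∉X _ = u , ∧-true u∈S (cong not u∉X) , here
        go true u∈X (inj₂ X≡∅) = ⊥-elim (true≢false u∈X (X≡∅ u))
        go true u∈X (inj₁ (y , y∈N)) with b , b∈N , u→b ← exit (connected u y) u∈X (N⇒outside y∈N)
          = b , b∈N , walk-reverse a-sym u→b

    -- No vertex outside X can be reached, so both graphs are single cycles; any vertex x serves as the base.
    isomorphic-inside : ∀ x → X x ≡ true → (∀ u → N u ≢ true) → ¬ ¬ Isomorphic G H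
    isomorphic-inside x x∈X N≡∅ k = ¬¬-choice (λ u → ¬¬-excluded-middle {A = Walk h x u}) λ walk? →
      isomorphic-from base base⊆S (λ u _ → x , base-x , a-walk u) (λ u u∉X → ⊥-elim (true≢false (X-all u) u∉X))
        -- The only common vertex is `x` itself, so preserving distances means preserving the return
        -- times of the cycle.
        (λ γ η eq₀ γ∈ t w w∈ m → subst (Meets η t) (trans (base-≡ γ∈) (sym (base-≡ w∈)))
          (period-preserved DᵀD {a} {h} intertwines a-sym a-irrefl h-sym h-irrefl γ η
            (λ u → on-line a-sym a-irrefl γ (a-walk u) (0ℤ , base-≡ γ∈)) eq₀ t
            (subst (Meets γ t) (trans (base-≡ w∈) (sym (base-≡ γ∈))) m)))
        (λ η γ eq₀ η∈ t w w∈ m → subst (Meets γ t) (trans (base-≡ η∈) (sym (base-≡ w∈)))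
          (period-preserved DDᵀ {h} {a} intertwinesᵀ h-sym h-irrefl a-sym a-irrefl η γ
            (λ u → on-line h-sym h-irrefl η (h-walk walk? u) (0ℤ , base-≡ η∈)) eq₀ t
            (subst (Meets η t) (trans (base-≡ w∈) (sym (base-≡ η∈))) m))) k
      where
      base : Fin n → Bool
      base u = does (u ≟ x)
      base-≡ : ∀ {u} → base u ≡ true → u ≡ x
      base-≡ {u} = from-does (u ≟ x)
      base-x : base x ≡ true
      base-x = dec-true (x ≟ x) refl
      inside : ∀ {u v} → Walk (adj G) u v → X u ≡ true → X v ≡ true × Walk a u v
      inside here u∈X = u∈X , here
      inside {u} (step {v = v} e w) u∈X = go (X v) refl
        where
        u→v : a u v ≡ true
        u→v = step-touching u∈X e
        go : ∀ c → X v ≡ c → X _ ≡ true × Walk a u _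
        go true  v∈X = map₂ (step u→v) (inside w v∈X)
        go false v∉X = contradiction (∧-true (support-edge a v u (trans (a-sym v u) u→v)) (cong not v∉X)) (N≡∅ v)
      X-all : ∀ u → X u ≡ true
      X-all u = proj₁ (inside (connected x u) x∈X)
      a-walk : ∀ u → Walk a x u
      a-walk u = proj₂ (inside (connected x u) x∈X)
      base⊆S : base ⊆ S
      base⊆S u _ = X⊆S u (X-all u)
      -- Equal degrees only make `h` a union of cycles; that it is a single one comes from the
      -- simple eigenvalue 2 of `a`.
      h-walk : (∀ u → Dec (Walk h x u)) → ∀ u → Walk h x u
      h-walk walk? u = from-does (walk? u) (regular-connected DᵀD {a} {h} intertwines a-sym 2
        (λ u → degree-on-S (X⊆S u (X-all u))) (λ u → trans (degrees u) (degree-on-S (X⊆S u (X-all u))))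
        x a-walk (λ u → does (walk? u)) (dec-true (walk? x) here) closed u)
        where
        closed : ∀ u v → h u v ≡ true → does (walk? u) ≡ does (walk? v)
        closed u v e with walk? u | walk? v
        ... | yes _   | yes _   = refl
        ... | no _    | no _    = refl
        ... | yes x→u | no ¬x→v = contradiction (walk-snoc x→u e) ¬x→v
        ... | no ¬x→u | yes x→v = contradiction (walk-snoc x→v (trans (h-sym v u) e)) ¬x→u

    isomorphic : ¬ ¬ Isomorphic G H
    isomorphic with any? (λ u → N u ≟ᵇ true) | any? (λ u → X u ≟ᵇ true)
    ... | yes y∈N | _ = isomorphic-outside (inj₁ y∈N)
    ... | no N≡∅  | yes (x , x∈X) = isomorphic-inside x x∈X λ u u∈N → N≡∅ (u , u∈N)
    -- With X empty there is no vertex from which an exit has to be found.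
    ... | no _    | no X≡∅ = isomorphic-outside (inj₂ λ u → ¬-not λ u∈X → X≡∅ (u , u∈X))

-- Relabelling vertices so that the switching set comes first

reindex : ∀ {n} → Graph n → Permutation′ n → Graph n
reindex G π = record
  { adj    = λ u v → adj G (π ⟨$⟩ʳ u) (π ⟨$⟩ʳ v)
  ; sym    = λ u v → adj-sym G (π ⟨$⟩ʳ u) (π ⟨$⟩ʳ v)
  ; irrefl = λ u → adj-irrefl G (π ⟨$⟩ʳ u) }

reindex-connected : ∀ {n} (G : Graph n) π → (∀ u v → Walk (adj G) u v) → ∀ u v → Walk (adj (reindex G π)) u v
reindex-connected G π walk u v = subst₂ (Walk (adj (reindex G π))) (inverseˡ π) (inverseˡ π)
  (walk-map (π ⟨$⟩ˡ_) (λ x y e → trans (cong₂ (adj G) (inverseʳ π) (inverseʳ π)) e) (walk (π ⟨$⟩ʳ u) (π ⟨$⟩ʳ v)))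

reindex-isomorphic : ∀ {n} (G H : Graph n) π ψ → Isomorphic (reindex G π) (reindex H ψ) → Isomorphic G H
reindex-isomorphic G H π ψ (φ , φ-iso) = flip π ∘ₚ φ ∘ₚ ψ , λ u v →
  trans (φ-iso (π ⟨$⟩ˡ u) (π ⟨$⟩ˡ v)) (cong₂ (adj G) (inverseʳ π) (inverseʳ π))

module _ {n} (G : Graph n) (π : Permutation′ n) (S : Subgraph (reindex G π)) where

  unindex : Subgraph G
  unindex = record
    { vert      = λ u → vert S (π ⟨$⟩ˡ u)
    ; edge      = λ u v → edge S (π ⟨$⟩ˡ u) (π ⟨$⟩ˡ v)
    ; edge-sym  = λ u v → edge-sym S _ _
    ; edge-adj  = λ u v e → trans (cong₂ (adj G) (sym (inverseʳ π)) (sym (inverseʳ π))) (edge-adj S _ _ e)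
    ; edge-vert = λ u v → edge-vert S _ _ }

  unindex-numVertices : numVertices unindex ≡ numVertices S
  unindex-numVertices = count-permute (flip π) (vert S)

  -- `numEdges` lists an edge by the order of its indices, which `π` need not respect. The degree
  -- sum treats both ends alike and is invariant.
  unindex-numEdges : numEdges unindex ≡ numEdges S
  unindex-numEdges = *-cancelˡ-≡ _ _ 2 (begin
    2 * numEdges unindex       ≡⟨ handshake unindex ⟨
    degSum (edge unindex)      ≡⟨ ∑-cong (λ u → ∑-permute (λ v → # edge S (π ⟨$⟩ˡ u) v) (flip π)) ⟨
    ∑ (λ u → ∑ λ v → # edge S (π ⟨$⟩ˡ u) v)
                               ≡⟨ ∑-permute (λ u → ∑ λ v → # edge S u v) (flip π) ⟨
    degSum (edge S)            ≡⟨ handshake S ⟩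
    2 * numEdges S             ∎)
    where open ≡-Reasoning

  unindex-connected : SubgraphConnected S → SubgraphConnected unindex
  unindex-connected conn u v u∈ v∈ = subst₂ (Walk (edge unindex)) (inverseʳ π) (inverseʳ π)
    (walk-map (π ⟨$⟩ʳ_) (λ x y e → trans (cong₂ (edge S) (inverseˡ π) (inverseˡ π)) e) (conn (π ⟨$⟩ˡ u) (π ⟨$⟩ˡ v) u∈ v∈))

-- The matrix Q ⊕ E and its integral rows

module DirectSum (ℝ : RealField) {k m : ℕ} where
  open OverField ℝ
  open Spectra ℝ
  open BlockSwitching ℝ

  switchSet : Fin (k + m) → Bool
  switchSet u = [ (λ _ → true) , (λ _ → false) ]′ (splitAt k u)

  data View : Fin (k + m) → Set where
    inside  : ∀ i → View (i ↑ˡ m)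
    outside : ∀ j → View (k ↑ʳ j)

  view : ∀ u → View u
  view u with splitAt k u in eq
  ... | inj₁ i = subst View (splitAt⁻¹-↑ˡ eq) (inside i)
  ... | inj₂ j = subst View (splitAt⁻¹-↑ʳ eq) (outside j)

  inside∈ : ∀ i → switchSet (i ↑ˡ m) ≡ true
  inside∈ i = cong [ (λ _ → true) , (λ _ → false) ]′ (splitAt-↑ˡ k i m)

  outside∉ : ∀ j → switchSet (k ↑ʳ j) ≡ false
  outside∉ j = cong [ (λ _ → true) , (λ _ → false) ]′ (splitAt-↑ʳ k m j)

  switchSet-view : ∀ u → switchSet u ≡ true → ∃ λ i → u ≡ i ↑ˡ m
  switchSet-view u u∈ with view u
  ... | inside i  = i , refl
  ... | outside j = ⊥-elim (true≢false u∈ (outside∉ j))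

  module _ (Q : Matrix ℝ k k) (E : Fin m → Bool) where

    private
      D : Matrix ℝ (k + m) (k + m)
      D = directSum ℝ Q E

    signᴿ : Fin m → Carrier
    signᴿ j = if E j then 1# else -ᴿ 1#

    D-inside : ∀ i j → D (i ↑ˡ m) (j ↑ˡ m) ≡ Q i j
    D-inside i j rewrite splitAt-↑ˡ k i m | splitAt-↑ˡ k j m = refl

    D-mixed : ∀ i j → D (i ↑ˡ m) (k ↑ʳ j) ≡ 0#
    D-mixed i j rewrite splitAt-↑ˡ k i m | splitAt-↑ʳ k m j = refl

    D-mixed′ : ∀ i j → D (k ↑ʳ j) (i ↑ˡ m) ≡ 0#
    D-mixed′ i j rewrite splitAt-↑ʳ k m j | splitAt-↑ˡ k i m = refl

    D-sign : ∀ j → D (k ↑ʳ j) (k ↑ʳ j) ≡ signᴿ j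
    D-sign j rewrite splitAt-↑ʳ k m j with j ≟ j
    ... | yes _   = refl
    ... | no  j≢j = contradiction refl j≢j

    D-off : ∀ i j → i ≢ j → D (k ↑ʳ i) (k ↑ʳ j) ≡ 0#
    D-off i j i≢j rewrite splitAt-↑ʳ k m i | splitAt-↑ʳ k m j with i ≟ j
    ... | yes i≡j = contradiction i≡j i≢j
    ... | no  _   = refl

    signᴿ² : ∀ j → signᴿ j *ᴿ signᴿ j ≈ 1#
    signᴿ² j with E j
    ... | true  = R.*-identityˡ 1#
    ... | false = R.trans (R.sym (-‿distribˡ-* 1# (-ᴿ 1#))) (R.trans (R.-‿cong (R.*-identityˡ (-ᴿ 1#))) (-‿involutive 1#))

    directSum-block : BlockDiagonal D switchSet
    directSum-block = record { off = λ u v → off (view u) (view v) ; sign = λ u → sign (view u) }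
      where
      off : ∀ {u v} → View u → View v → switchSet u ∧ switchSet v ≡ false → u ≢ v → D u v ≈ 0#
      off (inside i)  (inside j)  h _   = ⊥-elim (true≢false (∧-true (inside∈ i) (inside∈ j)) h)
      off (inside i)  (outside j) _ _   = R.reflexive (D-mixed i j)
      off (outside i) (inside j)  _ _   = R.reflexive (D-mixed′ j i)
      off (outside i) (outside j) _ u≢v = R.reflexive (D-off i j (u≢v ∘ cong (k ↑ʳ_)))
      sign : ∀ {u} → View u → switchSet u ≡ false → D u u *ᴿ D u u ≈ 1#
      sign (inside i)  u∉ = ⊥-elim (true≢false (inside∈ i) u∉)
      sign (outside j) _  = R.trans (R.*-cong (R.reflexive (D-sign j)) (R.reflexive (D-sign j))) (signᴿ² j)

    directSum-isometric : Orthogonal ℝ Q → Isometric D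
    directSum-isometric orth u v = R.trans (∑ᴿ-++ k (λ l → D l u *ᴿ D l v)) (go (view u) (view v))
      where
      ∑ᴿ-++ : ∀ p {q} (f : Fin (p + q) → Carrier) → ∑ᴿ f ≈ ∑ᴿ (λ i → f (i ↑ˡ q)) +ᴿ ∑ᴿ (λ j → f (p ↑ʳ j))
      ∑ᴿ-++ zero    f = R.sym (R.+-identityˡ _)
      ∑ᴿ-++ (suc p) f = R.trans (R.+-congˡ (∑ᴿ-++ p (f ∘ suc))) (R.sym (R.+-assoc _ _ _))
      zeroˡ′ : ∀ {x y} → x ≡ 0# → x *ᴿ y ≈ 0#
      zeroˡ′ {y = y} x≡0 = R.trans (R.*-congʳ (R.reflexive x≡0)) (R.zeroˡ y)
      zeroʳ′ : ∀ {x y} → y ≡ 0# → x *ᴿ y ≈ 0#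
      zeroʳ′ {x = x} y≡0 = R.trans (R.*-congˡ (R.reflexive y≡0)) (R.zeroʳ x)
      sum-zero : ∀ {x y} → x ≈ 0# → y ≈ 0# → x +ᴿ y ≈ 0#
      sum-zero x≈0 y≈0 = R.trans (R.+-cong x≈0 y≈0) (R.+-identityˡ 0#)
      distinct : ∀ i j → i ↑ˡ m ≢ k ↑ʳ j
      distinct i j eq = true≢false (inside∈ i) (trans (cong switchSet eq) (outside∉ j))
      diagonal-outside : ∀ j → ∑ᴿ (λ l → D (k ↑ʳ l) (k ↑ʳ j) *ᴿ D (k ↑ʳ l) (k ↑ʳ j)) ≈ 1#
      diagonal-outside j = R.trans (∑ᴿ-single _ j λ l l≢j → zeroˡ′ (D-off l j l≢j))
        (R.trans (R.*-cong (R.reflexive (D-sign j)) (R.reflexive (D-sign j))) (signᴿ² j))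
      go : ∀ {u v} → View u → View v →
        ∑ᴿ (λ i → D (i ↑ˡ m) u *ᴿ D (i ↑ˡ m) v) +ᴿ ∑ᴿ (λ j → D (k ↑ʳ j) u *ᴿ D (k ↑ʳ j) v) ≈ identity ℝ u v
      go (inside i) (inside j) = R.trans (R.+-cong (∑ᴿ-cong λ l → R.reflexive (cong₂ _*ᴿ_ (D-inside l i) (D-inside l j)))
          (∑ᴿ-zero λ l → zeroˡ′ (D-mixed′ i l)))
        (R.trans (R.+-identityʳ _) (R.trans (R.sym (sumℝ-∑ᴿ (λ l → Q l i *ᴿ Q l j))) (R.trans (orth i j) same)))
        where
        same : identity ℝ i j ≈ identity ℝ (i ↑ˡ m) (j ↑ˡ m)
        same with i ≟ j
        ... | yes refl = R.sym (δ-≡ (i ↑ˡ m))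
        ... | no  i≢j  = R.sym (δ-≢ (i≢j ∘ ↑ˡ-injective m i j))
      go (inside i) (outside j) = R.trans (sum-zero (∑ᴿ-zero λ l → zeroʳ′ (D-mixed l j)) (∑ᴿ-zero λ l → zeroˡ′ (D-mixed′ i l)))
        (R.sym (δ-≢ (distinct i j)))
      go (outside i) (inside j) = R.trans (sum-zero (∑ᴿ-zero λ l → zeroˡ′ (D-mixed l i)) (∑ᴿ-zero λ l → zeroʳ′ (D-mixed′ j l)))
        (R.sym (δ-≢ (distinct j i ∘ sym)))
      go (outside i) (outside j) = R.trans (R.+-congʳ (∑ᴿ-zero λ l → zeroˡ′ (D-mixed l i))) (R.trans (R.+-identityˡ _) (diagonal (i ≟ j)))
        where
        diagonal : Dec (i ≡ j) → ∑ᴿ (λ l → D (k ↑ʳ l) (k ↑ʳ i) *ᴿ D (k ↑ʳ l) (k ↑ʳ j)) ≈ identity ℝ (k ↑ʳ i) (k ↑ʳ j)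
        diagonal (yes refl) = R.trans (diagonal-outside i) (R.sym (δ-≡ (k ↑ʳ i)))
        diagonal (no i≢j)   = R.trans (∑ᴿ-zero zero-term) (R.sym (δ-≢ (i≢j ∘ ↑ʳ-injective k i j)))
          where
          zero-term : ∀ l → D (k ↑ʳ l) (k ↑ʳ i) *ᴿ D (k ↑ʳ l) (k ↑ʳ j) ≈ 0#
          zero-term l with l ≟ i
          ... | yes refl = zeroʳ′ (D-off l j i≢j)
          ... | no  l≢i  = zeroˡ′ (D-off l i l≢i)

    -- A vertex outside with a single neighbour i inside would make row i of Q, up to sign, a 0/1 vector.
    no-single-neighbour : NoIntegralRows ℝ Q → ∀ {g h : Rel (k + m)} →
      (∀ i j → ⟦ h i j ⟧ ≈ conj ℝ D (adjᴿ g) i j) →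
      ∀ v → switchSet v ≡ false → countFin (k + m) (λ u → switchSet u ∧ g u v) ≢ 1
    no-single-neighbour nonint {g} {h} h≈ v v∉ one
      with x , x∈ , unique ← count≡1-unique (λ u → switchSet u ∧ g u v) one
      with i , refl ← switchSet-view x (∧-conicalˡ (switchSet x) _ x∈)
      = nonint i λ j → integral v v∉ (h (j ↑ˡ m) v) (R.trans (R.reflexive (sym (D-inside i j)))
          (Switched.single-neighbour-row directSum-block {g} {h} h≈ v (i ↑ˡ m) v∉ (∧-conicalʳ (switchSet (i ↑ˡ m)) _ x∈)
            unique (j ↑ˡ m) (inside∈ j)))
      where
      integral : ∀ v → switchSet v ≡ false → ∀ b {q} → q ≈ ⟦ b ⟧ *ᴿ D v v → IsInteger ℝ q
      integral v v∉ false {q} q≈ = 0 , inj₁ (R.trans q≈ (R.zeroˡ (D v v)))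
      integral v v∉ true  {q} q≈ with view v
      ... | inside i  = ⊥-elim (true≢false (inside∈ i) v∉)
      ... | outside j = signed (E j) (R.trans q≈ (R.trans (R.*-identityˡ _) (R.reflexive (D-sign j))))
        where
        one≈ : 1# ≈ natℝ ℝ 1
        one≈ = R.sym (R.+-identityʳ 1#)
        signed : ∀ e → q ≈ (if e then 1# else -ᴿ 1#) → IsInteger ℝ q
        signed true  eq = 1 , inj₁ (R.trans eq one≈)
        signed false eq = 1 , inj₂ (R.trans eq (R.-‿cong one≈))

switchSet-size : ∀ k m (ℝ : RealField) → countFin (k + m) (DirectSum.switchSet ℝ {k} {m}) ≡ k
switchSet-size k m ℝ = go k
  where
  open DirectSum ℝ
  none : ∀ m → countFin m (λ _ → false) ≡ 0
  none zero    = refl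
  none (suc m) = none m
  shift-suc : ∀ k (u : Fin (k + m)) → switchSet {suc k} (suc u) ≡ switchSet {k} u
  shift-suc k u with splitAt k u
  ... | inj₁ _ = refl
  ... | inj₂ _ = refl
  go : ∀ k → countFin (k + m) (switchSet {k} {m}) ≡ k
  go zero    = none m
  go (suc k) = cong suc (trans (count-cong (shift-suc k)) (go k))

theorem3p1 : (ℝ : RealField) (k m : ℕ) (G : Graph (k + m)) (Q : Matrix ℝ k k) →
    Connected G → MinDegreeAtLeast 2 G →
    Orthogonal ℝ Q → NoIntegralRows ℝ Q →
    (H : Graph (k + m)) → QSwitching ℝ Q G H → ¬ Isomorphic G H →
    Σ (Subgraph G) λ S →
    SubgraphConnected S × (numVertices S ≤ 2 * k + 1) × (numVertices S < numEdges S)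
theorem3p1 ℝ k m G Q (_ , connected) mindeg orth nonint H (π , ψ , E , switching) G≇H =
  [ (λ { (S , conn , size , excess) → unindex G π S , unindex-connected G π S conn
        , subst₂ _≤_ (sym (unindex-numVertices G π S)) (cong (λ x → 2 * x + 1) (switchSet-size k m ℝ)) size
        , subst₂ _<_ (sym (unindex-numVertices G π S)) (sym (unindex-numEdges G π S)) excess })
  , (λ 2-regular → ⊥-elim (BlockSwitching.TwoRegular.isomorphic ℝ (directSum-isometric Q E orth) (directSum-block Q E)
        Gπ Hψ (reindex-connected G π connected) switching X⊆S 2-regular (G≇H ∘ reindex-isomorphic G H π ψ))) ]′
  (sparse⇒2-regular Gπ X 2≤deg X⊆S)
  where
  open DirectSum ℝ {k} {m}
  Gπ Hψ : Graph (k + m)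
  Gπ = reindex G π
  Hψ = reindex H ψ
  X : Fin (k + m) → Bool
  X = switchSet
  a : Rel (k + m)
  a = adj Gπ touching X
  -- A vertex of X keeps all its edges in `a`, so the minimum degree of `G` applies directly.
  2≤deg-inside : ∀ u → X u ≡ true → 2 ≤ countFin (k + m) (a u)
  2≤deg-inside u u∈X = subst (2 ≤_)
    (trans (sym (count-permute π (adj G (π ⟨$⟩ʳ u))))
      (count-cong λ v → sym (touching-true {g = adj Gπ} {X} (cong (_∨ X v) u∈X))))
    (mindeg (π ⟨$⟩ʳ u))
  X⊆S : X ⊆ support a
  X⊆S u u∈X with countFin (k + m) (a u) | 2≤deg-inside u u∈X
  ... | suc d | _ = refl
  2≤deg : ∀ u → support a u ≡ true → 2 ≤ countFin (k + m) (a u)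
  2≤deg u u∈S = by-side (X u) refl
    where
    by-side : ∀ b → X u ≡ b → 2 ≤ countFin (k + m) (a u)
    by-side true  u∈X = 2≤deg-inside u u∈X
    -- Outside X the `a`-degree is the number of neighbours in X, so degree 1 is the case that an
    -- integral row excludes.
    by-side false u∉X = at-least-2 (countFin (k + m) (a u)) u∈S λ deg≡1 →
      no-single-neighbour Q E nonint switching u u∉X (trans (count-cong same) deg≡1)
      where
      same : ∀ v → X v ∧ adj Gπ v u ≡ a u v
      same v = trans (∧-comm (X v) _) (cong₂ _∧_ (adj-sym Gπ v u) (cong (_∨ X v) (sym u∉X)))
      at-least-2 : ∀ d → positive? d ≡ true → d ≢ 1 → 2 ≤ d
      at-least-2 1             _ d≢1 = contradiction refl d≢1
      at-least-2 (suc (suc d)) _ _   = s≤s (s≤s z≤n)
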